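{- Let $\mathbb F_q$ be a finite field of characteristic two. Let $\sigma\in\mathbb F_q$ have absolute trace $1$, and if $q$ is a square let $\theta$ be a non-cube in $\mathbb F_q$. Then any cubic rational expression $R(x)$ over $\mathbb F_q$ is equivalent over $\mathbb F_q$ to precisely one of the following: (i) $x^3$, with ramification indices $(3,3)$; (ii) $\dfrac{x^3+\sigma x+\sigma}{x^2+x+\sigma+1}$, with ramification indices $(3,3)$; (iii) $x^3+x^2$, with ramification indices $(3,2)$; (iv) $(x^3+1)/x$ or, only in case $q$ is a square, $(x^3+\theta)/x$ or $(x^3+\theta^2)/x$, all with ramification indices $(2)$; (v) $(x^3+c)/(x+c)$, with ramification indices $(2,2)$, for a unique $c\in\mathbb F_q\setminus\mathbb F_2$; (vi) $\dfrac{x^3+bx^2+\sigma x+(b+1)\sigma}{x^2+x+b+1+\sigma}$, with ramification indices $(2,2)$, for a unique $b\in\mathbb F_q\setminus\mathbb F_2$.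
   Context: A rational expression $R(x)=g(x)/h(x)$ with $g,h$ coprime has degree $\max(\deg g,\deg h)$; cubic means degree $3$. The group $G(\mathbb F_q)=\mathrm{PGL}_2(\mathbb F_q)\times\mathrm{PGL}_2(\mathbb F_q)$, with $\mathrm{PGL}_2(\mathbb F_q)$ identified with the group of degree-one rational expressions (Möbius transformations) over $\mathbb F_q$ under composition, acts on $\mathbb F_q(x)$ by $(B,A)\cdot R(x)=B(R(A^{ -1}(x)))$; two expressions are equivalent over $\mathbb F_q$ if they lie in the same $G(\mathbb F_q)$-orbit. The absolute trace of $\sigma$ is $\sigma+\sigma^2+\sigma^4+\cdots+\sigma^{q/2}$. Viewing $R$ as a map $\mathbb P^1(\overline{\mathbb F}_q)\to\mathbb P^1(\overline{\mathbb F}_q)$, the ramification index $e_R(P)$ is the multiplicity of $P$ in the fibre $R^{ -1}(R(P))$; the listed ramification indices are the values $e_R(P)>1$ over all ramification points $P$. -}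

module Defs where

open import Level using (0ℓ)
open import Data.Nat as ℕ using (ℕ; zero; suc; _∸_; _⊔_; _≤_; _<_)
open import Data.Fin using (Fin)
open import Data.List as List using (List; []; _∷_; length; lookup)
open import Data.Product using (Σ; ∃; _×_; _,_)
open import Data.Sum using (_⊎_)
open import Data.Unit using (⊤)
open import Data.Empty using (⊥)
open import Relation.Nullary using (¬_)
open import Relation.Binary.PropositionalEquality using (_≡_)
open import Algebra.Bundles using (CommutativeRing)
open import Algebra.Morphism.Structures using (module RingMorphisms)

record IsField (F : CommutativeRing 0ℓ 0ℓ) : Set where
  open CommutativeRing F
  field
    1≉0     : ¬ (1# ≈ 0#)
    inverse : ∀ x → ¬ (x ≈ 0#) → ∃ λ y → x * y ≈ 1#

HasSize : (F : CommutativeRing 0ℓ 0ℓ) → ℕ → Set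
HasSize F q = Σ (Fin q → Carrier) λ f →
    (∀ i j → f i ≈ f j → i ≡ j) × (∀ x → ∃ λ i → f i ≈ x)
  where open CommutativeRing F

IsSquareℕ : ℕ → Set
IsSquareℕ q = ∃ λ m → m ℕ.* m ≡ q

IsRingHom : (F K : CommutativeRing 0ℓ 0ℓ) →
            (CommutativeRing.Carrier F → CommutativeRing.Carrier K) → Set
IsRingHom F K ι = RingMorphisms.IsRingHomomorphism
                    (CommutativeRing.rawRing F) (CommutativeRing.rawRing K) ι

-- Polynomials (coefficient lists, constant term first) over a
-- commutative ring, and rational expressions.

module _ (F : CommutativeRing 0ℓ 0ℓ) where
  open CommutativeRing F

  Poly : Set
  Poly = List Carrier

  pow : Carrier → ℕ → Carrier
  pow x zero    = 1#
  pow x (suc m) = x * pow x m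

  coeff : Poly → ℕ → Carrier
  coeff []       i       = 0#
  coeff (x ∷ xs) zero    = x
  coeff (x ∷ xs) (suc i) = coeff xs i

  _≈ₚ_ : Poly → Poly → Set
  p ≈ₚ r = ∀ i → coeff p i ≈ coeff r i

  _+ₚ_ : Poly → Poly → Poly
  []       +ₚ ys       = ys
  (x ∷ xs) +ₚ []       = x ∷ xs
  (x ∷ xs) +ₚ (y ∷ ys) = (x + y) ∷ (xs +ₚ ys)

  scale : Carrier → Poly → Poly
  scale a = List.map (a *_)

  _*ₚ_ : Poly → Poly → Poly
  []       *ₚ ys = []
  (x ∷ xs) *ₚ ys = scale x ys +ₚ (0# ∷ (xs *ₚ ys))

  powₚ : Poly → ℕ → Poly
  powₚ p zero    = 1# ∷ []
  powₚ p (suc m) = p *ₚ powₚ p m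

  eval : Poly → Carrier → Carrier
  eval []       x = 0#
  eval (a ∷ as) x = a + x * eval as x

  -- deg p ≤ d (the zero polynomial has every degree bound)
  DegLe : Poly → ℕ → Set
  DegLe p d = ∀ i → d < i → coeff p i ≈ 0#

  _∣ₚ_ : Poly → Poly → Set
  p ∣ₚ r = ∃ λ u → (p *ₚ u) ≈ₚ r

  -- rational expression g(x)/h(x), as the pair (g , h)
  RatExpr : Set
  RatExpr = Poly × Poly

  Coprime : Poly → Poly → Set
  Coprime g h = ∀ d → d ∣ₚ g → d ∣ₚ h → DegLe d 0

  IsCubic : RatExpr → Set
  IsCubic (g , h) = ¬ (h ≈ₚ []) × Coprime g h × DegLe g 3 × DegLe h 3
                    × (¬ (coeff g 3 ≈ 0#) ⊎ ¬ (coeff h 3 ≈ 0#))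

  _≈ᵣ_ : RatExpr → RatExpr → Set
  (g₁ , h₁) ≈ᵣ (g₂ , h₂) = (g₁ *ₚ h₂) ≈ₚ (g₂ *ₚ h₁)

  -- Möbius transformation x ↦ (a x + b)/(c x + d), an element of PGL₂
  record Mob : Set where
    constructor mob
    field a b c d : Carrier

  Invertible : Mob → Set
  Invertible (mob a b c d) = ¬ ((a * d) + (- (b * c)) ≈ 0#)

  -- inverse Möbius transformation (adjugate matrix)
  invM : Mob → Mob
  invM (mob a b c d) = mob d (- b) (- c) a

  -- p((a x + b)/(c x + d)) · (c x + d)^N, computed from coefficient index i
  substFrom : ℕ → Mob → ℕ → Poly → Poly
  substFrom N M i [] = []
  substFrom N (mob a b c d) i (p ∷ ps) =
    scale p (powₚ (b ∷ a ∷ []) i *ₚ powₚ (d ∷ c ∷ []) (N ∸ i))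
    +ₚ substFrom N (mob a b c d) (suc i) ps

  compR : RatExpr → Mob → RatExpr
  compR (g , h) M = substFrom N M 0 g , substFrom N M 0 h
    where N = length g ⊔ length h

  compL : Mob → RatExpr → RatExpr
  compL (mob a b c d) (g , h) = (scale a g +ₚ scale b h) , (scale c g +ₚ scale d h)

  act : Mob → Mob → RatExpr → RatExpr
  act B A R = compL B (compR R (invM A))

  Equivalent : RatExpr → RatExpr → Set
  Equivalent R S = ∃ λ B → ∃ λ A → Invertible B × Invertible A × (S ≈ᵣ act B A R)

  AlgClosed : Set
  AlgClosed = ∀ (as : List Carrier) → 1 ≤ length as →
              ∃ λ x → eval (as List.++ (1# ∷ [])) x ≈ 0#

  -- absolute trace for |F| = 2^n : σ + σ^2 + σ^4 + … + σ^(2^(n-1))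
  trace : ℕ → Carrier → Carrier
  trace zero    σ = 0#
  trace (suc k) σ = trace k σ + pow σ (2 ℕ.^ k)

  NonCube : Carrier → Set
  NonCube θ = ¬ (∃ λ y → (y * y) * y ≈ θ)

module _ (K : CommutativeRing 0ℓ 0ℓ) where
  open CommutativeRing K

  -- points of ℙ¹(K): homogeneous coordinates (x : y), not both zero
  Pt : Set
  Pt = Σ (Carrier × Carrier) λ { (x , y) → ¬ (x ≈ 0# × y ≈ 0#) }

  SamePt : Pt → Pt → Set
  SamePt ((x₁ , y₁) , _) ((x₂ , y₂) , _) = x₁ * y₂ ≈ x₂ * y₁

  evalHom3 : Poly K → Carrier → Carrier → Carrier
  evalHom3 g x y = ((coeff K g 0 * pow K y 3 + coeff K g 1 * (x * pow K y 2))
                   + coeff K g 2 * (pow K x 2 * y)) + coeff K g 3 * pow K x 3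

  -- binary cubic forms are represented by their coefficient list
  -- (coefficient i belongs to X^i Y^(3-i)); products of binary forms
  -- are products of coefficient lists.
  -- (y₀X - x₀Y)^m divides the binary cubic form Φ (a form of degree 3,
  -- so necessarily m ≤ 3 when Φ ≠ 0)
  LinPowDivides : Pt → ℕ → Poly K → Set
  LinPowDivides ((x₀ , y₀) , _) m Φ =
    m ≤ 3 × ∃ λ Q → DegLe K Q (3 ∸ m) × (_≈ₚ_ K (_*ₚ_ K (powₚ K ((- x₀) ∷ y₀ ∷ []) m) Q) Φ)

  -- the binary cubic form cutting out the fibre R⁻¹(R(P)):
  -- H(P)·G(X,Y) - G(P)·H(X,Y)
  fibreForm : Poly K × Poly K → Pt → Poly K
  fibreForm (g , h) ((x₀ , y₀) , _) =
    _+ₚ_ K (scale K (evalHom3 h x₀ y₀) g) (scale K (- evalHom3 g x₀ y₀) h)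

  RamIndex : Poly K × Poly K → Pt → ℕ → Set
  RamIndex R P m = LinPowDivides P m (fibreForm R P)
                   × ¬ LinPowDivides P (suc m) (fibreForm R P)

module _ (F K : CommutativeRing 0ℓ 0ℓ)
         (ι : CommutativeRing.Carrier F → CommutativeRing.Carrier K) where

  baseChange : RatExpr F → Poly K × Poly K
  baseChange (g , h) = List.map ι g , List.map ι h

  RamProfile : RatExpr F → List ℕ → Set
  RamProfile R es = Σ (Fin (length es) → Pt K) λ Ps →
      (∀ i j → SamePt K (Ps i) (Ps j) → i ≡ j)
    × (∀ i → RamIndex K (baseChange R) (Ps i) (lookup es i))
    × (∀ P → (∀ i → ¬ SamePt K P (Ps i)) → RamIndex K (baseChange R) P 1)

module _ (F : CommutativeRing 0ℓ 0ℓ) (n : ℕ) where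
  open CommutativeRing F

  data NF : Set where
    nf-i nf-ii nf-iii nf-iv₁ : NF
    nf-iv₂ nf-iv₃ : IsSquareℕ (2 ℕ.^ n) → NF
    nf-v  : (c : Carrier) → ¬ (c ≈ 0#) → ¬ (c ≈ 1#) → NF
    nf-vi : (b : Carrier) → ¬ (b ≈ 0#) → ¬ (b ≈ 1#) → NF

  SameNF : NF → NF → Set
  SameNF nf-i nf-i = ⊤
  SameNF nf-ii nf-ii = ⊤
  SameNF nf-iii nf-iii = ⊤
  SameNF nf-iv₁ nf-iv₁ = ⊤
  SameNF (nf-iv₂ _) (nf-iv₂ _) = ⊤
  SameNF (nf-iv₃ _) (nf-iv₃ _) = ⊤
  SameNF (nf-v c _ _) (nf-v c' _ _) = c ≈ c'
  SameNF (nf-vi b _ _) (nf-vi b' _ _) = b ≈ b'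
  SameNF _ _ = ⊥

  module _ (σ θ : Carrier) where
    -- coefficient lists, constant term first
    nfForm : NF → RatExpr F
    nfForm nf-i   = (0# ∷ 0# ∷ 0# ∷ 1# ∷ []) , (1# ∷ [])
    nfForm nf-ii  = (σ ∷ σ ∷ 0# ∷ 1# ∷ []) , ((σ + 1#) ∷ 1# ∷ 1# ∷ [])
    nfForm nf-iii = (0# ∷ 0# ∷ 1# ∷ 1# ∷ []) , (1# ∷ [])
    nfForm nf-iv₁ = (1# ∷ 0# ∷ 0# ∷ 1# ∷ []) , (0# ∷ 1# ∷ [])
    nfForm (nf-iv₂ _) = (θ ∷ 0# ∷ 0# ∷ 1# ∷ []) , (0# ∷ 1# ∷ [])
    nfForm (nf-iv₃ _) = ((θ * θ) ∷ 0# ∷ 0# ∷ 1# ∷ []) , (0# ∷ 1# ∷ [])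
    nfForm (nf-v c _ _) = (c ∷ 0# ∷ 0# ∷ 1# ∷ []) , (c ∷ 1# ∷ [])
    nfForm (nf-vi b _ _) = (((b + 1#) * σ) ∷ σ ∷ b ∷ 1# ∷ []) , (((b + 1#) + σ) ∷ 1# ∷ 1# ∷ [])

  nfRam : NF → List ℕ
  nfRam nf-i   = 3 ∷ 3 ∷ []
  nfRam nf-ii  = 3 ∷ 3 ∷ []
  nfRam nf-iii = 3 ∷ 2 ∷ []
  nfRam nf-iv₁ = 2 ∷ []
  nfRam (nf-iv₂ _) = 2 ∷ []
  nfRam (nf-iv₃ _) = 2 ∷ []
  nfRam (nf-v _ _ _) = 2 ∷ 2 ∷ []
  nfRam (nf-vi _ _ _) = 2 ∷ 2 ∷ []

{-# OPTIONS --safe #-}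
module Submission where

open import Defs
open import Level using (0ℓ)
open import Algebra.Bundles using (CommutativeMonoid; CommutativeRing)
open import Algebra.Morphism.Structures using (module RingMorphisms)
import Algebra.Properties.CommutativeMonoid.Sum as CommutativeMonoidSum
import Algebra.Properties.CommutativeSemigroup as CommutativeSemigroupProperties
import Algebra.Properties.Ring as RingProperties
open import Data.Bool.Base using (Bool; true; false; not; _∧_; _xor_; T)
open import Data.Empty using (⊥; ⊥-elim)
open import Data.Fin.Base as Fin using (Fin; zero; suc)
open import Data.Fin.Patterns using (0F; 1F; 2F; 3F)
open import Data.Fin.Permutation using (Permutation; permutation)
import Data.Fin.Properties as Fin
open import Data.List.Base as List using (List; []; _∷_; length)
open import Data.Nat using (ℕ; _^_)
open import Data.Nat.Base as ℕ using (zero; suc; _≤_; _<_; z≤n; s≤s)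
import Data.Nat.Properties as ℕ
open import Data.Nat.Tactic.RingSolver using (solve-∀)
open import Data.Product using (Σ; ∃; _×_; _,_; proj₁; proj₂; uncurry)
open import Data.Sum.Base using (_⊎_; inj₁; inj₂)
open import Data.Unit.Base using (tt)
open import Data.Vec.Base as Vec using (Vec) renaming ([] to []ᵛ; _∷_ to _∷ᵛ_)
open import Data.Vec.Functional using (replicate)
open import Function.Base using (_∘_)
open import Relation.Binary.Definitions using (tri<; tri≈; tri>)
open import Relation.Binary.PropositionalEquality as ≡ using (_≡_; _≢_)
import Relation.Binary.Reasoning.Setoid as SetoidReasoning
open import Relation.Nullary using (¬_; Dec; yes; no; contradiction; ¬?)
open import Relation.Nullary.Decidable using (map′; _×-dec_)

-- A cubic expression g/h up to post-composition is the pencil spanned by the binary cubics g and h, and a pencil is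
-- its Plücker vector p_ij = g_i h_j - g_j h_i. In characteristic two its Wronskian is p₀₁ + Δ x² + p₂₃ x⁴ with
-- Δ = p₀₃ + p₁₂, the square of a quadratic form whose zeros are the ramification points, and the resultant Res of g and
-- h is a cubic form in the p_ij. Under PGL₂ and scaling, Δ is multiplied by some ν ≠ 0 and Res by ν³.
--
-- Existence. If Δ = 0 there is one ramification point; at ∞ the pencil becomes ⟨x³ + β, x⟩, with β determined modulo
-- cubes. If Δ ≠ 0 and the Wronskian has a rational root, its two roots go to 0 and ∞ and the pencil becomes
-- ⟨x² (x + a), c x + d⟩, which gives (i), (iii) or (v). Otherwise its roots go to those of x² + x + σ by additive
-- Hilbert 90, and an explicit element of the torus fixing them makes p₁₃ = 1, which gives (ii) or (vi).
--
-- Uniqueness. The vanishing of Δ and the rationality of the roots of the Wronskian separate the three cases. In the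
-- first one Res modulo cubes is an invariant, in the others Res/Δ³ is; only (i) and (iii) agree on it, and they differ
-- in whether the pencil is spanned by two cubes.

-- Post-composition acts on a Plücker vector by a scalar alone, so only the substitution has to be
-- followed, and it is generated by three moves on six coordinates. The price is the way back: a
-- chain of moves is compressed into one substitution (`Realised`), and Cramer's rule then recovers
-- the outer Möbius map. Coprimality is traded for Res ≠ 0, which is equivalent to it once one of
-- the two polynomials has degree exactly 3. Δ³ and Res both have degree 3 in the p_ij and weight 9
-- under x ↦ s x, hence the invariance of Res/Δ³. It is 1 for (i), (ii) and (iii), (c + 1)²/c² for
-- (v) and (b + 1)⁴ for (vi); squaring is injective, so it determines c and b. The excluded
-- parameters show up here too: c = 1 and b = 1 make Res vanish, c = 0 makes Δ vanish, and b = 0 is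
-- (ii). The finite field enters the classification only through decidable equality, square roots,
-- the index two of the image of y ↦ y² + y with σ outside it, and the at most three classes of
-- units modulo cubes.

-- The ring solvers of the library cannot use 1 + 1 = 0, so identities are decided by normal forms over 𝔽₂.

-- Polynomials over 𝔽₂ in n variables, as coefficient lists in the first variable.
Norm : ℕ → Set
Norm zero    = Bool
Norm (suc n) = List (Norm n)

zeroᴺ : ∀ n → Norm n
zeroᴺ zero    = false
zeroᴺ (suc n) = []

constᴺ : ∀ n → Bool → Norm n
constᴺ zero    b = b
constᴺ (suc n) b = constᴺ n b ∷ []

varᴺ : ∀ {n} → Fin n → Norm n
varᴺ {suc n} zero    = zeroᴺ n ∷ constᴺ n true ∷ []
varᴺ {suc n} (suc i) = varᴺ i ∷ []

addᴺ : ∀ n → Norm n → Norm n → Norm n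
addᴺ zero    b        c        = b xor c
addᴺ (suc n) []       qs       = qs
addᴺ (suc n) (p ∷ ps) []       = p ∷ ps
addᴺ (suc n) (p ∷ ps) (q ∷ qs) = addᴺ n p q ∷ addᴺ (suc n) ps qs

mulᴺ : ∀ n → Norm n → Norm n → Norm n
scaleᴺ : ∀ n → Norm n → List (Norm n) → List (Norm n)
mulᴺ zero    b        c  = b ∧ c
mulᴺ (suc n) []       qs = []
mulᴺ (suc n) (p ∷ ps) qs = addᴺ (suc n) (scaleᴺ n p qs) (zeroᴺ n ∷ mulᴺ (suc n) ps qs)
scaleᴺ n p []       = []
scaleᴺ n p (q ∷ qs) = mulᴺ n p q ∷ scaleᴺ n p qs

isZeroᴺ : ∀ n → Norm n → Bool
isZeroᴺ zero    b        = not b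
isZeroᴺ (suc n) []       = true
isZeroᴺ (suc n) (p ∷ ps) = isZeroᴺ n p ∧ isZeroᴺ (suc n) ps

infixl 6 _:+_
infixl 7 _:*_
infix  8 :-_

data Exp (n : ℕ) : Set where
  var       : Fin n → Exp n
  con       : Bool → Exp n
  _:+_ _:*_ : Exp n → Exp n → Exp n
  :-_       : Exp n → Exp n

norm : ∀ {n} → Exp n → Norm n
norm (var i)     = varᴺ i
norm {n} (con b) = constᴺ n b
norm (e :+ f)    = addᴺ _ (norm e) (norm f)
norm (e :* f)    = mulᴺ _ (norm e) (norm f)
norm (:- e)      = norm e

pattern 𝟎 = con false
pattern 𝟏 = con true

infix 4 _⊜_
_⊜_ : {A : Set} → A → A → A × A
_⊜_ = _,_

Curried : ℕ → Set → Set → Set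
Curried zero    A B = B
Curried (suc k) A B = A → Curried k A B

apply : ∀ {A B} k → Curried k A B → Vec A k → B
apply zero    f []ᵛ       = f
apply (suc k) f (x ∷ᵛ xs) = apply k (f x) xs

close : ∀ n {B} → Curried n (Exp n) B → B
close n f = apply n f (Vec.map var (Vec.allFin n))

Forall : ∀ {A : Set} n → (Vec A n → Set) → Set
Forall zero    P = P []ᵛ
Forall (suc n) P = ∀ x → Forall n (λ xs → P (x ∷ᵛ xs))

curry∀ : ∀ {A : Set} n {P : Vec A n → Set} → (∀ xs → P xs) → Forall n P
curry∀ zero    f = f []ᵛ
curry∀ (suc n) f = λ x → curry∀ n (λ xs → f (x ∷ᵛ xs))

-- Normal forms are not unique, since a coefficient list may end in zeros. Two of them are therefore
-- compared by testing their sum, which is their difference, for zero.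
check : ∀ {n} → Exp n → Exp n → Bool
check {n} e f = isZeroᴺ n (addᴺ n (norm e) (norm f))

checks : ∀ {n} → List (Exp n) → List (Exp n) → Bool
checks []       []       = true
checks []       (f ∷ fs) = check 𝟎 f ∧ checks [] fs
checks (e ∷ es) []       = check e 𝟎 ∧ checks es []
checks (e ∷ es) (f ∷ fs) = check e f ∧ checks es fs

∧-T : ∀ b {c} → T (b ∧ c) → T b × T c
∧-T true t = _ , t

-- Deciding identities in rings of characteristic two

HasChar2 : CommutativeRing 0ℓ 0ℓ → Set
HasChar2 R = 1# + 1# ≈ 0#
  where open CommutativeRing R

ZeroTest : CommutativeRing 0ℓ 0ℓ → Set
ZeroTest R = ∀ x → Dec (x ≈ 0#)
  where open CommutativeRing R

module Char2 (R : CommutativeRing 0ℓ 0ℓ)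
  (1+1≈0 : HasChar2 R) where

  open CommutativeRing R
  open RingProperties ring using (+-inverseʳ-unique)
  open CommutativeSemigroupProperties (CommutativeRing.+-commutativeSemigroup R) using (interchange)
  open SetoidReasoning setoid

  x+x≈0 : ∀ x → x + x ≈ 0#
  x+x≈0 x = begin
    x + x             ≈⟨ +-cong (*-identityˡ x) (*-identityˡ x) ⟨
    1# * x + 1# * x   ≈⟨ distribʳ x 1# 1# ⟨
    (1# + 1#) * x     ≈⟨ *-congʳ 1+1≈0 ⟩
    0# * x            ≈⟨ zeroˡ x ⟩
    0#                ∎

  -x≈x : ∀ x → - x ≈ x
  -x≈x x = sym (+-inverseʳ-unique x x (x+x≈0 x))

  x+y≈0⇒x≈y : ∀ {x y} → x + y ≈ 0# → x ≈ y
  x+y≈0⇒x≈y {x} {y} e = trans (sym (-x≈x x)) (sym (+-inverseʳ-unique x y e))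

  ⟦_⟧ᵇ : Bool → Carrier
  ⟦ true  ⟧ᵇ = 1#
  ⟦ false ⟧ᵇ = 0#

  ⟦_⟧ : ∀ {n} → Exp n → Vec Carrier n → Carrier
  ⟦ var i  ⟧ ρ = Vec.lookup ρ i
  ⟦ con b  ⟧ ρ = ⟦ b ⟧ᵇ
  ⟦ e :+ f ⟧ ρ = ⟦ e ⟧ ρ + ⟦ f ⟧ ρ
  ⟦ e :* f ⟧ ρ = ⟦ e ⟧ ρ * ⟦ f ⟧ ρ
  ⟦ :- e   ⟧ ρ = - ⟦ e ⟧ ρ

  ⟦_⟧ᴺ : ∀ {n} → Norm n → Vec Carrier n → Carrier
  ⟦_⟧ᴺ {zero}  b        []ᵛ      = ⟦ b ⟧ᵇ
  ⟦_⟧ᴺ {suc n} []       (x ∷ᵛ ρ) = 0#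
  ⟦_⟧ᴺ {suc n} (p ∷ ps) (x ∷ᵛ ρ) = ⟦ p ⟧ᴺ ρ + x * ⟦_⟧ᴺ {suc n} ps (x ∷ᵛ ρ)

  ⟦zero⟧ : ∀ n ρ → ⟦ zeroᴺ n ⟧ᴺ ρ ≈ 0#
  ⟦zero⟧ zero    []ᵛ      = refl
  ⟦zero⟧ (suc n) (x ∷ᵛ ρ) = refl

  ⟦const⟧ : ∀ n b ρ → ⟦ constᴺ n b ⟧ᴺ ρ ≈ ⟦ b ⟧ᵇ
  ⟦const⟧ zero    b []ᵛ      = refl
  ⟦const⟧ (suc n) b (x ∷ᵛ ρ) = begin
    ⟦ constᴺ n b ⟧ᴺ ρ + x * 0#  ≈⟨ +-cong (⟦const⟧ n b ρ) (zeroʳ x) ⟩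
    ⟦ b ⟧ᵇ + 0#                 ≈⟨ +-identityʳ _ ⟩
    ⟦ b ⟧ᵇ                      ∎

  ⟦var⟧ : ∀ {n} (i : Fin n) ρ → ⟦ varᴺ i ⟧ᴺ ρ ≈ Vec.lookup ρ i
  ⟦var⟧ {suc n} zero (x ∷ᵛ ρ) = begin
    ⟦ zeroᴺ n ⟧ᴺ ρ + x * (⟦ constᴺ n true ⟧ᴺ ρ + x * 0#)
      ≈⟨ +-cong (⟦zero⟧ n ρ) (*-congˡ (⟦const⟧ (suc n) true (x ∷ᵛ ρ))) ⟩
    0# + x * 1#  ≈⟨ +-identityˡ _ ⟩
    x * 1#       ≈⟨ *-identityʳ x ⟩
    x            ∎
  ⟦var⟧ {suc n} (suc i) (x ∷ᵛ ρ) =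
    trans (+-cong (⟦var⟧ i ρ) (zeroʳ x)) (+-identityʳ _)

  ⟦xor⟧ : ∀ b c → ⟦ b xor c ⟧ᵇ ≈ ⟦ b ⟧ᵇ + ⟦ c ⟧ᵇ
  ⟦xor⟧ false c     = sym (+-identityˡ _)
  ⟦xor⟧ true  false = sym (+-identityʳ _)
  ⟦xor⟧ true  true  = sym 1+1≈0

  ⟦∧⟧ : ∀ b c → ⟦ b ∧ c ⟧ᵇ ≈ ⟦ b ⟧ᵇ * ⟦ c ⟧ᵇ
  ⟦∧⟧ false c = sym (zeroˡ _)
  ⟦∧⟧ true  c = sym (*-identityˡ _)

  ⟦add⟧ : ∀ n p q ρ → ⟦ addᴺ n p q ⟧ᴺ ρ ≈ ⟦ p ⟧ᴺ ρ + ⟦ q ⟧ᴺ ρ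
  ⟦add⟧ zero    b        c        []ᵛ      = ⟦xor⟧ b c
  ⟦add⟧ (suc n) []       qs       (x ∷ᵛ ρ) = sym (+-identityˡ _)
  ⟦add⟧ (suc n) (p ∷ ps) []       (x ∷ᵛ ρ) = sym (+-identityʳ _)
  ⟦add⟧ (suc n) (p ∷ ps) (q ∷ qs) (x ∷ᵛ ρ) = begin
    ⟦ addᴺ n p q ⟧ᴺ ρ + x * ⟦ addᴺ (suc n) ps qs ⟧ᴺ (x ∷ᵛ ρ)
      ≈⟨ +-cong (⟦add⟧ n p q ρ) (*-congˡ (⟦add⟧ (suc n) ps qs (x ∷ᵛ ρ))) ⟩
    (⟦ p ⟧ᴺ ρ + ⟦ q ⟧ᴺ ρ) + x * (P + Q)        ≈⟨ +-congˡ (distribˡ x P Q) ⟩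
    (⟦ p ⟧ᴺ ρ + ⟦ q ⟧ᴺ ρ) + (x * P + x * Q)    ≈⟨ interchange _ _ _ _ ⟩
    (⟦ p ⟧ᴺ ρ + x * P) + (⟦ q ⟧ᴺ ρ + x * Q)    ∎
    where
    P = ⟦_⟧ᴺ {suc n} ps (x ∷ᵛ ρ)
    Q = ⟦_⟧ᴺ {suc n} qs (x ∷ᵛ ρ)

  ⟦mul⟧ : ∀ n p q ρ → ⟦ mulᴺ n p q ⟧ᴺ ρ ≈ ⟦ p ⟧ᴺ ρ * ⟦ q ⟧ᴺ ρ
  ⟦scale⟧ : ∀ n p qs x ρ → ⟦_⟧ᴺ {suc n} (scaleᴺ n p qs) (x ∷ᵛ ρ) ≈ ⟦ p ⟧ᴺ ρ * ⟦_⟧ᴺ {suc n} qs (x ∷ᵛ ρ)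
  ⟦mul⟧ zero    b        c  []ᵛ      = ⟦∧⟧ b c
  ⟦mul⟧ (suc n) []       qs (x ∷ᵛ ρ) = sym (zeroˡ _)
  ⟦mul⟧ (suc n) (p ∷ ps) qs (x ∷ᵛ ρ) = begin
    ⟦ addᴺ (suc n) (scaleᴺ n p qs) (zeroᴺ n ∷ mulᴺ (suc n) ps qs) ⟧ᴺ (x ∷ᵛ ρ)
      ≈⟨ ⟦add⟧ (suc n) (scaleᴺ n p qs) (zeroᴺ n ∷ mulᴺ (suc n) ps qs) (x ∷ᵛ ρ) ⟩
    ⟦_⟧ᴺ {suc n} (scaleᴺ n p qs) (x ∷ᵛ ρ) + (⟦ zeroᴺ n ⟧ᴺ ρ + x * ⟦ mulᴺ (suc n) ps qs ⟧ᴺ (x ∷ᵛ ρ))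
      ≈⟨ +-cong (⟦scale⟧ n p qs x ρ) (+-cong (⟦zero⟧ n ρ) (*-congˡ (⟦mul⟧ (suc n) ps qs (x ∷ᵛ ρ)))) ⟩
    ⟦ p ⟧ᴺ ρ * Q + (0# + x * (P * Q))  ≈⟨ +-congˡ (trans (+-identityˡ _) (sym (*-assoc x P Q))) ⟩
    ⟦ p ⟧ᴺ ρ * Q + (x * P) * Q         ≈⟨ distribʳ Q _ _ ⟨
    (⟦ p ⟧ᴺ ρ + x * P) * Q             ∎
    where
    P = ⟦_⟧ᴺ {suc n} ps (x ∷ᵛ ρ)
    Q = ⟦_⟧ᴺ {suc n} qs (x ∷ᵛ ρ)
  ⟦scale⟧ n p []       x ρ = sym (zeroʳ _)
  ⟦scale⟧ n p (q ∷ qs) x ρ = begin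
    ⟦ mulᴺ n p q ⟧ᴺ ρ + x * ⟦_⟧ᴺ {suc n} (scaleᴺ n p qs) (x ∷ᵛ ρ)
      ≈⟨ +-cong (⟦mul⟧ n p q ρ) (*-congˡ (⟦scale⟧ n p qs x ρ)) ⟩
    ⟦ p ⟧ᴺ ρ * ⟦ q ⟧ᴺ ρ + x * (⟦ p ⟧ᴺ ρ * Q)
      ≈⟨ +-congˡ (trans (sym (*-assoc x _ Q)) (trans (*-congʳ (*-comm x _)) (*-assoc _ x Q))) ⟩
    ⟦ p ⟧ᴺ ρ * ⟦ q ⟧ᴺ ρ + ⟦ p ⟧ᴺ ρ * (x * Q)  ≈⟨ distribˡ _ _ _ ⟨
    ⟦ p ⟧ᴺ ρ * (⟦ q ⟧ᴺ ρ + x * Q)              ∎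
    where Q = ⟦_⟧ᴺ {suc n} qs (x ∷ᵛ ρ)

  ⟦norm⟧ : ∀ {n} (e : Exp n) ρ → ⟦ norm e ⟧ᴺ ρ ≈ ⟦ e ⟧ ρ
  ⟦norm⟧ (var i)     ρ = ⟦var⟧ i ρ
  ⟦norm⟧ {n} (con b) ρ = ⟦const⟧ n b ρ
  ⟦norm⟧ (e :+ f)    ρ = trans (⟦add⟧ _ (norm e) (norm f) ρ) (+-cong (⟦norm⟧ e ρ) (⟦norm⟧ f ρ))
  ⟦norm⟧ (e :* f)    ρ = trans (⟦mul⟧ _ (norm e) (norm f) ρ) (*-cong (⟦norm⟧ e ρ) (⟦norm⟧ f ρ))
  ⟦norm⟧ (:- e)      ρ = trans (⟦norm⟧ e ρ) (sym (-x≈x _))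

  ⟦isZero⟧ : ∀ n p ρ → T (isZeroᴺ n p) → ⟦ p ⟧ᴺ ρ ≈ 0#
  ⟦isZero⟧ zero    false    []ᵛ      t = refl
  ⟦isZero⟧ (suc n) []       (x ∷ᵛ ρ) t = refl
  ⟦isZero⟧ (suc n) (p ∷ ps) (x ∷ᵛ ρ) t with ∧-T (isZeroᴺ n p) t
  ... | tp , tps = begin
    ⟦ p ⟧ᴺ ρ + x * ⟦_⟧ᴺ {suc n} ps (x ∷ᵛ ρ)
      ≈⟨ +-cong (⟦isZero⟧ n p ρ tp) (*-congˡ (⟦isZero⟧ (suc n) ps (x ∷ᵛ ρ) tps)) ⟩
    0# + x * 0#  ≈⟨ +-identityˡ _ ⟩
    x * 0#       ≈⟨ zeroʳ x ⟩
    0#           ∎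

  prove : ∀ {n} (e f : Exp n) → T (check e f) → ∀ ρ → ⟦ e ⟧ ρ ≈ ⟦ f ⟧ ρ
  prove {n} e f valid ρ = x+y≈0⇒x≈y (begin
    ⟦ e ⟧ ρ + ⟦ f ⟧ ρ                 ≈⟨ +-cong (⟦norm⟧ e ρ) (⟦norm⟧ f ρ) ⟨
    ⟦ norm e ⟧ᴺ ρ + ⟦ norm f ⟧ᴺ ρ     ≈⟨ ⟦add⟧ n (norm e) (norm f) ρ ⟨
    ⟦ addᴺ n (norm e) (norm f) ⟧ᴺ ρ   ≈⟨ ⟦isZero⟧ n _ ρ valid ⟩
    0#                                ∎)

  proves : ∀ {n} (es fs : List (Exp n)) → T (checks es fs) → ∀ ρ →
           _≈ₚ_ R (List.map (λ e → ⟦ e ⟧ ρ) es) (List.map (λ e → ⟦ e ⟧ ρ) fs)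
  proves []       []       valid ρ i       = refl
  proves []       (f ∷ fs) valid ρ zero    = prove 𝟎 f (proj₁ (∧-T (check 𝟎 f) valid)) ρ
  proves []       (f ∷ fs) valid ρ (suc i) = proves [] fs (proj₂ (∧-T (check 𝟎 f) valid)) ρ i
  proves (e ∷ es) []       valid ρ zero    = prove e 𝟎 (proj₁ (∧-T (check e 𝟎) valid)) ρ
  proves (e ∷ es) []       valid ρ (suc i) = proves es [] (proj₂ (∧-T (check e 𝟎) valid)) ρ i
  proves (e ∷ es) (f ∷ fs) valid ρ zero    = prove e f (proj₁ (∧-T (check e f) valid)) ρ
  proves (e ∷ es) (f ∷ fs) valid ρ (suc i) = proves es fs (proj₂ (∧-T (check e f) valid)) ρ i

  -- Proof by reflection: `close` applies the equation to formal variables, and the implicit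
  -- argument is a closed Boolean test that evaluation settles.
  solve : ∀ n (eq : Curried n (Exp n) (Exp n × Exp n)) {_ : T (uncurry check (close n eq))} →
          Forall n (λ ρ → ⟦ proj₁ (close n eq) ⟧ ρ ≈ ⟦ proj₂ (close n eq) ⟧ ρ)
  solve n eq {valid} = curry∀ n (prove (proj₁ (close n eq)) (proj₂ (close n eq)) valid)

  solveₚ : ∀ n (eq : Curried n (Exp n) (List (Exp n) × List (Exp n))) {_ : T (uncurry checks (close n eq))} →
           Forall n (λ ρ → _≈ₚ_ R (List.map (λ e → ⟦ e ⟧ ρ) (proj₁ (close n eq))) (List.map (λ e → ⟦ e ⟧ ρ) (proj₂ (close n eq))))
  solveₚ n eq {valid} = curry∀ n (proves (proj₁ (close n eq)) (proj₂ (close n eq)) valid)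

  -- A formula defined over every commutative ring yields its own syntax tree when instantiated here.
  expRing : ℕ → CommutativeRing 0ℓ 0ℓ
  expRing n = record
    { Carrier = Exp n
    ; _≈_ = λ e f → ∀ ρ → ⟦ e ⟧ ρ ≈ ⟦ f ⟧ ρ
    ; _+_ = _:+_
    ; _*_ = _:*_
    ; -_  = :-_
    ; 0#  = 𝟎
    ; 1#  = 𝟏
    ; isCommutativeRing = record
      { isRing = record
        { +-isAbelianGroup = record
          { isGroup = record
            { isMonoid = record
              { isSemigroup = record
                { isMagma = record
                  { isEquivalence = record
                    { refl  = λ ρ → refl
                    ; sym   = λ e ρ → sym (e ρ)
                    ; trans = λ e f ρ → trans (e ρ) (f ρ)
                    }
                  ; ∙-cong = λ e f ρ → +-cong (e ρ) (f ρ)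
                  }
                ; assoc = λ _ _ _ ρ → +-assoc _ _ _
                }
              ; identity = (λ _ ρ → +-identityˡ _) , (λ _ ρ → +-identityʳ _)
              }
            ; inverse = (λ _ ρ → -‿inverseˡ _) , (λ _ ρ → -‿inverseʳ _)
            ; ⁻¹-cong = λ e ρ → -‿cong (e ρ)
            }
          ; comm = λ _ _ ρ → +-comm _ _
          }
        ; *-cong     = λ e f ρ → *-cong (e ρ) (f ρ)
        ; *-assoc    = λ _ _ _ ρ → *-assoc _ _ _
        ; *-identity = (λ _ ρ → *-identityˡ _) , (λ _ ρ → *-identityʳ _)
        ; distrib    = (λ _ _ _ ρ → distribˡ _ _ _) , (λ _ _ _ ρ → distribʳ _ _ _)
        }
      ; *-comm = λ _ _ ρ → *-comm _ _
      }
    }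

-- Binary cubics, Plücker vectors and their covariants

record Cubic (A : Set) : Set where
  constructor cubic
  field c₀ c₁ c₂ c₃ : A

record Plücker (A : Set) : Set where
  constructor plücker
  field p₀₁ p₀₂ p₀₃ p₁₂ p₁₃ p₂₃ : A

open Cubic public
open Plücker public

onCubic : {A B : Set} → (Cubic A → B) → A → A → A → A → B
onCubic f x y z w = f (cubic x y z w)

onPlücker : {A B : Set} → (Plücker A → B) → A → A → A → A → A → A → B
onPlücker f a b c d e g = f (plücker a b c d e g)

-- All formulas are specialised to characteristic two: signs are dropped, and so are even binomial coefficients.
module Forms (R : CommutativeRing 0ℓ 0ℓ) where

  open CommutativeRing R

  infixl 8 _² _³ _⁴
  _² _³ _⁴ : Carrier → Carrier
  x ² = x * x
  x ³ = x ² * x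
  x ⁴ = x ² * x ²

  toPoly : Cubic Carrier → Poly R
  toPoly (cubic x y z w) = x ∷ y ∷ z ∷ w ∷ []

  coefficients : Poly R → Cubic Carrier
  coefficients p = cubic (coeff R p 0) (coeff R p 1) (coeff R p 2) (coeff R p 3)

  -- The combination of the polynomial parts of g/x, g/x² and g/x³ with weights k₀, k₁, k₂.
  truncate : Carrier → Carrier → Carrier → Cubic Carrier → Poly R
  truncate k₀ k₁ k₂ (cubic _ g₁ g₂ g₃) =
    (k₀ * g₁ + k₁ * g₂ + k₂ * g₃) ∷ (k₀ * g₂ + k₁ * g₃) ∷ k₀ * g₃ ∷ []

  -- Written exactly as evalHom3, with which it has to agree definitionally.
  evaluate : Cubic Carrier → Carrier → Carrier → Carrier
  evaluate (cubic g₀ g₁ g₂ g₃) x y =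
    ((g₀ * pow R y 3 + g₁ * (x * pow R y 2)) + g₂ * (pow R x 2 * y)) + g₃ * pow R x 3

  combine : Carrier → Carrier → Cubic Carrier → Cubic Carrier → Cubic Carrier
  combine a b (cubic g₀ g₁ g₂ g₃) (cubic h₀ h₁ h₂ h₃) =
    cubic (a * g₀ + b * h₀) (a * g₁ + b * h₁) (a * g₂ + b * h₂) (a * g₃ + b * h₃)

  -- g((a x + b)/(c x + d)) · (c x + d)³
  substitute : Carrier → Carrier → Carrier → Carrier → Cubic Carrier → Cubic Carrier
  substitute a b c d (cubic g₀ g₁ g₂ g₃) = cubic
    (g₀ * d ³ + g₁ * (b * d ²) + g₂ * (b ² * d) + g₃ * b ³)
    (g₀ * (d ² * c) + g₁ * (a * d ²) + g₂ * (b ² * c) + g₃ * (a * b ²))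
    (g₀ * (d * c ²) + g₁ * (b * c ²) + g₂ * (a ² * d) + g₃ * (a ² * b))
    (g₀ * c ³ + g₁ * (a * c ²) + g₂ * (a ² * c) + g₃ * a ³)

  shiftᶜ : Carrier → Cubic Carrier → Cubic Carrier
  shiftᶜ t (cubic g₀ g₁ g₂ g₃) =
    cubic (g₀ + t * g₁ + t ² * g₂ + t ³ * g₃) (g₁ + t ² * g₃) (g₂ + t * g₃) g₃

  dilateᶜ : Carrier → Cubic Carrier → Cubic Carrier
  dilateᶜ a (cubic g₀ g₁ g₂ g₃) = cubic g₀ (a * g₁) (a ² * g₂) (a ³ * g₃)

  swapᶜ : Cubic Carrier → Cubic Carrier
  swapᶜ (cubic g₀ g₁ g₂ g₃) = cubic g₃ g₂ g₁ g₀

  wedge : Cubic Carrier → Cubic Carrier → Plücker Carrier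
  wedge (cubic g₀ g₁ g₂ g₃) (cubic h₀ h₁ h₂ h₃) = plücker
    (g₀ * h₁ + g₁ * h₀) (g₀ * h₂ + g₂ * h₀) (g₀ * h₃ + g₃ * h₀)
    (g₁ * h₂ + g₂ * h₁) (g₁ * h₃ + g₃ * h₁) (g₂ * h₃ + g₃ * h₂)

  shift : Carrier → Plücker Carrier → Plücker Carrier
  shift t (plücker a b c d e f) = plücker
    (a + t ² * (c + d) + t ⁴ * f) (b + t * (c + d) + t ² * e)
    (c + t * e + t ² * f) (d + t * e + t ² * f) e f

  dilate : Carrier → Plücker Carrier → Plücker Carrier
  dilate s (plücker a b c d e f) =
    plücker (s * a) (s ² * b) (s ³ * c) (s ³ * d) (s ⁴ * e) (s ⁴ * s * f)

  swap : Plücker Carrier → Plücker Carrier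
  swap (plücker a b c d e f) = plücker f e c d b a

  scaleᵖ : Carrier → Plücker Carrier → Plücker Carrier
  scaleᵖ μ (plücker a b c d e f) = plücker (μ * a) (μ * b) (μ * c) (μ * d) (μ * e) (μ * f)

  -- The Klein quadric: the equation satisfied by six numbers that are the Plücker vector of a
  -- pencil.
  relation : Plücker Carrier → Carrier
  relation (plücker a b c d e f) = a * f + b * e + c * d

  -- The Wronskian of the pencil is p₀₁ y⁴ + Δ x² y² + p₂₃ x⁴, the square of a quadratic form over a perfect
  -- field; Δ is the square of its middle coefficient.
  Δ : Plücker Carrier → Carrier
  Δ p = p₀₃ p + p₁₂ p

  wronskian : Plücker Carrier → Carrier → Carrier → Carrier
  wronskian p x y = p₀₁ p * y ⁴ + Δ p * (x ² * y ²) + p₂₃ p * x ⁴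

  -- The resultant, as the determinant of the Bézout matrix
  --   p₀₁ p₀₂ p₀₃
  --   p₀₂  Δ  p₁₃
  --   p₀₃ p₁₃ p₂₃
  resultant : Plücker Carrier → Carrier
  resultant p = p₀₁ p * p₂₃ p * Δ p + p₀₁ p * p₁₃ p ² + p₀₂ p ² * p₂₃ p + Δ p * p₀₃ p ²

  fibre : Cubic Carrier → Cubic Carrier → Carrier → Carrier → Cubic Carrier
  fibre g h x y = combine (evaluate h x y) (- evaluate g x y) g h

  -- Normal form (vi), or (ii) if b = 0, with σ = ρ² + ρ.
  inert-g inert-h : Carrier → Carrier → Cubic Carrier
  inert-g b ρ = cubic ((b + 1#) * (ρ ² + ρ)) (ρ ² + ρ) b 1#
  inert-h b ρ = cubic (b + 1# + (ρ ² + ρ)) 1# 1# 0#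

  bézoutian : Plücker Carrier → Carrier → Carrier → Poly R
  bézoutian p x y =
    (p₀₁ p * y ² + p₀₂ p * (x * y) + p₀₃ p * x ²) ∷
    (p₀₂ p * y ² + Δ p * (x * y) + p₁₃ p * x ²) ∷
    (p₀₃ p * y ² + p₁₃ p * (x * y) + p₂₃ p * x ²) ∷ []

module FieldProperties (F : CommutativeRing 0ℓ 0ℓ) (isField : IsField F) where

  open CommutativeRing F
  open IsField isField public
  open SetoidReasoning setoid

  *-cancelˡ-0 : ∀ {x y} → ¬ (x ≈ 0#) → x * y ≈ 0# → y ≈ 0#
  *-cancelˡ-0 {x} {y} x≉0 xy≈0 with inverse x x≉0
  ... | z , xz≈1 = begin
    y            ≈⟨ *-identityˡ y ⟨
    1# * y       ≈⟨ *-congʳ (trans (sym xz≈1) (*-comm x z)) ⟩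
    (z * x) * y  ≈⟨ *-assoc z x y ⟩
    z * (x * y)  ≈⟨ *-congˡ xy≈0 ⟩
    z * 0#       ≈⟨ zeroʳ z ⟩
    0#           ∎

  *-nonzero : ∀ {x y} → ¬ (x ≈ 0#) → ¬ (y ≈ 0#) → ¬ (x * y ≈ 0#)
  *-nonzero x≉0 y≉0 xy≈0 = y≉0 (*-cancelˡ-0 x≉0 xy≈0)

  nonzero-resp : ∀ {x y} → x ≈ y → ¬ (x ≈ 0#) → ¬ (y ≈ 0#)
  nonzero-resp x≈y x≉0 y≈0 = x≉0 (trans x≈y y≈0)

  *-nonzeroˡ : ∀ {x y} → ¬ (x * y ≈ 0#) → ¬ (x ≈ 0#)
  *-nonzeroˡ {x} {y} xy≉0 x≈0 = xy≉0 (trans (*-congʳ x≈0) (zeroˡ y))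

  *-nonzeroʳ : ∀ {x y} → ¬ (x * y ≈ 0#) → ¬ (y ≈ 0#)
  *-nonzeroʳ {x} {y} xy≉0 y≈0 = xy≉0 (trans (*-congˡ y≈0) (zeroʳ x))

  inverse-nonzero : ∀ {x y} → x * y ≈ 1# → ¬ (y ≈ 0#)
  inverse-nonzero xy≈1 = *-nonzeroʳ (nonzero-resp (sym xy≈1) 1≉0)

  quotient : ∀ x y → ¬ (y ≈ 0#) → ∃ λ z → z * y ≈ x
  quotient x y y≉0 with inverse y y≉0
  ... | w , yw≈1 = x * w , trans (*-assoc x w y) (trans (*-congˡ (trans (*-comm w y) yw≈1)) (*-identityʳ x))

  quotient-nonzero : ∀ {x y z} → z * y ≈ x → ¬ (x ≈ 0#) → ¬ (z ≈ 0#)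
  quotient-nonzero e x≉0 = *-nonzeroˡ (nonzero-resp (sym e) x≉0)

-- Pencils under changes of variable, and their invariants

module Pencils (F : CommutativeRing 0ℓ 0ℓ) (isField : IsField F)
  (1+1≈0 : HasChar2 F) where

  open CommutativeRing F
  open FieldProperties F isField
  open Char2 F 1+1≈0
  open Forms F
  module E {n : ℕ} = Forms (expRing n)

  infix 4 _≋ᶜ_ _≋_ _⇝_

  record _≋ᶜ_ (g h : Cubic Carrier) : Set where
    constructor cubic-≈
    field
      e₀ : c₀ g ≈ c₀ h
      e₁ : c₁ g ≈ c₁ h
      e₂ : c₂ g ≈ c₂ h
      e₃ : c₃ g ≈ c₃ h

  record _≋_ (p q : Plücker Carrier) : Set where
    constructor plücker-≈
    field
      e₀₁ : p₀₁ p ≈ p₀₁ q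
      e₀₂ : p₀₂ p ≈ p₀₂ q
      e₀₃ : p₀₃ p ≈ p₀₃ q
      e₁₂ : p₁₂ p ≈ p₁₂ q
      e₁₃ : p₁₃ p ≈ p₁₃ q
      e₂₃ : p₂₃ p ≈ p₂₃ q

  ≋ᶜ-refl : ∀ {g} → g ≋ᶜ g
  ≋ᶜ-refl = cubic-≈ refl refl refl refl

  ≋ᶜ-sym : ∀ {g h} → g ≋ᶜ h → h ≋ᶜ g
  ≋ᶜ-sym (cubic-≈ e₀ e₁ e₂ e₃) = cubic-≈ (sym e₀) (sym e₁) (sym e₂) (sym e₃)

  ≋ᶜ-trans : ∀ {g h k} → g ≋ᶜ h → h ≋ᶜ k → g ≋ᶜ k
  ≋ᶜ-trans (cubic-≈ e₀ e₁ e₂ e₃) (cubic-≈ f₀ f₁ f₂ f₃) =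
    cubic-≈ (trans e₀ f₀) (trans e₁ f₁) (trans e₂ f₂) (trans e₃ f₃)

  ≋-refl : ∀ {p} → p ≋ p
  ≋-refl = plücker-≈ refl refl refl refl refl refl

  ≋-sym : ∀ {p q} → p ≋ q → q ≋ p
  ≋-sym (plücker-≈ a b c d e f) = plücker-≈ (sym a) (sym b) (sym c) (sym d) (sym e) (sym f)

  ≋-trans : ∀ {p q r} → p ≋ q → q ≋ r → p ≋ r
  ≋-trans (plücker-≈ a b c d e f) (plücker-≈ a′ b′ c′ d′ e′ f′) =
    plücker-≈ (trans a a′) (trans b b′) (trans c c′) (trans d d′) (trans e e′) (trans f f′)

  module _ {n : ℕ} where

    cubicList : Cubic (Exp n) → List (Exp n)
    cubicList (cubic x y z w) = x ∷ y ∷ z ∷ w ∷ []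

    plückerList : Plücker (Exp n) → List (Exp n)
    plückerList (plücker a b c d e f) = a ∷ b ∷ c ∷ d ∷ e ∷ f ∷ []

    mapᶜ : Vec Carrier n → Cubic (Exp n) → Cubic Carrier
    mapᶜ ρ (cubic x y z w) = cubic (⟦ x ⟧ ρ) (⟦ y ⟧ ρ) (⟦ z ⟧ ρ) (⟦ w ⟧ ρ)

    mapᵖ : Vec Carrier n → Plücker (Exp n) → Plücker Carrier
    mapᵖ ρ (plücker a b c d e f) = plücker (⟦ a ⟧ ρ) (⟦ b ⟧ ρ) (⟦ c ⟧ ρ) (⟦ d ⟧ ρ) (⟦ e ⟧ ρ) (⟦ f ⟧ ρ)

  solveᶜ : ∀ n (eq : Curried n (Exp n) (Cubic (Exp n) × Cubic (Exp n))) {_ : T (uncurry (λ g h → checks (cubicList g) (cubicList h)) (close n eq))} →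
           Forall n (λ ρ → mapᶜ ρ (proj₁ (close n eq)) ≋ᶜ mapᶜ ρ (proj₂ (close n eq)))
  solveᶜ n eq {valid} = curry∀ n λ ρ →
    let e = proves (cubicList (proj₁ (close n eq))) (cubicList (proj₂ (close n eq))) valid ρ
    in cubic-≈ (e 0) (e 1) (e 2) (e 3)

  solveᵖ : ∀ n (eq : Curried n (Exp n) (Plücker (Exp n) × Plücker (Exp n))) {_ : T (uncurry (λ p q → checks (plückerList p) (plückerList q)) (close n eq))} →
           Forall n (λ ρ → mapᵖ ρ (proj₁ (close n eq)) ≋ mapᵖ ρ (proj₂ (close n eq)))
  solveᵖ n eq {valid} = curry∀ n λ ρ →
    let e = proves (plückerList (proj₁ (close n eq))) (plückerList (proj₂ (close n eq))) valid ρ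
    in plücker-≈ (e 0) (e 1) (e 2) (e 3) (e 4) (e 5)

  shift-cong : ∀ t {p q} → p ≋ q → shift t p ≋ shift t q
  shift-cong t (plücker-≈ a b c d e f) = plücker-≈
    (+-cong (+-cong a (*-congˡ (+-cong c d))) (*-congˡ f))
    (+-cong (+-cong b (*-congˡ (+-cong c d))) (*-congˡ e))
    (+-cong (+-cong c (*-congˡ e)) (*-congˡ f))
    (+-cong (+-cong d (*-congˡ e)) (*-congˡ f)) e f

  dilate-cong : ∀ s {p q} → p ≋ q → dilate s p ≋ dilate s q
  dilate-cong s (plücker-≈ a b c d e f) =
    plücker-≈ (*-congˡ a) (*-congˡ b) (*-congˡ c) (*-congˡ d) (*-congˡ e) (*-congˡ f)

  swap-cong : ∀ {p q} → p ≋ q → swap p ≋ swap q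
  swap-cong (plücker-≈ a b c d e f) = plücker-≈ f e c d b a

  scaleᵖ-cong : ∀ {s t} {p q} → s ≈ t → p ≋ q → scaleᵖ s p ≋ scaleᵖ t q
  scaleᵖ-cong st (plücker-≈ a b c d e f) =
    plücker-≈ (*-cong st a) (*-cong st b) (*-cong st c) (*-cong st d) (*-cong st e) (*-cong st f)

  wedge-cong : ∀ {g g′ h h′} → g ≋ᶜ g′ → h ≋ᶜ h′ → wedge g h ≋ wedge g′ h′
  wedge-cong (cubic-≈ a b c d) (cubic-≈ a′ b′ c′ d′) = plücker-≈
    (minor a b′ b a′) (minor a c′ c a′) (minor a d′ d a′) (minor b c′ c b′) (minor b d′ d b′) (minor c d′ d c′)
    where
    minor : ∀ {x x′ y y′ z z′ w w′} → x ≈ x′ → y ≈ y′ → z ≈ z′ → w ≈ w′ → x * y + z * w ≈ x′ * y′ + z′ * w′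
    minor e f g h = +-cong (*-cong e f) (*-cong g h)

  Δ-cong : ∀ {p q} → p ≋ q → Δ p ≈ Δ q
  Δ-cong (plücker-≈ _ _ c d _ _) = +-cong c d

  ²-cong : ∀ {x y} → x ≈ y → x ² ≈ y ²
  ²-cong e = *-cong e e

  ³-cong : ∀ {x y} → x ≈ y → x ³ ≈ y ³
  ³-cong e = *-cong (²-cong e) e

  ⁴-cong : ∀ {x y} → x ≈ y → x ⁴ ≈ y ⁴
  ⁴-cong e = ²-cong (²-cong e)

  resultant-cong : ∀ {p q} → p ≋ q → resultant p ≈ resultant q
  resultant-cong r@(plücker-≈ a b c d e f) =
    +-cong (+-cong (+-cong (*-cong (*-cong a f) (Δ-cong r)) (*-cong a (²-cong e))) (*-cong (²-cong b) f))
           (*-cong (Δ-cong r) (²-cong c))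

  wronskian-cong : ∀ {p q} x y → p ≋ q → wronskian p x y ≈ wronskian q x y
  wronskian-cong x y r = +-cong (+-cong (*-congʳ (_≋_.e₀₁ r)) (*-congʳ (Δ-cong r))) (*-congʳ (_≋_.e₂₃ r))

  relation-cong : ∀ {p q} → p ≋ q → relation p ≈ relation q
  relation-cong (plücker-≈ a b c d e f) = +-cong (+-cong (*-cong a f) (*-cong b e)) (*-cong c d)

  -- Plücker vectors of pencils of binary cubics that differ by a change of variable: Λ²Sym³ of the generators
  -- x ↦ x + t, x ↦ s x, x ↦ 1/x of PGL₂, and the scalars that come from a change of basis of the pencil.
  data _⇝_ : Plücker Carrier → Plücker Carrier → Set where
    same    : ∀ {p q} → p ≋ q → p ⇝ q
    shifts  : ∀ t {p} → p ⇝ shift t p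
    dilates : ∀ s {p} → ¬ (s ≈ 0#) → p ⇝ dilate s p
    swaps   : ∀ {p} → p ⇝ swap p
    scales  : ∀ μ {p} → ¬ (μ ≈ 0#) → p ⇝ scaleᵖ μ p
    _⨾_     : ∀ {p q r} → p ⇝ q → q ⇝ r → p ⇝ r

  infixl 5 _⨾_

  -- Shifts are involutions because t + t = 0, the swap is one in any case, and dilations and
  -- scalars are undone by the inverse unit.
  ⇝-sym : ∀ {p q} → p ⇝ q → q ⇝ p
  ⇝-sym (same e) = same (≋-sym e)
  ⇝-sym (shifts t {plücker a b c d e f}) = shifts t ⨾
    same (solveᵖ 7 (λ t → onPlücker λ p → E.shift t (E.shift t p) ⊜ p) t a b c d e f)
  ⇝-sym (dilates s {plücker a b c d e f} s≉0) with inverse s s≉0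
  ... | r , sr≈1 = dilates r (inverse-nonzero sr≈1) ⨾ same (plücker-≈
    (trans (solve 3 (λ r s a → r :* (s :* a) ⊜ s :* r :* a) r s a) (cancel a sr≈1))
    (trans (solve 3 (λ r s a → r E.² :* (s E.² :* a) ⊜ (s :* r) E.² :* a) r s b) (cancel b (one *-one)))
    (trans (solve 3 (λ r s a → r E.³ :* (s E.³ :* a) ⊜ (s :* r) E.³ :* a) r s c) (cancel c cube))
    (trans (solve 3 (λ r s a → r E.³ :* (s E.³ :* a) ⊜ (s :* r) E.³ :* a) r s d) (cancel d cube))
    (trans (solve 3 (λ r s a → r E.⁴ :* (s E.⁴ :* a) ⊜ (s :* r) E.⁴ :* a) r s e) (cancel e fourth))
    (trans (solve 3 (λ r s a → (r E.⁴ :* r) :* (s E.⁴ :* s :* a) ⊜ (s :* r) E.⁴ :* (s :* r) :* a) r s f)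
           (cancel f (one (*-cong fourth sr≈1)))))
    where
    cancel : ∀ {z} x → z ≈ 1# → z * x ≈ x
    cancel x e = trans (*-congʳ e) (*-identityˡ x)
    one : ∀ {z} → z ≈ 1# * 1# → z ≈ 1#
    one e = trans e (*-identityˡ 1#)
    *-one : (s * r) ² ≈ 1# * 1#
    *-one = *-cong sr≈1 sr≈1
    cube : (s * r) ³ ≈ 1#
    cube = one (*-cong (one *-one) sr≈1)
    fourth : (s * r) ⁴ ≈ 1#
    fourth = one (*-cong (one *-one) (one *-one))
  ⇝-sym swaps = swaps
  ⇝-sym (scales μ {plücker a b c d e f} μ≉0) with inverse μ μ≉0
  ... | r , μr≈1 = scales r (inverse-nonzero μr≈1) ⨾ same
    (plücker-≈ (cancel a) (cancel b) (cancel c) (cancel d) (cancel e) (cancel f))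
    where
    cancel : ∀ x → r * (μ * x) ≈ x
    cancel x = trans (solve 3 (λ r μ x → r :* (μ :* x) ⊜ μ :* r :* x) r μ x) (trans (*-congʳ μr≈1) (*-identityˡ x))
  ⇝-sym (a ⨾ b) = ⇝-sym b ⨾ ⇝-sym a

  -- Since p_ij has weight i + j, the factor ν is s³ for a dilation by s; it is μ for a scalar and 1
  -- for shifts and swaps. Along a chain the factors multiply.
  ⇝-invariants : ∀ {p q} → p ⇝ q → ∃ λ ν → ¬ (ν ≈ 0#) × Δ q ≈ ν * Δ p × resultant q ≈ ν ³ * resultant p
  ⇝-invariants {p} {q} (same e) =
    1# , 1≉0 , trans (sym (Δ-cong e)) (sym (*-identityˡ _)) ,
    trans (sym (resultant-cong e)) (solve 1 (λ x → x ⊜ 𝟏 E.³ :* x) (resultant p))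
  ⇝-invariants {plücker a b c d e f} (shifts t) =
    1# , 1≉0 ,
    solve 7 (λ t → onPlücker λ p → E.Δ (E.shift t p) ⊜ 𝟏 :* E.Δ p) t a b c d e f ,
    solve 7 (λ t → onPlücker λ p → E.resultant (E.shift t p) ⊜ 𝟏 E.³ :* E.resultant p) t a b c d e f
  ⇝-invariants {plücker a b c d e f} (dilates t t≉0) =
    t ³ , *-nonzero (*-nonzero t≉0 t≉0) t≉0 ,
    solve 7 (λ t → onPlücker λ p → E.Δ (E.dilate t p) ⊜ t E.³ :* E.Δ p) t a b c d e f ,
    solve 7 (λ t → onPlücker λ p → E.resultant (E.dilate t p) ⊜ t E.³ E.³ :* E.resultant p) t a b c d e f
  ⇝-invariants {plücker a b c d e f} swaps =
    1# , 1≉0 , sym (*-identityˡ _) ,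
    solve 6 (onPlücker λ p → E.resultant (E.swap p) ⊜ 𝟏 E.³ :* E.resultant p) a b c d e f
  ⇝-invariants {plücker a b c d e f} (scales t t≉0) =
    t , t≉0 ,
    solve 7 (λ t → onPlücker λ p → E.Δ (E.scaleᵖ t p) ⊜ t :* E.Δ p) t a b c d e f ,
    solve 7 (λ t → onPlücker λ p → E.resultant (E.scaleᵖ t p) ⊜ t E.³ :* E.resultant p) t a b c d e f
  ⇝-invariants {p} (a ⨾ b) with ⇝-invariants a | ⇝-invariants b
  ... | ν , ν≉0 , eΔ , eR | ν′ , ν′≉0 , eΔ′ , eR′ =
    ν′ * ν , *-nonzero ν′≉0 ν≉0 ,
    trans eΔ′ (trans (*-congˡ eΔ) (sym (*-assoc _ _ _))) ,
    trans eR′ (trans (*-congˡ eR) (solve 3 (λ x y z → x E.³ :* (y E.³ :* z) ⊜ (x :* y) E.³ :* z) ν′ ν (resultant p)))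

  HasRoot : Plücker Carrier → Set
  HasRoot p = ∃ λ x → ∃ λ y → ¬ (x ≈ 0# × y ≈ 0#) × wronskian p x y ≈ 0#

  -- The point (x : y) moves along with the coordinate, and the Wronskian changes by a factor only:
  -- t⁵ for a dilation, t for a scalar, 1 otherwise.
  ⇝-root : ∀ {p q} → p ⇝ q → HasRoot p → HasRoot q
  ⇝-root (same e) (x , y , nz , w) = x , y , nz , trans (sym (wronskian-cong x y e)) w
  ⇝-root {plücker a b c d e f} (shifts t) (x , y , nz , w) =
    x + t * y , y ,
    (λ { (x′≈0 , y≈0) → nz (trans (sym (trans (+-congˡ (trans (*-congˡ y≈0) (zeroʳ t))) (+-identityʳ x))) x′≈0 , y≈0) }) ,
    trans (solve 9 (λ t x y → onPlücker λ p → E.wronskian (E.shift t p) (x :+ t :* y) y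
                                        ⊜ E.wronskian p x y) t x y a b c d e f) w
  ⇝-root {plücker a b c d e f} (dilates t t≉0) (x , y , nz , w) =
    x , t * y , (λ { (x≈0 , ty≈0) → nz (x≈0 , *-cancelˡ-0 t≉0 ty≈0) }) ,
    trans (solve 9 (λ t x y → onPlücker λ p → E.wronskian (E.dilate t p) x (t :* y)
                                        ⊜ t E.⁴ :* t :* E.wronskian p x y) t x y a b c d e f)
          (trans (*-congˡ w) (zeroʳ _))
  ⇝-root {plücker a b c d e f} swaps (x , y , nz , w) =
    y , x , (λ { (y≈0 , x≈0) → nz (x≈0 , y≈0) }) ,
    trans (solve 8 (λ x y → onPlücker λ p → E.wronskian (E.swap p) y x
                                      ⊜ E.wronskian p x y) x y a b c d e f) w
  ⇝-root {plücker a b c d e f} (scales t t≉0) (x , y , nz , w) =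
    x , y , nz ,
    trans (solve 9 (λ t x y → onPlücker λ p → E.wronskian (E.scaleᵖ t p) x y
                                        ⊜ t :* E.wronskian p x y) t x y a b c d e f)
          (trans (*-congˡ w) (zeroʳ _))
  ⇝-root (a ⨾ b) r = ⇝-root b (⇝-root a r)

  -- The pencils spanned by two cubes of linear forms satisfy this, and x³ + x² does not.
  TwoCubes : Plücker Carrier → Set
  TwoCubes p = p₀₂ p ² ≈ p₀₁ p * Δ p × p₁₃ p ² ≈ p₂₃ p * Δ p

  -- The two equations have to travel together: the swap exchanges them, and a shift needs the
  -- second one to preserve the first.
  ⇝-twoCubes : ∀ {p q} → p ⇝ q → TwoCubes p → TwoCubes q
  ⇝-twoCubes (same r@(plücker-≈ a b c d e f)) (z , z′) =
    trans (sym (²-cong b)) (trans z (*-cong a (Δ-cong r))) ,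
    trans (sym (²-cong e)) (trans z′ (*-cong f (Δ-cong r)))
  ⇝-twoCubes {plücker a b c d e f} (shifts t) (z , z′) =
    trans (solve 5 (λ t b c d e → (b :+ t :* (c :+ d) :+ t E.² :* e) E.² ⊜ b E.² :+ t E.² :* (c :+ d) E.² :+ t E.⁴ :* e E.²) t b c d e)
      (trans (+-cong (+-congʳ z) (*-congˡ z′))
        (solve 7 (λ t a b c d e f → a :* (c :+ d) :+ t E.² :* (c :+ d) E.² :+ t E.⁴ :* (f :* (c :+ d))
           ⊜ p₀₁ (E.shift t (plücker a b c d e f)) :* E.Δ (E.shift t (plücker a b c d e f))) t a b c d e f)) ,
    trans z′ (*-congˡ (solve 7 (λ t → onPlücker λ p → E.Δ p ⊜ E.Δ (E.shift t p)) t a b c d e f))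
  ⇝-twoCubes {plücker a b c d e f} (dilates t t≉0) (z , z′) =
    trans (solve 2 (λ t b → (t E.² :* b) E.² ⊜ t E.⁴ :* b E.²) t b)
      (trans (*-congˡ z) (solve 4 (λ t a c d → t E.⁴ :* (a :* (c :+ d)) ⊜ t :* a :* (t E.³ :* c :+ t E.³ :* d)) t a c d)) ,
    trans (solve 2 (λ t b → (t E.⁴ :* b) E.² ⊜ t E.⁴ E.² :* b E.²) t e)
      (trans (*-congˡ z′) (solve 4 (λ t a c d → t E.⁴ E.² :* (a :* (c :+ d)) ⊜ t E.⁴ :* t :* a :* (t E.³ :* c :+ t E.³ :* d)) t f c d))
  ⇝-twoCubes swaps (z , z′) = z′ , z
  ⇝-twoCubes {plücker a b c d e f} (scales t t≉0) (z , z′) = move b a z , move e f z′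
    where
    move : ∀ x y → x ² ≈ y * (c + d) → (t * x) ² ≈ t * y * (t * c + t * d)
    move x y h = trans (solve 2 (λ t x → (t :* x) E.² ⊜ t E.² :* x E.²) t x)
      (trans (*-congˡ h) (solve 4 (λ t y c d → t E.² :* (y :* (c :+ d)) ⊜ t :* y :* (t :* c :+ t :* d)) t y c d))
  ⇝-twoCubes (a ⨾ b) z = ⇝-twoCubes b (⇝-twoCubes a z)

  ⇝-relation : ∀ {p q} → p ⇝ q → relation p ≈ 0# → relation q ≈ 0#
  ⇝-relation (same e) r = trans (sym (relation-cong e)) r
  ⇝-relation {plücker a b c d e f} (shifts t) r =
    trans (solve 7 (λ t → onPlücker λ p → E.relation (E.shift t p) ⊜ E.relation p) t a b c d e f) r
  ⇝-relation {plücker a b c d e f} (dilates t t≉0) r =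
    trans (solve 7 (λ t → onPlücker λ p → E.relation (E.dilate t p) ⊜ t E.³ E.² :* E.relation p) t a b c d e f)
          (trans (*-congˡ r) (zeroʳ _))
  ⇝-relation {plücker a b c d e f} swaps r =
    trans (solve 6 (onPlücker λ p → E.relation (E.swap p) ⊜ E.relation p) a b c d e f) r
  ⇝-relation {plücker a b c d e f} (scales t t≉0) r =
    trans (solve 7 (λ t → onPlücker λ p → E.relation (E.scaleᵖ t p) ⊜ t E.² :* E.relation p) t a b c d e f)
          (trans (*-congˡ r) (zeroʳ _))
  ⇝-relation (a ⨾ b) r = ⇝-relation b (⇝-relation a r)

-- Möbius substitutions, and the pencil behind a Plücker vector

module Substitution (F : CommutativeRing 0ℓ 0ℓ) (isField : IsField F)
  (1+1≈0 : HasChar2 F)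
  (_≟0 : ZeroTest F) where

  open CommutativeRing F
  open FieldProperties F isField
  open Char2 F 1+1≈0
  open Forms F
  open Pencils F isField 1+1≈0

  wedge-shift : ∀ t g h → shift t (wedge g h) ≋ wedge (shiftᶜ t g) (shiftᶜ t h)
  wedge-shift t (cubic a b c d) (cubic a′ b′ c′ d′) = solveᵖ 9
    (λ t → onCubic λ g → onCubic λ h → E.shift t (E.wedge g h) ⊜ E.wedge (E.shiftᶜ t g) (E.shiftᶜ t h)) t a b c d a′ b′ c′ d′

  wedge-dilate : ∀ s g h → dilate s (wedge g h) ≋ wedge (dilateᶜ s g) (dilateᶜ s h)
  wedge-dilate s (cubic a b c d) (cubic a′ b′ c′ d′) = solveᵖ 9
    (λ s → onCubic λ g → onCubic λ h → E.dilate s (E.wedge g h) ⊜ E.wedge (E.dilateᶜ s g) (E.dilateᶜ s h)) s a b c d a′ b′ c′ d′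

  wedge-swap : ∀ g h → swap (wedge g h) ≋ wedge (swapᶜ g) (swapᶜ h)
  wedge-swap (cubic a b c d) (cubic a′ b′ c′ d′) = plücker-≈
    (+-comm _ _) (+-comm _ _) (+-comm _ _) (+-comm _ _) (+-comm _ _) (+-comm _ _)

  wedge-combine : ∀ a b c d g h →
                  scaleᵖ (a * d + b * c) (wedge g h) ≋ wedge (combine a b g h) (combine c d g h)
  wedge-combine a b c d (cubic x y z w) (cubic x′ y′ z′ w′) = solveᵖ 12
    (λ a b c d → onCubic λ g → onCubic λ h →
      E.scaleᵖ (a :* d :+ b :* c) (E.wedge g h) ⊜ E.wedge (E.combine a b g h) (E.combine c d g h))
    a b c d x y z w x′ y′ z′ w′

  relation-wedge : ∀ g h → relation (wedge g h) ≈ 0#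
  relation-wedge (cubic a b c d) (cubic a′ b′ c′ d′) =
    solve 8 (onCubic λ g → onCubic λ h → E.relation (E.wedge g h) ⊜ 𝟎) a b c d a′ b′ c′ d′

  substitute-cong : ∀ {a a′ b b′ c c′ d d′} g → a ≈ a′ → b ≈ b′ → c ≈ c′ → d ≈ d′ →
                    substitute a b c d g ≋ᶜ substitute a′ b′ c′ d′ g
  substitute-cong g a b c d = cubic-≈
    (go (³-cong d) (*-cong b (²-cong d)) (*-cong (²-cong b) d) (³-cong b))
    (go (*-cong (²-cong d) c) (*-cong a (²-cong d)) (*-cong (²-cong b) c) (*-cong a (²-cong b)))
    (go (*-cong d (²-cong c)) (*-cong b (²-cong c)) (*-cong (²-cong a) d) (*-cong (²-cong a) b))
    (go (³-cong c) (*-cong a (²-cong c)) (*-cong (²-cong a) c) (³-cong a))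
    where
    go : ∀ {x x′ y y′ z z′ w w′} → x ≈ x′ → y ≈ y′ → z ≈ z′ → w ≈ w′ →
         c₀ g * x + c₁ g * y + c₂ g * z + c₃ g * w ≈ c₀ g * x′ + c₁ g * y′ + c₂ g * z′ + c₃ g * w′
    go e f g h = +-cong (+-cong (+-cong (*-congˡ e) (*-congˡ f)) (*-congˡ g)) (*-congˡ h)

  shifts-wedge : ∀ t {g h} → wedge g h ⇝ wedge (shiftᶜ t g) (shiftᶜ t h)
  shifts-wedge t = shifts t ⨾ same (wedge-shift t _ _)

  dilates-wedge : ∀ s {g h} → ¬ (s ≈ 0#) → wedge g h ⇝ wedge (dilateᶜ s g) (dilateᶜ s h)
  dilates-wedge s s≉0 = dilates s s≉0 ⨾ same (wedge-dilate s _ _)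

  swaps-wedge : ∀ {g h} → wedge g h ⇝ wedge (swapᶜ g) (swapᶜ h)
  swaps-wedge = swaps ⨾ same (wedge-swap _ _)

  combines-wedge : ∀ a b c d {g h} → ¬ (a * d + b * c ≈ 0#) → wedge g h ⇝ wedge (combine a b g h) (combine c d g h)
  combines-wedge a b c d nz = scales _ nz ⨾ same (wedge-combine a b c d _ _)

  -- (a x + b)/(c x + d) = m + e/(c x + d)
  substitute-fraction : ∀ m e c d g → dilateᶜ c (shiftᶜ d (swapᶜ (dilateᶜ e (shiftᶜ m g))))
                      ≋ᶜ substitute (m * c) (e + m * d) c d g
  substitute-fraction m e c d (cubic x y z w) = solveᶜ 8
    (λ m e c d → onCubic λ g → E.dilateᶜ c (E.shiftᶜ d (E.swapᶜ (E.dilateᶜ e (E.shiftᶜ m g))))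
      ⊜ E.substitute (m :* c) (e :+ m :* d) c d g) m e c d x y z w

  substitute-affine : ∀ a b d g h → substitute (a * d) (b * d) 0# d g
                    ≋ᶜ combine (d ³) 0# (dilateᶜ a (shiftᶜ b g)) (dilateᶜ a (shiftᶜ b h))
  substitute-affine a b d (cubic x y z w) (cubic x′ y′ z′ w′) = solveᶜ 11
    (λ a b d → onCubic λ g → onCubic λ h → E.substitute (a :* d) (b :* d) 𝟎 d g
      ⊜ E.combine (d E.³) 𝟎 (E.dilateᶜ a (E.shiftᶜ b g)) (E.dilateᶜ a (E.shiftᶜ b h))) a b d x y z w x′ y′ z′ w′

  combine-swap : ∀ a b g h → combine a b g h ≋ᶜ combine b a h g
  combine-swap a b g h = cubic-≈ (+-comm _ _) (+-comm _ _) (+-comm _ _) (+-comm _ _)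

  -- The Bruhat decomposition of PGL₂. For c ≠ 0 the fraction is a shift, a dilation, the inversion,
  -- a shift and a dilation. For c = 0 the map is affine, and dividing the matrix by d multiplies
  -- both cubics by d³, a diagonal change of basis.
  substitute⇝ : ∀ a b c d g h → ¬ (a * d + b * c ≈ 0#) →
                wedge g h ⇝ wedge (substitute a b c d g) (substitute a b c d h)
  substitute⇝ a b c d g h det≉0 with c ≟0
  ... | no c≉0 =
    shifts-wedge m ⨾ dilates-wedge e e≉0 ⨾ swaps-wedge ⨾ shifts-wedge d ⨾ dilates-wedge c c≉0 ⨾
    same (wedge-cong (step g) (step h))
    where
    γ = proj₁ (inverse c c≉0)
    cγ≈1 : c * γ ≈ 1#
    cγ≈1 = proj₂ (inverse c c≉0)
    m = a * γ
    e = (a * d + b * c) * γ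
    e≉0 : ¬ (e ≈ 0#)
    e≉0 = *-nonzero det≉0 (inverse-nonzero cγ≈1)
    mc≈a : m * c ≈ a
    mc≈a = trans (solve 3 (λ a c γ → a :* γ :* c ⊜ c :* γ :* a) a c γ) (trans (*-congʳ cγ≈1) (*-identityˡ a))
    e+md≈b : e + m * d ≈ b
    e+md≈b = trans (solve 5 (λ a b c d γ → (a :* d :+ b :* c) :* γ :+ a :* γ :* d ⊜ c :* γ :* b) a b c d γ)
                   (trans (*-congʳ cγ≈1) (*-identityˡ b))
    step : ∀ g → dilateᶜ c (shiftᶜ d (swapᶜ (dilateᶜ e (shiftᶜ m g)))) ≋ᶜ substitute a b c d g
    step g = ≋ᶜ-trans (substitute-fraction m e c d g) (substitute-cong g mc≈a e+md≈b refl refl)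
  ... | yes c≈0 =
    shifts-wedge b′ ⨾ dilates-wedge a′ (*-nonzero a≉0 (inverse-nonzero dδ≈1)) ⨾
    combines-wedge (d ³) 0# 0# (d ³)
      (nonzero-resp (sym (trans (+-congˡ (zeroˡ 0#)) (+-identityʳ _))) (*-nonzero d³≉0 d³≉0)) ⨾
    same (wedge-cong (≋ᶜ-sym (step g h)) (≋ᶜ-sym (≋ᶜ-trans (step h g) (combine-swap _ _ _ _))))
    where
    ad≉0 : ¬ (a * d ≈ 0#)
    ad≉0 = nonzero-resp (trans (+-congˡ (trans (*-congˡ c≈0) (zeroʳ b))) (+-identityʳ _)) det≉0
    a≉0 = *-nonzeroˡ ad≉0
    d≉0 = *-nonzeroʳ ad≉0
    d³≉0 : ¬ (d ³ ≈ 0#)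
    d³≉0 = *-nonzero (*-nonzero d≉0 d≉0) d≉0
    δ = proj₁ (inverse d d≉0)
    dδ≈1 : d * δ ≈ 1#
    dδ≈1 = proj₂ (inverse d d≉0)
    a′ = a * δ
    b′ = b * δ
    back : ∀ x → x ≈ x * δ * d
    back x = sym (trans (solve 3 (λ x d δ → x :* δ :* d ⊜ d :* δ :* x) x d δ) (trans (*-congʳ dδ≈1) (*-identityˡ x)))
    step : ∀ g h → substitute a b c d g ≋ᶜ combine (d ³) 0# (dilateᶜ a′ (shiftᶜ b′ g)) (dilateᶜ a′ (shiftᶜ b′ h))
    step g h = ≋ᶜ-trans (substitute-cong g (back a) (back b) c≈0 refl) (substitute-affine a′ b′ d g h)

  substitute-shift : ∀ t a b c d g → substitute a (a * t + b) c (c * t + d) g ≋ᶜ shiftᶜ t (substitute a b c d g)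
  substitute-shift t a b c d (cubic x y z w) = solveᶜ 9
    (λ t a b c d → onCubic λ g → E.substitute a (a :* t :+ b) c (c :* t :+ d) g ⊜ E.shiftᶜ t (E.substitute a b c d g)) t a b c d x y z w

  substitute-dilate : ∀ s a b c d g → substitute (a * s) b (c * s) d g ≋ᶜ dilateᶜ s (substitute a b c d g)
  substitute-dilate s a b c d (cubic x y z w) = solveᶜ 9
    (λ s a b c d → onCubic λ g → E.substitute (a :* s) b (c :* s) d g ⊜ E.dilateᶜ s (E.substitute a b c d g)) s a b c d x y z w

  substitute-swap : ∀ a b c d g → substitute b a d c g ≋ᶜ swapᶜ (substitute a b c d g)
  substitute-swap a b c d (cubic x y z w) = solveᶜ 8
    (λ a b c d → onCubic λ g → E.substitute b a d c g ⊜ E.swapᶜ (E.substitute a b c d g)) a b c d x y z w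

  substitute-identity : ∀ g → substitute 1# 0# 0# 1# g ≋ᶜ g
  substitute-identity (cubic x y z w) = solveᶜ 4 (onCubic λ g → E.substitute 𝟏 𝟎 𝟎 𝟏 g ⊜ g) x y z w

  -- Shifts, dilations and swaps of a chain accumulate in one matrix by multiplication on the right,
  -- and the scalars accumulate in μ. The change of basis behind μ is reconstructed only at the end.
  Realised : Cubic Carrier → Cubic Carrier → Plücker Carrier → Set
  Realised g h q = ∃ λ a → ∃ λ b → ∃ λ c → ∃ λ d → ¬ (a * d + b * c ≈ 0#) ×
    ∃ λ μ → ¬ (μ ≈ 0#) × wedge (substitute a b c d g) (substitute a b c d h) ≋ scaleᵖ μ q

  realise : ∀ {g h p q} → p ⇝ q → Realised g h p → Realised g h q
  realise (same p≋q) (a , b , c , d , det≉0 , μ , μ≉0 , e) =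
    a , b , c , d , det≉0 , μ , μ≉0 , ≋-trans e (scaleᵖ-cong refl p≋q)
  realise {g} {h} (shifts t {plücker x y z u v w}) (a , b , c , d , det≉0 , μ , μ≉0 , e) =
    a , a * t + b , c , c * t + d ,
    nonzero-resp (solve 5 (λ a b c d t → a :* d :+ b :* c ⊜ a :* (c :* t :+ d) :+ (a :* t :+ b) :* c) a b c d t) det≉0 ,
    μ , μ≉0 ,
    ≋-trans (wedge-cong (substitute-shift t a b c d g) (substitute-shift t a b c d h))
      (≋-trans (≋-sym (wedge-shift t _ _)) (≋-trans (shift-cong t e)
        (solveᵖ 8 (λ t μ → onPlücker λ p → E.shift t (E.scaleᵖ μ p) ⊜ E.scaleᵖ μ (E.shift t p)) t μ x y z u v w)))
  realise {g} {h} (dilates s {plücker x y z u v w} s≉0) (a , b , c , d , det≉0 , μ , μ≉0 , e) =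
    a * s , b , c * s , d ,
    nonzero-resp (solve 5 (λ a b c d s → s :* (a :* d :+ b :* c) ⊜ a :* s :* d :+ b :* (c :* s)) a b c d s) (*-nonzero s≉0 det≉0) ,
    μ , μ≉0 ,
    ≋-trans (wedge-cong (substitute-dilate s a b c d g) (substitute-dilate s a b c d h))
      (≋-trans (≋-sym (wedge-dilate s _ _)) (≋-trans (dilate-cong s e)
        (solveᵖ 8 (λ s μ → onPlücker λ p → E.dilate s (E.scaleᵖ μ p) ⊜ E.scaleᵖ μ (E.dilate s p)) s μ x y z u v w)))
  realise {g} {h} swaps (a , b , c , d , det≉0 , μ , μ≉0 , e) =
    b , a , d , c ,
    nonzero-resp (+-comm _ _) det≉0 ,
    μ , μ≉0 ,
    ≋-trans (wedge-cong (substitute-swap a b c d g) (substitute-swap a b c d h))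
      (≋-trans (≋-sym (wedge-swap _ _)) (swap-cong e))
  realise {g} {h} (scales ν {plücker x y z u v w} ν≉0) (a , b , c , d , det≉0 , μ , μ≉0 , e) with inverse ν ν≉0
  ... | r , νr≈1 = a , b , c , d , det≉0 , μ * r , *-nonzero μ≉0 (inverse-nonzero νr≈1) ,
    ≋-trans e (plücker-≈ (absorb x) (absorb y) (absorb z) (absorb u) (absorb v) (absorb w))
    where
    absorb : ∀ x → μ * x ≈ μ * r * (ν * x)
    absorb x = sym (trans (solve 4 (λ μ r ν x → μ :* r :* (ν :* x) ⊜ ν :* r :* (μ :* x)) μ r ν x) (trans (*-congʳ νr≈1) (*-identityˡ _)))
  realise (r ⨾ s) x = realise s (realise r x)

  realise-wedge : ∀ {g h q} → wedge g h ⇝ q → Realised g h q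
  realise-wedge {g} {h} r = realise r (1# , 0# , 0# , 1# ,
    nonzero-resp (solve 0 (𝟏 ⊜ 𝟏 :* 𝟏 :+ 𝟎 :* 𝟎)) 1≉0 , 1# , 1≉0 ,
    ≋-trans (wedge-cong (substitute-identity g) (substitute-identity h))
      (plücker-≈ (one _) (one _) (one _) (one _) (one _) (one _)))
    where
    one : ∀ x → x ≈ 1# * x
    one x = sym (*-identityˡ x)

  column : Cubic Carrier → Fin 4 → Carrier
  column g 0F = c₀ g
  column g 1F = c₁ g
  column g 2F = c₂ g
  column g 3F = c₃ g

  minor : Cubic Carrier → Cubic Carrier → Fin 4 → Fin 4 → Carrier
  minor g h i j = column g i * column h j + column g j * column h i

  minor-proportional : ∀ {g h s t μ} → wedge g h ≋ scaleᵖ μ (wedge s t) → ∀ i j → minor g h i j ≈ μ * minor s t i j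
  minor-proportional {g} {h} {s} {t} {μ} (plücker-≈ a b c d e f) = go
    where
    diagonal : ∀ x y → x + x ≈ μ * (y + y)
    diagonal x y = trans (x+x≈0 x) (sym (trans (*-congˡ (x+x≈0 y)) (zeroʳ μ)))
    flip : ∀ {x y z w} → x + y ≈ μ * (z + w) → y + x ≈ μ * (w + z)
    flip e = trans (+-comm _ _) (trans e (*-congˡ (+-comm _ _)))
    go : ∀ i j → minor g h i j ≈ μ * minor s t i j
    go 0F 0F = diagonal _ _
    go 1F 1F = diagonal _ _
    go 2F 2F = diagonal _ _
    go 3F 3F = diagonal _ _
    go 0F 1F = a
    go 0F 2F = b
    go 0F 3F = c
    go 1F 2F = d
    go 1F 3F = e
    go 2F 3F = f
    go 1F 0F = flip a
    go 2F 0F = flip b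
    go 3F 0F = flip c
    go 2F 1F = flip d
    go 3F 1F = flip e
    go 3F 2F = flip f

  -- Proportional Plücker vectors come from the same pencil: solve for two columns by Cramer's rule.
  same-pencil : ∀ {g h s t μ} → ¬ (μ ≈ 0#) → wedge g h ≋ scaleᵖ μ (wedge s t) →
                ∀ i j → ¬ (minor s t i j ≈ 0#) →
                ∃ λ α → ∃ λ β → ∃ λ γ → ∃ λ δ → ¬ (α * δ + β * γ ≈ 0#)
                  × s ≋ᶜ combine α β g h × t ≋ᶜ combine γ δ g h
  same-pencil {g} {h} {s} {t} {μ} μ≉0 prop i j q≉0 =
    coef₁ s , coef₂ s , coef₁ t , coef₂ t ,
    nonzero-resp (sym det≈) (*-nonzero q≉0 (inverse-nonzero Dε≈1)) ,
    cubic-≈ (solves-s 0F) (solves-s 1F) (solves-s 2F) (solves-s 3F) ,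
    cubic-≈ (solves-t 0F) (solves-t 1F) (solves-t 2F) (solves-t 3F)
    where
    minors = minor-proportional {g} {h} {s} {t} prop
    D = minor g h i j
    D≉0 : ¬ (D ≈ 0#)
    D≉0 = nonzero-resp (sym (minors i j)) (*-nonzero μ≉0 q≉0)
    ε = proj₁ (inverse D D≉0)
    Dε≈1 : D * ε ≈ 1#
    Dε≈1 = proj₂ (inverse D D≉0)
    gi = column g i
    gj = column g j
    hi = column h i
    hj = column h j
    coef₁ coef₂ : Cubic Carrier → Carrier
    coef₁ u = (column u i * hj + column u j * hi) * ε
    coef₂ u = (gi * column u j + gj * column u i) * ε
    det≈ : coef₁ s * coef₂ t + coef₂ s * coef₁ t ≈ minor s t i j * ε
    det≈ = trans
      (solve 9 (λ gi gj hi hj si sj ti tj ε →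
          (si :* hj :+ sj :* hi) :* ε :* ((gi :* tj :+ gj :* ti) :* ε) :+ (gi :* sj :+ gj :* si) :* ε :* ((ti :* hj :+ tj :* hi) :* ε)
          ⊜ (gi :* hj :+ gj :* hi) :* ε :* ((si :* tj :+ sj :* ti) :* ε))
        gi gj hi hj (column s i) (column s j) (column t i) (column t j) ε)
      (trans (*-congʳ Dε≈1) (*-identityˡ _))
    -- The hypothesis says that the 3 × 3 minor of u, g, h in columns i, j, k vanishes; solving for
    -- column k gives the combination found by Cramer's rule.
    expand : ∀ u k → column u i * minor g h j k + column u j * minor g h i k ≈ column u k * D →
             column u k ≈ coef₁ u * column g k + coef₂ u * column h k
    expand u k eq = sym (trans
      (solve 9 (λ gi gj hi hj ui uj gk hk ε →
          (ui :* hj :+ uj :* hi) :* ε :* gk :+ (gi :* uj :+ gj :* ui) :* ε :* hk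
          ⊜ (ui :* (gj :* hk :+ gk :* hj) :+ uj :* (gi :* hk :+ gk :* hi)) :* ε)
        gi gj hi hj (column u i) (column u j) (column g k) (column h k) ε)
      (trans (*-congʳ eq) (trans (*-assoc _ _ _) (trans (*-congˡ Dε≈1) (*-identityʳ _)))))
    solves-s : ∀ k → column s k ≈ coef₁ s * column g k + coef₂ s * column h k
    solves-s k = expand s k (trans (+-cong (*-congˡ (minors j k)) (*-congˡ (minors i k))) (trans
      (solve 7 (λ μ si sj sk ti tj tk → si :* (μ :* (sj :* tk :+ sk :* tj)) :+ sj :* (μ :* (si :* tk :+ sk :* ti))
          ⊜ sk :* (μ :* (si :* tj :+ sj :* ti)))
        μ (column s i) (column s j) (column s k) (column t i) (column t j) (column t k))
      (*-congˡ (sym (minors i j)))))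
    solves-t : ∀ k → column t k ≈ coef₁ t * column g k + coef₂ t * column h k
    solves-t k = expand t k (trans (+-cong (*-congˡ (minors j k)) (*-congˡ (minors i k))) (trans
      (solve 7 (λ μ si sj sk ti tj tk → ti :* (μ :* (sj :* tk :+ sk :* tj)) :+ tj :* (μ :* (si :* tk :+ sk :* ti))
          ⊜ tk :* (μ :* (si :* tj :+ sj :* ti)))
        μ (column s i) (column s j) (column s k) (column t i) (column t j) (column t k))
      (*-congˡ (sym (minors i j)))))

  -- Every term of the resultant contains one of p₀₁, p₀₂ and p₀₃, so these cannot all vanish; one
  -- index of the minor can thus be fixed as 0.
  nonzero-minor : ∀ s t → ¬ (resultant (wedge s t) ≈ 0#) → ∃ λ j → ¬ (minor s t 0F j ≈ 0#)
  nonzero-minor s t res≉0 with minor s t 0F 1F ≟0 | minor s t 0F 2F ≟0 | minor s t 0F 3F ≟0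
  ... | no ≉0 | _     | _     = 1F , ≉0
  ... | yes _ | no ≉0 | _     = 2F , ≉0
  ... | yes _ | yes _ | no ≉0 = 3F , ≉0
  ... | yes a | yes b | yes c = contradiction
    (trans (resultant-cong {q = plücker 0# 0# 0# (p₁₂ w) (p₁₃ w) (p₂₃ w)} (plücker-≈ a b c refl refl refl))
      (solve 3 (λ d e f → E.resultant (plücker 𝟎 𝟎 𝟎 d e f) ⊜ 𝟎) (p₁₂ w) (p₁₃ w) (p₂₃ w)))
    res≉0
    where w = wedge s t

-- Coefficient lists as a commutative ring

module PolyRing (R : CommutativeRing 0ℓ 0ℓ) where

  open CommutativeRing R
  open RingProperties ring using (-0#≈0#)

  infix 4 _≈ᵖ_
  infixl 6 _+ᵖ_
  infixl 7 _*ᵖ_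
  _+ᵖ_ _*ᵖ_ : Poly R → Poly R → Poly R
  _+ᵖ_ = _+ₚ_ R
  _*ᵖ_ = _*ₚ_ R

  -- _≈ₚ_ as a record, so that Agda can infer the two polynomials from an equation between them.
  record _≈ᵖ_ (p q : Poly R) : Set where
    constructor pointwise
    field at : _≈ₚ_ R p q

  open _≈ᵖ_ public

  negate : Poly R → Poly R
  negate = List.map (λ x → - x)

  coeff-+ : ∀ p q i → coeff R (p +ᵖ q) i ≈ coeff R p i + coeff R q i
  coeff-+ []      q       i       = sym (+-identityˡ _)
  coeff-+ (x ∷ p) []      i       = sym (+-identityʳ _)
  coeff-+ (x ∷ p) (y ∷ q) zero    = refl
  coeff-+ (x ∷ p) (y ∷ q) (suc i) = coeff-+ p q i

  coeff-scale : ∀ a p i → coeff R (scale R a p) i ≈ a * coeff R p i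
  coeff-scale a []      i       = sym (zeroʳ a)
  coeff-scale a (x ∷ p) zero    = refl
  coeff-scale a (x ∷ p) (suc i) = coeff-scale a p i

  coeff-negate : ∀ p i → coeff R (negate p) i ≈ - coeff R p i
  coeff-negate []      i       = sym -0#≈0#
  coeff-negate (x ∷ p) zero    = refl
  coeff-negate (x ∷ p) (suc i) = coeff-negate p i

  +ᵖ-commutativeMonoid : CommutativeMonoid 0ℓ 0ℓ
  +ᵖ-commutativeMonoid = record
    { Carrier = Poly R
    ; _≈_ = _≈ᵖ_
    ; _∙_ = _+ᵖ_
    ; ε   = []
    ; isCommutativeMonoid = record
      { isMonoid = record
        { isSemigroup = record
          { isMagma = record
            { isEquivalence = record
              { refl  = pointwise λ i → refl
              ; sym   = λ e → pointwise λ i → sym (at e i)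
              ; trans = λ e f → pointwise λ i → trans (at e i) (at f i)
              }
            ; ∙-cong = λ {p} {q} {r} {s} e f → pointwise λ i →
                trans (coeff-+ p r i) (trans (+-cong (at e i) (at f i)) (sym (coeff-+ q s i)))
            }
          ; assoc = λ p q r → pointwise λ i →
              trans (coeff-+ (p +ᵖ q) r i) (trans (+-congʳ (coeff-+ p q i)) (trans (+-assoc _ _ _)
              (trans (+-congˡ (sym (coeff-+ q r i))) (sym (coeff-+ p (q +ᵖ r) i)))))
          }
        ; identity = (λ p → pointwise λ i → refl) , (λ p → pointwise λ i → trans (coeff-+ p [] i) (+-identityʳ _))
        }
      ; comm = λ p q → pointwise λ i → trans (coeff-+ p q i) (trans (+-comm _ _) (sym (coeff-+ q p i)))
      }
    }

  module Sum = CommutativeMonoid +ᵖ-commutativeMonoid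
  open CommutativeSemigroupProperties Sum.commutativeSemigroup
    using () renaming (interchange to interchangeᵖ)
  open SetoidReasoning Sum.setoid

  0∷-cong : ∀ {p q} → p ≈ᵖ q → (0# ∷ p) ≈ᵖ (0# ∷ q)
  0∷-cong e = pointwise λ { zero → refl ; (suc i) → at e i }

  0∷-+ : ∀ p q → (0# ∷ (p +ᵖ q)) ≈ᵖ (0# ∷ p) +ᵖ (0# ∷ q)
  0∷-+ p q = pointwise λ { zero → sym (+-identityˡ 0#) ; (suc i) → refl }

  0∷[]≈[] : (0# ∷ []) ≈ᵖ []
  0∷[]≈[] = pointwise λ { zero → refl ; (suc i) → refl }

  scale-cong : ∀ {a b p q} → a ≈ b → p ≈ᵖ q → scale R a p ≈ᵖ scale R b q
  scale-cong {a} {b} {p} {q} e f = pointwise λ i →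
    trans (coeff-scale a p i) (trans (*-cong e (at f i)) (sym (coeff-scale b q i)))

  scale-+ : ∀ a p q → scale R a (p +ᵖ q) ≈ᵖ scale R a p +ᵖ scale R a q
  scale-+ a p q = pointwise λ i →
    trans (coeff-scale a (p +ᵖ q) i) (trans (*-congˡ (coeff-+ p q i)) (trans (distribˡ a _ _)
    (trans (+-cong (sym (coeff-scale a p i)) (sym (coeff-scale a q i))) (sym (coeff-+ (scale R a p) (scale R a q) i)))))

  +-scale : ∀ a b p → scale R (a + b) p ≈ᵖ scale R a p +ᵖ scale R b p
  +-scale a b p = pointwise λ i → trans (coeff-scale (a + b) p i) (trans (distribʳ _ a b)
    (trans (+-cong (sym (coeff-scale a p i)) (sym (coeff-scale b p i))) (sym (coeff-+ (scale R a p) (scale R b p) i))))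

  scale-0∷ : ∀ a p → scale R a (0# ∷ p) ≈ᵖ (0# ∷ scale R a p)
  scale-0∷ a p = pointwise λ { zero → zeroʳ a ; (suc i) → refl }

  scale-zero : ∀ {a} p → a ≈ 0# → scale R a p ≈ᵖ []
  scale-zero p e = pointwise λ i → trans (coeff-scale _ p i) (trans (*-congʳ e) (zeroˡ _))

  scale-scale : ∀ a b p → scale R a (scale R b p) ≈ᵖ scale R (a * b) p
  scale-scale a b p = pointwise λ i → trans (coeff-scale a (scale R b p) i) (trans (*-congˡ (coeff-scale b p i))
    (trans (sym (*-assoc a b _)) (sym (coeff-scale (a * b) p i))))

  *-congˡᵖ : ∀ p {q r} → q ≈ᵖ r → p *ᵖ q ≈ᵖ p *ᵖ r
  *-congˡᵖ []      e = Sum.refl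
  *-congˡᵖ (x ∷ p) e = Sum.∙-cong (scale-cong refl e) (0∷-cong (*-congˡᵖ p e))

  zero-*ᵖ : ∀ p q → p ≈ᵖ [] → p *ᵖ q ≈ᵖ []
  zero-*ᵖ []      q e = Sum.refl
  zero-*ᵖ (x ∷ p) q e = begin
    scale R x q +ᵖ (0# ∷ (p *ᵖ q))
      ≈⟨ Sum.∙-cong (scale-zero q (at e 0)) (0∷-cong (zero-*ᵖ p q (pointwise λ i → at e (suc i)))) ⟩
    (0# ∷ [])  ≈⟨ 0∷[]≈[] ⟩
    []         ∎

  *-congʳᵖ : ∀ p q r → p ≈ᵖ q → p *ᵖ r ≈ᵖ q *ᵖ r
  *-congʳᵖ []      q       r e = Sum.sym (zero-*ᵖ q r (Sum.sym e))
  *-congʳᵖ (x ∷ p) []      r e = zero-*ᵖ (x ∷ p) r e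
  *-congʳᵖ (x ∷ p) (y ∷ q) r e =
    Sum.∙-cong (scale-cong (at e 0) Sum.refl) (0∷-cong (*-congʳᵖ p q r (pointwise λ i → at e (suc i))))

  *-distribʳᵖ : ∀ r p q → (p +ᵖ q) *ᵖ r ≈ᵖ (p *ᵖ r) +ᵖ (q *ᵖ r)
  *-distribʳᵖ r []      q       = Sum.refl
  *-distribʳᵖ r (x ∷ p) []      = Sum.sym (Sum.identityʳ ((x ∷ p) *ᵖ r))
  *-distribʳᵖ r (x ∷ p) (y ∷ q) = begin
    scale R (x + y) r +ᵖ (0# ∷ ((p +ᵖ q) *ᵖ r))
      ≈⟨ Sum.∙-cong (+-scale x y r) (Sum.trans (0∷-cong (*-distribʳᵖ r p q)) (0∷-+ (p *ᵖ r) (q *ᵖ r))) ⟩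
    (scale R x r +ᵖ scale R y r) +ᵖ ((0# ∷ (p *ᵖ r)) +ᵖ (0# ∷ (q *ᵖ r)))
      ≈⟨ interchangeᵖ (scale R x r) (scale R y r) (0# ∷ (p *ᵖ r)) (0# ∷ (q *ᵖ r)) ⟩
    ((x ∷ p) *ᵖ r) +ᵖ ((y ∷ q) *ᵖ r)  ∎

  *-∷ : ∀ p y q → p *ᵖ (y ∷ q) ≈ᵖ scale R y p +ᵖ (0# ∷ (p *ᵖ q))
  *-∷ []      y q = Sum.sym 0∷[]≈[]
  *-∷ (x ∷ p) y q = pointwise λ { zero → +-congʳ (*-comm x y) ; (suc i) → at step i }
    where
    step : scale R x q +ᵖ (p *ᵖ (y ∷ q)) ≈ᵖ scale R y p +ᵖ ((x ∷ p) *ᵖ q)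
    step = begin
      scale R x q +ᵖ (p *ᵖ (y ∷ q))
        ≈⟨ Sum.∙-cong Sum.refl (*-∷ p y q) ⟩
      scale R x q +ᵖ (scale R y p +ᵖ (0# ∷ (p *ᵖ q)))
        ≈⟨ Sum.assoc (scale R x q) (scale R y p) _ ⟨
      (scale R x q +ᵖ scale R y p) +ᵖ (0# ∷ (p *ᵖ q))
        ≈⟨ Sum.∙-cong (Sum.comm (scale R x q) (scale R y p)) Sum.refl ⟩
      (scale R y p +ᵖ scale R x q) +ᵖ (0# ∷ (p *ᵖ q))
        ≈⟨ Sum.assoc (scale R y p) (scale R x q) _ ⟩
      scale R y p +ᵖ ((x ∷ p) *ᵖ q)  ∎

  *-[] : ∀ p → p *ᵖ [] ≈ᵖ []
  *-[] []      = Sum.refl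
  *-[] (x ∷ p) = Sum.trans (0∷-cong (*-[] p)) 0∷[]≈[]

  *-commᵖ : ∀ p q → p *ᵖ q ≈ᵖ q *ᵖ p
  *-commᵖ []      q = Sum.sym (*-[] q)
  *-commᵖ (x ∷ p) q = begin
    scale R x q +ᵖ (0# ∷ (p *ᵖ q))  ≈⟨ Sum.∙-cong Sum.refl (0∷-cong (*-commᵖ p q)) ⟩
    scale R x q +ᵖ (0# ∷ (q *ᵖ p))  ≈⟨ *-∷ q x p ⟨
    q *ᵖ (x ∷ p)                    ∎

  scale-* : ∀ a p q → scale R a p *ᵖ q ≈ᵖ scale R a (p *ᵖ q)
  scale-* a []      q = Sum.refl
  scale-* a (x ∷ p) q = begin
    scale R (a * x) q +ᵖ (0# ∷ (scale R a p *ᵖ q))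
      ≈⟨ Sum.∙-cong (Sum.sym (scale-scale a x q)) (Sum.trans (0∷-cong (scale-* a p q)) (Sum.sym (scale-0∷ a (p *ᵖ q)))) ⟩
    scale R a (scale R x q) +ᵖ scale R a (0# ∷ (p *ᵖ q))
      ≈⟨ scale-+ a (scale R x q) (0# ∷ (p *ᵖ q)) ⟨
    scale R a ((x ∷ p) *ᵖ q)  ∎

  0∷-* : ∀ p q → (0# ∷ p) *ᵖ q ≈ᵖ (0# ∷ (p *ᵖ q))
  0∷-* p q = Sum.∙-cong (scale-zero q refl) Sum.refl

  *-assocᵖ : ∀ p q r → (p *ᵖ q) *ᵖ r ≈ᵖ p *ᵖ (q *ᵖ r)
  *-assocᵖ []      q r = Sum.refl
  *-assocᵖ (x ∷ p) q r = begin
    (scale R x q +ᵖ (0# ∷ (p *ᵖ q))) *ᵖ r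
      ≈⟨ *-distribʳᵖ r (scale R x q) (0# ∷ (p *ᵖ q)) ⟩
    (scale R x q *ᵖ r) +ᵖ ((0# ∷ (p *ᵖ q)) *ᵖ r)
      ≈⟨ Sum.∙-cong (scale-* x q r) (Sum.trans (0∷-* (p *ᵖ q) r) (0∷-cong (*-assocᵖ p q r))) ⟩
    (x ∷ p) *ᵖ (q *ᵖ r)  ∎

  *-identityˡᵖ : ∀ p → (1# ∷ []) *ᵖ p ≈ᵖ p
  *-identityˡᵖ p = pointwise λ i → trans (coeff-+ (scale R 1# p) (0# ∷ []) i)
    (trans (+-cong (trans (coeff-scale 1# p i) (*-identityˡ _)) (at 0∷[]≈[] i)) (+-identityʳ _))

  negate-inverse : ∀ p → p +ᵖ negate p ≈ᵖ []
  negate-inverse p = pointwise λ i →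
    trans (coeff-+ p (negate p) i) (trans (+-congˡ (coeff-negate p i)) (-‿inverseʳ _))

  -- With this structure, polynomials over a ring of characteristic two can themselves be the
  -- variables of a `solve` identity.
  polyRing : CommutativeRing 0ℓ 0ℓ
  polyRing = record
    { Carrier = Poly R
    ; _≈_ = _≈ᵖ_
    ; _+_ = _+ᵖ_
    ; _*_ = _*ᵖ_
    ; -_  = negate
    ; 0#  = []
    ; 1#  = 1# ∷ []
    ; isCommutativeRing = record
      { isRing = record
        { +-isAbelianGroup = record
          { isGroup = record
            { isMonoid = Sum.isMonoid
            ; inverse  = (λ p → Sum.trans (Sum.comm (negate p) p) (negate-inverse p)) , negate-inverse
            ; ⁻¹-cong  = λ {p} {q} e → pointwise λ i →
                trans (coeff-negate p i) (trans (-‿cong (at e i)) (sym (coeff-negate q i)))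
            }
          ; comm = Sum.comm
          }
        ; *-cong     = λ {p} {q} {r} {s} e f → Sum.trans (*-congʳᵖ p q r e) (*-congˡᵖ q f)
        ; *-assoc    = *-assocᵖ
        ; *-identity = *-identityˡᵖ , λ p → Sum.trans (*-commᵖ p (1# ∷ [])) (*-identityˡᵖ p)
        ; distrib    =
            (λ p q r → Sum.trans (*-commᵖ p (q +ᵖ r)) (Sum.trans (*-distribʳᵖ p q r)
                       (Sum.∙-cong (*-commᵖ q p) (*-commᵖ r p)))) ,
            *-distribʳᵖ
        }
      ; *-comm = *-commᵖ
      }
    }

  scale-as-* : ∀ a p → scale R a p ≈ᵖ (a ∷ []) *ᵖ p
  scale-as-* a p = pointwise λ i →
    sym (trans (coeff-+ (scale R a p) (0# ∷ []) i) (trans (+-congˡ (at 0∷[]≈[] i)) (+-identityʳ _)))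

-- Bézout identities, the resultant and coprimality

module Coprimality (F : CommutativeRing 0ℓ 0ℓ) (isField : IsField F)
  (1+1≈0 : HasChar2 F)
  (_≟0 : ZeroTest F) where

  open CommutativeRing F hiding (zero)
  open FieldProperties F isField
  open Char2 F 1+1≈0
  open Forms F
  open Pencils F isField 1+1≈0 using (module E)
  open PolyRing F public
  module P = CommutativeRing polyRing

  infixl 6 _⊕_
  infixl 7 _⊗_
  _⊕_ _⊗_ : ∀ {n} → List (Exp n) → List (Exp n) → List (Exp n)
  _⊕_ {n} = _+ₚ_ (expRing n)
  _⊗_ {n} = _*ₚ_ (expRing n)

  1+1≈0ᵖ : P.1# P.+ P.1# P.≈ P.0#
  1+1≈0ᵖ = pointwise λ { zero → 1+1≈0 ; (suc i) → refl }

  module S = Char2 polyRing 1+1≈0ᵖ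

  infix 8 C_
  C_ : Carrier → Poly F
  C a = a ∷ []

  ZeroFrom : ℕ → Poly F → Set
  ZeroFrom m p = ∀ i → m ≤ i → coeff F p i ≈ 0#

  zeroFrom-length : ∀ p → ZeroFrom (length p) p
  zeroFrom-length []      i       _         = refl
  zeroFrom-length (x ∷ p) (suc i) (s≤s l≤i) = zeroFrom-length p i l≤i

  zeroFrom-0 : ∀ {p} → ZeroFrom 0 p → p ≈ᵖ []
  zeroFrom-0 z = pointwise λ i → z i z≤n

  zeroFrom-1 : ∀ {p} → ZeroFrom 1 p → p ≈ᵖ C (coeff F p 0)
  zeroFrom-1 z = pointwise λ { zero → refl ; (suc i) → z (suc i) (s≤s z≤n) }

  zeroFrom-suc⁻ : ∀ {n} p → coeff F p n ≈ 0# → ZeroFrom (suc n) p → ZeroFrom n p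
  zeroFrom-suc⁻ {n} p pn≈0 z i n≤i with ℕ.m≤n⇒m<n∨m≡n n≤i
  ... | inj₁ n<i    = z i n<i
  ... | inj₂ ≡.refl = pn≈0

  HasDegree : Poly F → ℕ → Set
  HasDegree p d = ¬ (coeff F p d ≈ 0#) × ZeroFrom (suc d) p

  degree : ∀ n p → ZeroFrom n p → p ≈ᵖ [] ⊎ ∃ (HasDegree p)
  degree zero    p z = inj₁ (zeroFrom-0 z)
  degree (suc n) p z with coeff F p n ≟0
  ... | yes pn≈0 = degree n p (zeroFrom-suc⁻ p pn≈0 z)
  ... | no  pn≉0 = inj₂ (n , pn≉0 , z)

  coeff-*-∷ : ∀ p x k i → coeff F (p *ᵖ (x ∷ k)) (suc i) ≈ x * coeff F p (suc i) + coeff F (p *ᵖ k) i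
  coeff-*-∷ p x k i = trans (at (*-∷ p x k) (suc i))
    (trans (coeff-+ (scale F x p) (0# ∷ (p *ᵖ k)) (suc i)) (+-congʳ (coeff-scale x p (suc i))))

  -- Degrees add over a field. The case m = 0 gives cancellation, and the case m = 1 shows that
  -- certain cofactors are constants.
  degree-factor : ∀ p {d} → HasDegree p d → ∀ m k → ZeroFrom (d ℕ.+ m) (p *ᵖ k) → ZeroFrom m k
  degree-factor p deg m [] z i m≤i = refl
  degree-factor p {d} deg@(pd≉0 , pz) (suc m) (x ∷ k) z (suc i) (s≤s m≤i) =
    degree-factor p deg m k tail i m≤i
    where
    tail : ZeroFrom (d ℕ.+ m) (p *ᵖ k)
    tail j d+m≤j = trans (sym (+-identityˡ _)) (trans (+-congʳ (sym (trans (*-congˡ (pz (suc j) (s≤s (ℕ.≤-trans (ℕ.m≤m+n d m) d+m≤j)))) (zeroʳ x))))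
      (trans (sym (coeff-*-∷ p x k j)) (z (suc j) (ℕ.≤-trans (ℕ.≤-reflexive (ℕ.+-suc d m)) (s≤s d+m≤j)))))
  degree-factor p {d} deg@(pd≉0 , pz) zero (x ∷ k) z = go
    where
    tail : ZeroFrom (d ℕ.+ 0) (p *ᵖ k)
    tail j d≤j = trans (sym (+-identityˡ _)) (trans (+-congʳ (sym (trans (*-congˡ (pz (suc j) (s≤s (ℕ.≤-trans (ℕ.m≤m+n d 0) d≤j)))) (zeroʳ x))))
      (trans (sym (coeff-*-∷ p x k j)) (z (suc j) (ℕ.≤-trans d≤j (ℕ.n≤1+n j)))))
    -- Once the tail k is zero the product is x p, whose coefficient of degree d forces x = 0.
    k≈[] : k ≈ᵖ []
    k≈[] = zeroFrom-0 (degree-factor p deg zero k tail)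
    p*k≈[] : (0# ∷ (p *ᵖ k)) ≈ᵖ []
    p*k≈[] = P.trans (0∷-cong (P.trans (*-congˡᵖ p k≈[]) (*-[] p))) 0∷[]≈[]
    x≈0 : x ≈ 0#
    x≈0 = *-cancelˡ-0 pd≉0 (trans (*-comm _ x) (trans (sym (coeff-scale x p d)) (trans (sym (+-identityʳ _))
      (trans (+-congˡ (sym (at p*k≈[] d))) (trans (sym (coeff-+ (scale F x p) (0# ∷ (p *ᵖ k)) d))
      (trans (sym (at (*-∷ p x k) d)) (z d (ℕ.≤-reflexive (ℕ.+-identityʳ d)))))))))
    go : ZeroFrom 0 (x ∷ k)
    go zero    _ = x≈0
    go (suc i) _ = at k≈[] i

  *ᵖ-cancel-0 : ∀ p {d} → HasDegree p d → ∀ k → p *ᵖ k ≈ᵖ [] → k ≈ᵖ []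
  *ᵖ-cancel-0 p deg k e = zeroFrom-0 (degree-factor p deg 0 k (λ i _ → at e i))

  *ᵖ-cancelˡ : ∀ p {d} → HasDegree p d → ∀ k l → p *ᵖ k ≈ᵖ p *ᵖ l → k ≈ᵖ l
  *ᵖ-cancelˡ p deg k l e = S.x+y≈0⇒x≈y (*ᵖ-cancel-0 p deg (k +ᵖ l)
    (P.trans (P.distribˡ p k l) (P.trans (P.+-congʳ e) (S.x+x≈0 (p *ᵖ l)))))

  -- Long division in Horner order: after g is divided, the remainder of X g + x is X r + x, of
  -- degree at most n, and one multiple of h removes its coefficient of degree n.
  divide : ∀ h {n} → HasDegree h n → ∀ g → ∃ λ q → ∃ λ r → g ≈ᵖ h *ᵖ q +ᵖ r × ZeroFrom n r
  divide h deg [] = [] , [] , P.sym (P.trans (P.+-identityʳ (h *ᵖ [])) (*-[] h)) , λ i _ → refl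
  divide h {n} deg@(hn≉0 , hz) (x ∷ g) with divide h deg g | inverse (coeff F h n) hn≉0
  ... | q , r , g≈hq+r , rz | ε , hε≈1 = (0# ∷ q) +ᵖ C t , s +ᵖ scale F t h , split , bound
    where
    s = x ∷ r
    t = coeff F s n * ε
    split : (x ∷ g) ≈ᵖ h *ᵖ ((0# ∷ q) +ᵖ C t) +ᵖ (s +ᵖ scale F t h)
    split = P.trans {j = (0# ∷ (h *ᵖ q)) +ᵖ s}
      (pointwise λ { zero → sym (+-identityˡ x) ; (suc i) → at g≈hq+r i })
      (P.trans (P.+-congʳ {s} (P.sym (P.trans (*-∷ h 0# q) (P.+-congʳ {0# ∷ (h *ᵖ q)} (scale-zero h refl)))))
      (P.trans (S.solve 4 (λ h X T s → h :* X :+ s ⊜ h :* (X :+ T) :+ (s :+ T :* h)) h (0# ∷ q) (C t) s)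
      (P.+-congˡ {h *ᵖ ((0# ∷ q) +ᵖ C t)} (P.+-congˡ {s} (P.sym (scale-as-* t h))))))
    bound : ZeroFrom n (s +ᵖ scale F t h)
    bound = zeroFrom-suc⁻ (s +ᵖ scale F t h) top rest
      where
      entry : ∀ i → coeff F (s +ᵖ scale F t h) i ≈ coeff F s i + t * coeff F h i
      entry i = trans (coeff-+ s (scale F t h) i) (+-congˡ (coeff-scale t h i))
      top : coeff F (s +ᵖ scale F t h) n ≈ 0#
      top = trans (entry n) (trans (+-congˡ (trans (*-assoc _ ε _) (trans (*-congˡ (trans (*-comm ε _) hε≈1)) (*-identityʳ _)))) (x+x≈0 _))
      rest : ZeroFrom (suc n) (s +ᵖ scale F t h)
      rest (suc i) (s≤s n≤i) = trans (entry (suc i))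
        (trans (+-cong (rz i n≤i) (trans (*-congˡ (hz (suc i) (s≤s n≤i))) (zeroʳ t))) (+-identityˡ 0#))

  -- The recursion is on the bound n for h: either its coefficient of degree n - 1 vanishes and the
  -- bound drops, or the remainder of g modulo h obeys the smaller bound.
  euclid : ∀ n g h → ZeroFrom n h →
           ∃ λ d → ∃ λ u → ∃ λ v → (∃ λ a → d *ᵖ a ≈ᵖ g) × (∃ λ b → d *ᵖ b ≈ᵖ h) × d ≈ᵖ u *ᵖ g +ᵖ v *ᵖ h
  euclid zero g h hz =
    g , P.1# , [] , (P.1# , P.*-identityʳ g) , ([] , P.trans (*-[] g) (P.sym (zeroFrom-0 hz))) ,
    P.sym (P.trans (P.+-identityʳ (P.1# *ᵖ g)) (P.*-identityˡ g))
  euclid (suc n) g h hz with coeff F h n ≟0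
  ... | yes hn≈0 = euclid n g h (zeroFrom-suc⁻ h hn≈0 hz)
  ... | no  hn≉0 with divide h (hn≉0 , hz) g
  ...   | q , r , g≈hq+r , rz with euclid n h r rz
  ...     | d , u , v , (a , da≈h) , (b , db≈r) , d≈uh+vr =
    d , v , u +ᵖ v *ᵖ q ,
    (a *ᵖ q +ᵖ b , P.trans (S.solve 4 (λ d a q b → d :* (a :* q :+ b) ⊜ d :* a :* q :+ d :* b) d a q b)
      (P.trans (P.+-cong (P.*-congʳ {q} da≈h) db≈r) (P.sym g≈hq+r))) ,
    (a , da≈h) ,
    P.trans d≈uh+vr (P.trans
      (S.solve 5 (λ u v h q r → u :* h :+ v :* r ⊜ v :* (h :* q :+ r) :+ (u :+ v :* q) :* h) u v h q r)
      (P.+-congʳ {(u +ᵖ v *ᵖ q) *ᵖ h} (P.*-congˡ {v} (P.sym g≈hq+r))))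

  Bézout : Poly F → Poly F → Set
  Bézout g h = ∃ λ u → ∃ λ v → ∃ λ r → ¬ (r ≈ 0#) × u *ᵖ g +ᵖ v *ᵖ h ≈ᵖ C r

  coprime⇒bézout : ∀ g h → ¬ (_≈ₚ_ F h []) → Coprime F g h → Bézout g h
  coprime⇒bézout g h h≉0 coprime with euclid (length h) g h (zeroFrom-length h)
  ... | d , u , v , (a , da≈g) , (b , db≈h) , d≈ =
    u , v , coeff F d 0 , r≉0 , P.trans (P.sym d≈) d≈C
    where
    d≈C : d ≈ᵖ C (coeff F d 0)
    d≈C = zeroFrom-1 (coprime d (a , at da≈g) (b , at db≈h))
    r≉0 : ¬ (coeff F d 0 ≈ 0#)
    r≉0 r≈0 = h≉0 (at (P.trans (P.sym db≈h) (zero-*ᵖ d b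
      (P.trans d≈C (pointwise λ { zero → r≈0 ; (suc i) → refl })))))

  -- A common divisor d has a cofactor w for which w d is the nonzero constant r. Degrees add, so d
  -- is constant.
  bézout⇒coprime : ∀ {g h} → Bézout g h → Coprime F g h
  bézout⇒coprime {g} {h} (u , v , r , r≉0 , bez) d (a , da≈g) (b , db≈h) = bound
    where
    w = u *ᵖ a +ᵖ v *ᵖ b
    w*d≈C : w *ᵖ d ≈ᵖ C r
    w*d≈C = P.trans (S.solve 5 (λ u v a b d → (u :* a :+ v :* b) :* d ⊜ u :* (d :* a) :+ v :* (d :* b)) u v a b d)
      (P.trans (P.+-cong (P.*-congˡ {u} {d *ᵖ a} (pointwise da≈g)) (P.*-congˡ {v} {d *ᵖ b} (pointwise db≈h))) bez)
    bound : DegLe F d 0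
    bound with degree (length w) w (zeroFrom-length w)
    ... | inj₁ w≈[] = contradiction (trans (sym (at w*d≈C 0)) (at (zero-*ᵖ w d w≈[]) 0)) r≉0
    ... | inj₂ (e , deg) = degree-factor w deg 1 d (λ i e+1≤i → trans (at w*d≈C i) (tail i (ℕ.≤-trans (ℕ.m≤n+m 1 e) e+1≤i)))
      where
      tail : ZeroFrom 1 (C r)
      tail (suc i) _ = refl

  toPoly-coefficients : ∀ p → DegLe F p 3 → p ≈ᵖ toPoly (coefficients p)
  toPoly-coefficients p deg = pointwise λ
    { 0 → refl ; 1 → refl ; 2 → refl ; 3 → refl
    ; (suc (suc (suc (suc i)))) → deg _ (s≤s (s≤s (s≤s (s≤s z≤n)))) }

  toPoly-degree : ∀ g → ZeroFrom 4 (toPoly g)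
  toPoly-degree g (suc (suc (suc (suc i)))) _ = refl
  toPoly-degree g 0 ()
  toPoly-degree g 1 (s≤s ())
  toPoly-degree g 2 (s≤s (s≤s ()))
  toPoly-degree g 3 (s≤s (s≤s (s≤s ())))

  module _ (k₀ k₁ k₂ : Carrier) (p : Plücker Carrier) where

    row₀ row₁ row₂ : Carrier
    row₀ = p₀₁ p * k₀ + p₀₂ p * k₁ + p₀₃ p * k₂
    row₁ = p₀₂ p * k₀ + Δ p * k₁ + p₁₃ p * k₂
    row₂ = p₀₃ p * k₀ + p₁₃ p * k₁ + p₂₃ p * k₂

  -- The difference g (h/x^j) - h (g/x^j) is zero, so replacing each quotient by its polynomial part
  -- leaves terms of degree at most 2. Their coefficients are the Bézout matrix applied to (k₀, k₁,
  -- k₂).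
  truncate-product : ∀ k₀ k₁ k₂ g h →
    toPoly g *ᵖ truncate k₀ k₁ k₂ h +ᵖ toPoly h *ᵖ truncate k₀ k₁ k₂ g ≈ᵖ
    row₀ k₀ k₁ k₂ (wedge g h) ∷ row₁ k₀ k₁ k₂ (wedge g h) ∷ row₂ k₀ k₁ k₂ (wedge g h) ∷ []
  truncate-product k₀ k₁ k₂ (cubic a b c d) (cubic x y z w) = pointwise (solveₚ 11
    (λ k₀ k₁ k₂ → onCubic λ g → onCubic λ h → let p = E.wedge g h in
      E.toPoly g ⊗ E.truncate k₀ k₁ k₂ h ⊕ E.toPoly h ⊗ E.truncate k₀ k₁ k₂ g
      ⊜ (p₀₁ p :* k₀ :+ p₀₂ p :* k₁ :+ p₀₃ p :* k₂) ∷ (p₀₂ p :* k₀ :+ E.Δ p :* k₁ :+ p₁₃ p :* k₂)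
          ∷ (p₀₃ p :* k₀ :+ p₁₃ p :* k₁ :+ p₂₃ p :* k₂) ∷ [])
    k₀ k₁ k₂ a b c d x y z w)

  resultant⇒bézout : ∀ g h → ¬ (resultant (wedge g h) ≈ 0#) → Bézout (toPoly g) (toPoly h)
  resultant⇒bézout g h res≉0 =
    truncate k₀ k₁ k₂ h , truncate k₀ k₁ k₂ g , resultant p , res≉0 ,
    P.trans (P.+-cong (P.*-comm (truncate k₀ k₁ k₂ h) (toPoly g)) (P.*-comm (truncate k₀ k₁ k₂ g) (toPoly h)))
      (P.trans (truncate-product k₀ k₁ k₂ g h) (pointwise λ { 0 → r₀ ; 1 → r₁ ; 2 → r₂ ; (suc (suc (suc i))) → refl }))
    where
    p = wedge g h
    -- The first column of the adjugate of the Bézout matrix, which the matrix sends to (Res, 0, 0).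
    k₀ = Δ p * p₂₃ p + p₁₃ p ²
    k₁ = p₀₂ p * p₂₃ p + p₀₃ p * p₁₃ p
    k₂ = p₀₂ p * p₁₃ p + p₀₃ p * Δ p
    r₀ : row₀ k₀ k₁ k₂ p ≈ resultant p
    r₀ = solve 6 (λ A B C D E G → let Δ = C :+ D in
      A :* (Δ :* G :+ E E.²) :+ B :* (B :* G :+ C :* E) :+ C :* (B :* E :+ C :* Δ) ⊜ E.resultant (plücker A B C D E G))
      (p₀₁ p) (p₀₂ p) (p₀₃ p) (p₁₂ p) (p₁₃ p) (p₂₃ p)
    r₁ : row₁ k₀ k₁ k₂ p ≈ 0#
    r₁ = solve 5 (λ B C Δ E G → B :* (Δ :* G :+ E E.²) :+ Δ :* (B :* G :+ C :* E) :+ E :* (B :* E :+ C :* Δ) ⊜ 𝟎)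
      (p₀₂ p) (p₀₃ p) (Δ p) (p₁₃ p) (p₂₃ p)
    r₂ : row₂ k₀ k₁ k₂ p ≈ 0#
    r₂ = solve 5 (λ B C Δ E G → C :* (Δ :* G :+ E E.²) :+ E :* (B :* G :+ C :* E) :+ G :* (B :* E :+ C :* Δ) ⊜ 𝟎)
      (p₀₂ p) (p₀₃ p) (Δ p) (p₁₃ p) (p₂₃ p)

  Kernel : Plücker Carrier → Set
  Kernel p = ∃ λ k₀ → ∃ λ k₁ → ∃ λ k₂ → ¬ (k₀ ≈ 0# × k₁ ≈ 0# × k₂ ≈ 0#)
    × row₀ k₀ k₁ k₂ p ≈ 0# × row₁ k₀ k₁ k₂ p ≈ 0# × row₂ k₀ k₁ k₂ p ≈ 0#

  square-zero : ∀ {x} → x ² ≈ 0# → x ≈ 0#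
  square-zero {x} x²≈0 with x ≟0
  ... | yes x≈0 = x≈0
  ... | no  x≉0 = *-cancelˡ-0 x≉0 x²≈0

  -- A nonzero column of the adjugate if there is one; otherwise the matrix has rank at most one.
  kernel : ∀ p → resultant p ≈ 0# → Kernel p
  kernel p res≈0 = search
    where
    A = p₀₁ p
    B = p₀₂ p
    G = p₂₃ p
    H = p₁₃ p
    K = p₀₃ p
    D = Δ p
    via : ∀ {x} → x ≈ resultant p → x ≈ 0#
    via e = trans e res≈0
    search : Kernel p
    search with (D * G + H ²) ≟0 | (A * G + K ²) ≟0 | (A * D + B ²) ≟0
    ... | no k≉0 | _ | _ = D * G + H ² , B * G + K * H , B * H + K * D , (k≉0 ∘ proj₁) ,
      via (solve 6 (λ A B K D H G → A :* (D :* G :+ H E.²) :+ B :* (B :* G :+ K :* H) :+ K :* (B :* H :+ K :* D)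
        ⊜ A :* G :* D :+ A :* H E.² :+ B E.² :* G :+ D :* K E.²) A B K D H G) ,
      solve 5 (λ B K D H G → B :* (D :* G :+ H E.²) :+ D :* (B :* G :+ K :* H) :+ H :* (B :* H :+ K :* D) ⊜ 𝟎) B K D H G ,
      solve 5 (λ B K D H G → K :* (D :* G :+ H E.²) :+ H :* (B :* G :+ K :* H) :+ G :* (B :* H :+ K :* D) ⊜ 𝟎) B K D H G
    ... | yes _ | no k≉0 | _ = B * G + K * H , A * G + K ² , A * H + B * K , (k≉0 ∘ proj₁ ∘ proj₂) ,
      solve 5 (λ A B K H G → A :* (B :* G :+ K :* H) :+ B :* (A :* G :+ K E.²) :+ K :* (A :* H :+ B :* K) ⊜ 𝟎) A B K H G ,
      via (solve 6 (λ A B K D H G → B :* (B :* G :+ K :* H) :+ D :* (A :* G :+ K E.²) :+ H :* (A :* H :+ B :* K)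
        ⊜ A :* G :* D :+ A :* H E.² :+ B E.² :* G :+ D :* K E.²) A B K D H G) ,
      solve 5 (λ A B K H G → K :* (B :* G :+ K :* H) :+ H :* (A :* G :+ K E.²) :+ G :* (A :* H :+ B :* K) ⊜ 𝟎) A B K H G
    ... | yes _ | yes _ | no k≉0 = B * H + K * D , A * H + B * K , A * D + B ² , (k≉0 ∘ proj₂ ∘ proj₂) ,
      solve 5 (λ A B K D H → A :* (B :* H :+ K :* D) :+ B :* (A :* H :+ B :* K) :+ K :* (A :* D :+ B E.²) ⊜ 𝟎) A B K D H ,
      solve 5 (λ A B K D H → B :* (B :* H :+ K :* D) :+ D :* (A :* H :+ B :* K) :+ H :* (A :* D :+ B E.²) ⊜ 𝟎) A B K D H ,
      via (solve 6 (λ A B K D H G → K :* (B :* H :+ K :* D) :+ H :* (A :* H :+ B :* K) :+ G :* (A :* D :+ B E.²)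
        ⊜ A :* G :* D :+ A :* H E.² :+ B E.² :* G :+ D :* K E.²) A B K D H G)
    ... | yes m₀ | yes m₁ | yes m₂ = rank-one
      where
      -- The off-diagonal minors have zero square, by the vanishing of the diagonal ones.
      BG+KH : B * G + K * H ≈ 0#
      BG+KH = square-zero (trans
        (solve 6 (λ A B K D H G → (B :* G :+ K :* H) E.² ⊜
          (A :* D :+ B E.²) :* G E.² :+ (A :* G :+ K E.²) :* H E.² :+ A :* G :* (D :* G :+ H E.²)) A B K D H G)
        (trans (+-cong (+-cong (trans (*-congʳ m₂) (zeroˡ _)) (trans (*-congʳ m₁) (zeroˡ _))) (trans (*-congˡ m₀) (zeroʳ _)))
          (solve 0 (𝟎 :+ 𝟎 :+ 𝟎 ⊜ 𝟎))))
      rank-one : Kernel p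
      rank-one with G ≟0 | D ≟0
      ... | no G≉0 | _ = G , 0# , K , (G≉0 ∘ proj₁) ,
        trans (solve 4 (λ A B K G → A :* G :+ B :* 𝟎 :+ K :* K ⊜ A :* G :+ K E.²) A B K G) m₁ ,
        trans (solve 5 (λ B D K H G → B :* G :+ D :* 𝟎 :+ H :* K ⊜ B :* G :+ K :* H) B D K H G) BG+KH ,
        solve 3 (λ K H G → K :* G :+ H :* 𝟎 :+ G :* K ⊜ 𝟎) K H G
      ... | yes G≈0 | no D≉0 = D , B , 0# , (D≉0 ∘ proj₁) ,
        trans (solve 4 (λ A B D K → A :* D :+ B :* B :+ K :* 𝟎 ⊜ A :* D :+ B E.²) A B D K) m₂ ,
        solve 3 (λ B D H → B :* D :+ D :* B :+ H :* 𝟎 ⊜ 𝟎) B D H ,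
        trans (+-cong (+-cong (trans (*-congʳ K≈0) (zeroˡ D)) (trans (*-congʳ H≈0) (zeroˡ B))) (zeroʳ G))
          (solve 0 (𝟎 :+ 𝟎 :+ 𝟎 ⊜ 𝟎))
        where
        K≈0 : K ≈ 0#
        K≈0 = square-zero (trans (sym (+-identityˡ _)) (trans (+-congʳ (sym (trans (*-congˡ G≈0) (zeroʳ A)))) m₁))
        H≈0 : H ≈ 0#
        H≈0 = square-zero (trans (sym (+-identityˡ _)) (trans (+-congʳ (sym (trans (*-congˡ G≈0) (zeroʳ D)))) m₀))
      ... | yes G≈0 | yes D≈0 = 0# , 0# , 1# , (1≉0 ∘ proj₂ ∘ proj₂) ,
        last A B K≈0 , last B D H≈0 , last K H G≈0
        where
        K≈0 : K ≈ 0#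
        K≈0 = square-zero (trans (sym (+-identityˡ _)) (trans (+-congʳ (sym (trans (*-congˡ G≈0) (zeroʳ A)))) m₁))
        H≈0 : H ≈ 0#
        H≈0 = square-zero (trans (sym (+-identityˡ _)) (trans (+-congʳ (sym (trans (*-congˡ G≈0) (zeroʳ D)))) m₀))
        last : ∀ x y {z} → z ≈ 0# → x * 0# + y * 0# + z * 1# ≈ 0#
        last x y {z} z≈0 = trans (solve 3 (λ x y z → x :* 𝟎 :+ y :* 𝟎 :+ z :* 𝟏 ⊜ z) x y z) z≈0

  -- If u g + v h = r and g a = h b with deg a, deg b < 3 = deg g, then w = u b + v a satisfies g w = r b, so w = 0.
  no-syzygy : ∀ g h a b {d} → Bézout g h → HasDegree g d → ZeroFrom d b → g *ᵖ a ≈ᵖ h *ᵖ b → b ≈ᵖ []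
  no-syzygy g h a b {d} (u , v , r , r≉0 , bez) deg bz ga≈hb =
    pointwise λ i → *-cancelˡ-0 r≉0 (trans (sym (coeff-scale r b i))
      (trans (at (scale-as-* r b) i) (trans (sym (at gw≈rb i)) (at (P.trans (P.*-congˡ {g} w≈[]) (*-[] g)) i))))
    where
    w = u *ᵖ b +ᵖ v *ᵖ a
    gw≈rb : g *ᵖ w ≈ᵖ C r *ᵖ b
    gw≈rb = P.trans (S.solve 5 (λ g u v a b → g :* (u :* b :+ v :* a) ⊜ u :* g :* b :+ v :* (g :* a)) g u v a b)
      (P.trans (P.+-congˡ {u *ᵖ g *ᵖ b} (P.*-congˡ {v} ga≈hb))
      (P.trans (S.solve 5 (λ g h u v b → u :* g :* b :+ v :* (h :* b) ⊜ (u :* g :+ v :* h) :* b) g h u v b)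
      (P.*-congʳ {b} bez)))
    w≈[] : w ≈ᵖ []
    w≈[] = zeroFrom-0 (degree-factor g deg 0 w (λ i d≤i →
      trans (at gw≈rb i) (trans (sym (at (scale-as-* r b) i)) (trans (coeff-scale r b i)
      (trans (*-congˡ (bz i (ℕ.≤-trans (ℕ.≤-reflexive (≡.sym (ℕ.+-identityʳ d))) d≤i))) (zeroʳ r))))))

  -- The coefficients form a triangular system in k₀, k₁, k₂ with g₃ on the diagonal.
  truncate-injective : ∀ k₀ k₁ k₂ g → ¬ (c₃ g ≈ 0#) → truncate k₀ k₁ k₂ g ≈ᵖ [] → k₀ ≈ 0# × k₁ ≈ 0# × k₂ ≈ 0#
  truncate-injective k₀ k₁ k₂ (cubic g₀ g₁ g₂ g₃) g₃≉0 e = k₀≈0 , k₁≈0 , k₂≈0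
    where
    peel : ∀ {x y} k → x ≈ 0# → x + k * g₃ ≈ y → y ≈ 0# → k ≈ 0#
    peel {x} k x≈0 x+kg≈y y≈0 = *-cancelˡ-0 g₃≉0 (trans (*-comm g₃ k)
      (trans (sym (+-identityˡ _)) (trans (+-congʳ (sym x≈0)) (trans x+kg≈y y≈0))))
    annihilate : ∀ {k} x → k ≈ 0# → k * x ≈ 0#
    annihilate x k≈0 = trans (*-congʳ k≈0) (zeroˡ x)
    k₀≈0 : k₀ ≈ 0#
    k₀≈0 = peel k₀ refl (+-identityˡ _) (at e 2)
    k₁≈0 : k₁ ≈ 0#
    k₁≈0 = peel k₁ (annihilate g₂ k₀≈0) refl (at e 1)
    k₂≈0 : k₂ ≈ 0#
    k₂≈0 = peel k₂ (trans (+-cong (annihilate g₁ k₀≈0) (annihilate g₂ k₁≈0)) (+-identityˡ 0#)) refl (at e 0)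

  truncate-degree : ∀ k₀ k₁ k₂ g → ZeroFrom 3 (truncate k₀ k₁ k₂ g)
  truncate-degree k₀ k₁ k₂ g (suc (suc (suc i))) _ = refl
  truncate-degree k₀ k₁ k₂ g 0 ()
  truncate-degree k₀ k₁ k₂ g 1 (s≤s ())
  truncate-degree k₀ k₁ k₂ g 2 (s≤s (s≤s ()))

  bézout-comm : ∀ {g h} → Bézout g h → Bézout h g
  bézout-comm {g} {h} (u , v , r , r≉0 , e) = v , u , r , r≉0 , P.trans (P.+-comm (v *ᵖ h) (u *ᵖ g)) e

  -- A kernel vector of the Bézout matrix would give g a = h b with a and b of degree at most 2,
  -- which coprimality forbids. The condition on leading coefficients rules out a common zero at
  -- infinity, which would also make the resultant vanish.
  bézout⇒resultant : ∀ g h → Bézout (toPoly g) (toPoly h) → ¬ (c₃ g ≈ 0#) ⊎ ¬ (c₃ h ≈ 0#) →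
                     ¬ (resultant (wedge g h) ≈ 0#)
  bézout⇒resultant g h bez lead res≈0 with kernel (wedge g h) res≈0
  ... | k₀ , k₁ , k₂ , nz , r₀ , r₁ , r₂ = nz (all-zero lead)
    where
    syzygy : toPoly g *ᵖ truncate k₀ k₁ k₂ h ≈ᵖ toPoly h *ᵖ truncate k₀ k₁ k₂ g
    syzygy = S.x+y≈0⇒x≈y (P.trans (truncate-product k₀ k₁ k₂ g h)
      (pointwise λ { 0 → r₀ ; 1 → r₁ ; 2 → r₂ ; (suc (suc (suc i))) → refl }))
    all-zero : ¬ (c₃ g ≈ 0#) ⊎ ¬ (c₃ h ≈ 0#) → k₀ ≈ 0# × k₁ ≈ 0# × k₂ ≈ 0#
    all-zero (inj₁ g₃≉0) = truncate-injective k₀ k₁ k₂ g g₃≉0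
      (no-syzygy (toPoly g) (toPoly h) (truncate k₀ k₁ k₂ h) (truncate k₀ k₁ k₂ g) bez (g₃≉0 , toPoly-degree g) (truncate-degree k₀ k₁ k₂ g) syzygy)
    all-zero (inj₂ h₃≉0) = truncate-injective k₀ k₁ k₂ h h₃≉0
      (no-syzygy (toPoly h) (toPoly g) (truncate k₀ k₁ k₂ g) (truncate k₀ k₁ k₂ h) (bézout-comm bez) (h₃≉0 , toPoly-degree h) (truncate-degree k₀ k₁ k₂ h) (P.sym syzygy))

  -- Uniqueness of lowest terms: k = u s′ + v t′ satisfies s k = r s′ and t k = r t′, and the degree
  -- bound on s′ makes k a constant. The common factor is k / r.
  proportional : ∀ {s t s′ t′ d} → Bézout s t → HasDegree s d → ZeroFrom (suc d) s′ → s *ᵖ t′ ≈ᵖ s′ *ᵖ t →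
                 ∃ λ κ → s′ ≈ᵖ C κ *ᵖ s × t′ ≈ᵖ C κ *ᵖ t
  proportional {s} {t} {s′} {t′} {d} (u , v , r , r≉0 , bez) deg s′z cross with inverse r r≉0
  ... | ε , rε≈1 = κ₀ * ε , conclude s s′ sk≈rs′ , conclude t t′ tk≈rt′
    where
    k = u *ᵖ s′ +ᵖ v *ᵖ t′
    sk≈rs′ : s *ᵖ k ≈ᵖ C r *ᵖ s′
    sk≈rs′ = P.trans (S.solve 5 (λ s s′ t′ u v → s :* (u :* s′ :+ v :* t′) ⊜ u :* s :* s′ :+ v :* (s :* t′)) s s′ t′ u v)
      (P.trans (P.+-congˡ {u *ᵖ s *ᵖ s′} (P.*-congˡ {v} cross))
      (P.trans (S.solve 5 (λ s t s′ u v → u :* s :* s′ :+ v :* (s′ :* t) ⊜ (u :* s :+ v :* t) :* s′) s t s′ u v)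
      (P.*-congʳ {s′} bez)))
    tk≈rt′ : t *ᵖ k ≈ᵖ C r *ᵖ t′
    tk≈rt′ = P.trans (S.solve 5 (λ t s′ t′ u v → t :* (u :* s′ :+ v :* t′) ⊜ u :* (s′ :* t) :+ v :* t :* t′) t s′ t′ u v)
      (P.trans (P.+-congʳ {v *ᵖ t *ᵖ t′} (P.*-congˡ {u} (P.sym cross)))
      (P.trans (S.solve 5 (λ s t t′ u v → u :* (s :* t′) :+ v :* t :* t′ ⊜ (u :* s :+ v :* t) :* t′) s t t′ u v)
      (P.*-congʳ {t′} bez)))
    κ₀ = coeff F k 0
    k≈C : k ≈ᵖ C κ₀
    k≈C = zeroFrom-1 (degree-factor s deg 1 k (λ i d+1≤i →
      trans (at sk≈rs′ i) (trans (sym (at (scale-as-* r s′) i)) (trans (coeff-scale r s′ i)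
      (trans (*-congˡ (s′z i (ℕ.≤-trans (ℕ.≤-reflexive (ℕ.+-comm 1 d)) d+1≤i))) (zeroʳ r))))))
    conclude : ∀ x y → x *ᵖ k ≈ᵖ C r *ᵖ y → y ≈ᵖ C (κ₀ * ε) *ᵖ x
    conclude x y e = pointwise λ i → trans (begin
      coeff F y i                        ≈⟨ *-identityˡ _ ⟨
      1# * coeff F y i                   ≈⟨ *-congʳ (trans (sym rε≈1) (*-comm r ε)) ⟩
      ε * r * coeff F y i                ≈⟨ *-assoc ε r _ ⟩
      ε * (r * coeff F y i)              ≈⟨ *-congˡ (coeff-scale r y i) ⟨
      ε * coeff F (scale F r y) i        ≈⟨ *-congˡ (at (scale-as-* r y) i) ⟩
      ε * coeff F (C r *ᵖ y) i           ≈⟨ *-congˡ (at (P.trans (P.sym e) (P.trans (P.*-congˡ {x} k≈C) (P.*-comm x (C κ₀)))) i) ⟩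
      ε * coeff F (C κ₀ *ᵖ x) i          ≈⟨ *-congˡ (at (scale-as-* κ₀ x) i) ⟨
      ε * coeff F (scale F κ₀ x) i       ≈⟨ *-congˡ (coeff-scale κ₀ x i) ⟩
      ε * (κ₀ * coeff F x i)             ≈⟨ *-assoc ε κ₀ _ ⟨
      ε * κ₀ * coeff F x i               ≈⟨ *-congʳ (*-comm ε κ₀) ⟩
      κ₀ * ε * coeff F x i               ≈⟨ coeff-scale (κ₀ * ε) x i ⟨
      coeff F (scale F (κ₀ * ε) x) i     ∎) (at (scale-as-* (κ₀ * ε) x) i)
      where open SetoidReasoning setoid

-- Finite fields: exponents and Fermat's theorem

odd-or-even : ∀ n → (∃ λ k → n ≡ k ℕ.+ k) ⊎ (∃ λ k → n ≡ suc (k ℕ.+ k))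
odd-or-even zero = inj₁ (0 , ≡.refl)
odd-or-even (suc n) with odd-or-even n
... | inj₁ (k , ≡.refl) = inj₂ (k , ≡.refl)
... | inj₂ (k , ≡.refl) = inj₁ (suc k , ≡.cong suc (≡.sym (ℕ.+-suc k k)))

-- Since 4 is 1 modulo 3, an odd power of two is 2 modulo 3, which is what makes every element of
-- the corresponding field a cube.
four-power : ∀ k → ∃ λ j → 2 ℕ.^ (k ℕ.+ k) ≡ 1 ℕ.+ 3 ℕ.* j
four-power zero = 0 , ≡.refl
four-power (suc k) with four-power k
... | j , eq = 1 ℕ.+ 4 ℕ.* j , (begin
  2 ℕ.^ (suc k ℕ.+ suc k)         ≡⟨ ≡.cong (λ m → 2 ℕ.* 2 ℕ.^ m) (ℕ.+-suc k k) ⟩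
  2 ℕ.* (2 ℕ.* 2 ℕ.^ (k ℕ.+ k))   ≡⟨ ≡.cong (λ m → 2 ℕ.* (2 ℕ.* m)) eq ⟩
  2 ℕ.* (2 ℕ.* (1 ℕ.+ 3 ℕ.* j))   ≡⟨ arithmetic j ⟩
  1 ℕ.+ 3 ℕ.* (1 ℕ.+ 4 ℕ.* j)     ∎)
  where
  open ≡.≡-Reasoning
  arithmetic : ∀ j → 2 ℕ.* (2 ℕ.* (1 ℕ.+ 3 ℕ.* j)) ≡ 1 ℕ.+ 3 ℕ.* (1 ℕ.+ 4 ℕ.* j)
  arithmetic = solve-∀

record Units (F : CommutativeRing 0ℓ 0ℓ) (m : ℕ) : Set where
  open CommutativeRing F
  field
    unit           : Fin m → Carrier
    unit-injective : ∀ {i j} → unit i ≈ unit j → i ≡ j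
    unit≉0         : ∀ i → ¬ (unit i ≈ 0#)
    unitIndex      : ∀ x → ¬ (x ≈ 0#) → Fin m
    unit-unitIndex : ∀ x x≉0 → unit (unitIndex x x≉0) ≈ x

module FiniteField (F : CommutativeRing 0ℓ 0ℓ) (isField : IsField F) (q : ℕ) (size : HasSize F q) where

  open CommutativeRing F hiding (zero)
  open FieldProperties F isField
  open CommutativeMonoidSum *-commutativeMonoid using ()
    renaming (sum to product; sum-permute to product-permute; sum-cong-≋ to product-cong; ∑-distrib-+ to product-distrib)

  element : Fin q → Carrier
  element = proj₁ size

  element-injective : ∀ {i j} → element i ≈ element j → i ≡ j
  element-injective = proj₁ (proj₂ size) _ _

  index : Carrier → Fin q
  index x = proj₁ (proj₂ (proj₂ size) x)

  element-index : ∀ x → element (index x) ≈ x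
  element-index x = proj₂ (proj₂ (proj₂ size) x)

  _≟_ : ∀ x y → Dec (x ≈ y)
  x ≟ y = map′
    (λ e → trans (sym (element-index x)) (trans (reflexive (≡.cong element e)) (element-index y)))
    (λ e → element-injective (trans (element-index x) (trans e (sym (element-index y)))))
    (index x Fin.≟ index y)

  punctured : ∀ m → q ≡ suc m → Units F m
  punctured m ≡.refl = record
    { unit           = element ∘ Fin.punchIn (index 0#)
    ; unit-injective = Fin.punchIn-injective (index 0#) _ _ ∘ element-injective
    ; unit≉0         = λ i e → Fin.punchInᵢ≢i (index 0#) i (element-injective (trans e (sym (element-index 0#))))
    ; unitIndex      = λ x x≉0 → Fin.punchOut (apart x x≉0)
    ; unit-unitIndex = λ x x≉0 →
        trans (reflexive (≡.cong element (Fin.punchIn-punchOut (apart x x≉0)))) (element-index x)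
    }
    where
    apart : ∀ x → ¬ (x ≈ 0#) → index 0# ≢ index x
    apart x x≉0 e = x≉0 (trans (sym (element-index x)) (trans (reflexive (≡.cong element (≡.sym e))) (element-index 0#)))

  units : ∃ λ m → q ≡ suc m × Units F m
  units = go q ≡.refl
    where
    go : ∀ r → q ≡ r → ∃ λ m → q ≡ suc m × Units F m
    go zero    e = contradiction (≡.subst Fin e (index 0#)) Fin.¬Fin0
    go (suc m) e = m , e , punctured m e

  open Units (proj₂ (proj₂ units)) public

  pow-cong : ∀ {x y} k → x ≈ y → pow F x k ≈ pow F y k
  pow-cong zero    e = refl
  pow-cong (suc k) e = *-cong e (pow-cong k e)

  pow-+ : ∀ x a b → pow F x (a ℕ.+ b) ≈ pow F x a * pow F x b
  pow-+ x zero    b = sym (*-identityˡ _)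
  pow-+ x (suc a) b = trans (*-congˡ (pow-+ x a b)) (sym (*-assoc _ _ _))

  product-nonzero : ∀ {n} (f : Fin n → Carrier) → (∀ i → ¬ (f i ≈ 0#)) → ¬ (product f ≈ 0#)
  product-nonzero {zero}  f f≉0 = 1≉0
  product-nonzero {suc n} f f≉0 = *-nonzero (f≉0 zero) (product-nonzero (f ∘ suc) (f≉0 ∘ suc))

  product-constant : ∀ x n → product (replicate n x) ≈ pow F x n
  product-constant x zero    = refl
  product-constant x (suc n) = *-congˡ (product-constant x n)

  -- Multiplication by a unit x permutes the units, so their product P satisfies x^(q-1) P = P.
  lagrange : ∀ x → ¬ (x ≈ 0#) → pow F x (proj₁ units) ≈ 1#
  lagrange x x≉0 = cancel (begin
    pow F x m * P                                ≈⟨ *-congʳ (product-constant x m) ⟨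
    product (replicate m x) * P                  ≈⟨ product-distrib (replicate m x) unit ⟨
    product (λ i → x * unit i)                   ≈⟨ product-cong (λ i → sym (unit-unitIndex _ (*-nonzero x≉0 (unit≉0 i)))) ⟩
    product (unit ∘ multiply x x≉0)              ≈⟨ product-permute unit rotation ⟨
    P                                            ∎)
    where
    open SetoidReasoning setoid
    m = proj₁ units
    P = product unit
    y = proj₁ (inverse x x≉0)
    xy≈1 : x * y ≈ 1#
    xy≈1 = proj₂ (inverse x x≉0)
    multiply : ∀ z → ¬ (z ≈ 0#) → Fin m → Fin m
    multiply z z≉0 i = unitIndex (z * unit i) (*-nonzero z≉0 (unit≉0 i))
    inverts : ∀ z w z≉0 w≉0 → z * w ≈ 1# → ∀ i → multiply z z≉0 (multiply w w≉0 i) ≡ i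
    inverts z w z≉0 w≉0 zw≈1 i = unit-injective (begin
      unit (multiply z z≉0 (multiply w w≉0 i))  ≈⟨ unit-unitIndex _ _ ⟩
      z * unit (multiply w w≉0 i)               ≈⟨ *-congˡ (unit-unitIndex _ _) ⟩
      z * (w * unit i)                          ≈⟨ *-assoc z w _ ⟨
      z * w * unit i                            ≈⟨ *-congʳ zw≈1 ⟩
      1# * unit i                               ≈⟨ *-identityˡ _ ⟩
      unit i                                    ∎)
    y≉0 : ¬ (y ≈ 0#)
    y≉0 = inverse-nonzero xy≈1
    rotation : Permutation m m
    rotation = permutation (multiply x x≉0) (multiply y y≉0)
      (inverts x y x≉0 y≉0 xy≈1) (inverts y x y≉0 x≉0 (trans (*-comm y x) xy≈1))
    cancel : ∀ {z} → z * P ≈ P → z ≈ 1#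
    cancel {z} zP≈P with inverse P (product-nonzero unit unit≉0)
    ... | p , Pp≈1 = begin
      z            ≈⟨ *-identityʳ z ⟨
      z * 1#       ≈⟨ *-congˡ Pp≈1 ⟨
      z * (P * p)  ≈⟨ *-assoc z P p ⟨
      z * P * p    ≈⟨ *-congʳ zP≈P ⟩
      P * p        ≈⟨ Pp≈1 ⟩
      1#           ∎

  fermat : ∀ x → pow F x q ≈ x
  fermat x with x ≟ 0#
  ... | no x≉0 = trans (reflexive (≡.cong (pow F x) (proj₁ (proj₂ units)))) (trans (*-congˡ (lagrange x x≉0)) (*-identityʳ x))
  ... | yes x≈0 = trans (reflexive (≡.cong (pow F x) (proj₁ (proj₂ units))))
    (trans (*-congʳ x≈0) (trans (zeroˡ _) (sym x≈0)))

-- Counting the cosets of the cubes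

module CubeCosets (F : CommutativeRing 0ℓ 0ℓ) (isField : IsField F)
  (1+1≈0 : HasChar2 F)
  (_≟_ : ∀ x y → Dec (CommutativeRing._≈_ F x y)) (U : ℕ) (units : Units F U) where

  open CommutativeRing F hiding (zero)
  open FieldProperties F isField
  open Units units
  open Char2 F 1+1≈0
  open Forms F
  open Pencils F isField 1+1≈0 using (module E; ²-cong; ³-cong)

  -- The units with a given cube: the first one, the second one, and at most one other.

  first second : Fin U → Fin U
  first j with Fin.any? (λ i → (unit i ³) ≟ unit j)
  ... | yes (i , _) = i
  -- An arbitrary value, taken only when `unit j` is not a cube.
  ... | no _        = j
  second j with Fin.any? (λ i → ((unit i ³) ≟ unit j) ×-dec ¬? (i Fin.≟ first j))
  ... | yes (i , _) = i
  ... | no _        = j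

  first-cube : ∀ j k → unit k ³ ≈ unit j → unit (first j) ³ ≈ unit j
  first-cube j k e with Fin.any? (λ i → (unit i ³) ≟ unit j)
  ... | yes (i , e′) = e′
  ... | no none      = contradiction (k , e) none

  second-cube : ∀ j k → unit k ³ ≈ unit j → k ≢ first j → unit (second j) ³ ≈ unit j × second j ≢ first j
  second-cube j k e k≢ with Fin.any? (λ i → ((unit i ³) ≟ unit j) ×-dec ¬? (i Fin.≟ first j))
  ... | yes (i , e′) = e′
  ... | no none      = contradiction (k , e , k≢) none

  rank : Fin U → Fin U → Fin 3
  rank j k with k Fin.≟ first j | k Fin.≟ second j
  ... | yes _ | _     = 0F
  ... | no _  | yes _ = 1F
  ... | no _  | no _  = 2F

  -- The polynomial X³ + c has no term in X², so three distinct roots sum to zero and two of them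
  -- determine the third.
  third-root : ∀ {x y z c} → x ³ ≈ c → y ³ ≈ c → z ³ ≈ c → ¬ (x ≈ y) → ¬ (x ≈ z) → ¬ (y ≈ z) → z ≈ x + y
  third-root {x} {y} {z} {c} x³ y³ z³ x≉y x≉z y≉z = sym (x+y≈0⇒x≈y
    (*-cancelˡ-0 (y≉z ∘ x+y≈0⇒x≈y) (trans
      (solve 3 (λ x y z → (y :+ z) :* (x :+ y :+ z) ⊜ (x E.² :+ x :* y :+ y E.²) :+ (x E.² :+ x :* z :+ z E.²)) x y z)
      (trans (+-cong (cofactor x³ y³ x≉y) (cofactor x³ z³ x≉z)) (+-identityˡ 0#)))))
    where
    cofactor : ∀ {x y} → x ³ ≈ c → y ³ ≈ c → ¬ (x ≈ y) → x ² + x * y + y ² ≈ 0#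
    cofactor {x} {y} x³ y³ x≉y = *-cancelˡ-0 (x≉y ∘ x+y≈0⇒x≈y) (trans
      (solve 2 (λ x y → (x :+ y) :* (x E.² :+ x :* y :+ y E.²) ⊜ x E.³ :+ y E.³) x y)
      (trans (+-cong x³ y³) (x+x≈0 c)))

  rank-injective : ∀ j k l → unit k ³ ≈ unit j → unit l ³ ≈ unit j → rank j k ≡ rank j l → k ≡ l
  rank-injective j k l ek el eq with k Fin.≟ first j | k Fin.≟ second j | l Fin.≟ first j | l Fin.≟ second j | eq
  ... | yes a | _     | yes b | _     | _ = ≡.trans a (≡.sym b)
  ... | no _  | yes a | no _  | yes b | _ = ≡.trans a (≡.sym b)
  ... | no a  | no b  | no c  | no d  | _ = unit-injective (trans (third a b ek) (sym (third c d el)))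
    where
    third : ∀ {i} → i ≢ first j → i ≢ second j → unit i ³ ≈ unit j → unit i ≈ unit (first j) + unit (second j)
    third {i} i≢₁ i≢₂ ei = third-root (first-cube j i ei) (proj₁ snd) ei
      (λ e → proj₂ snd (≡.sym (unit-injective e))) (λ e → i≢₁ (≡.sym (unit-injective e))) (λ e → i≢₂ (≡.sym (unit-injective e)))
      where snd = second-cube j i ei i≢₁
  ... | yes _ | _     | no _  | yes _ | ()
  ... | yes _ | _     | no _  | no _  | ()
  ... | no _  | yes _ | yes _ | _     | ()
  ... | no _  | yes _ | no _  | no _  | ()
  ... | no _  | no _  | yes _ | _     | ()
  ... | no _  | no _  | no _  | yes _ | ()

  coset-ratio : ∀ {c d x y} → ¬ (x ≈ 0#) → c * x ³ ≈ d * y ³ → ∃ λ w → c ≈ d * w ³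
  coset-ratio {c} {d} {x} {y} x≉0 e with inverse x x≉0
  ... | z , xz≈1 = y * z , (begin
    c                    ≈⟨ *-identityʳ c ⟨
    c * 1#               ≈⟨ *-congˡ (trans (³-cong xz≈1) (solve 0 (𝟏 E.³ ⊜ 𝟏))) ⟨
    c * (x * z) ³        ≈⟨ solve 3 (λ c x z → c :* (x :* z) E.³ ⊜ c :* x E.³ :* z E.³) c x z ⟩
    c * x ³ * z ³        ≈⟨ *-congʳ e ⟩
    d * y ³ * z ³        ≈⟨ solve 3 (λ d y z → d :* y E.³ :* z E.³ ⊜ d :* (y :* z) E.³) d y z ⟩
    d * (y * z) ³        ∎)
    where open SetoidReasoning setoid

  -- Four cosets of the cubes would inject four copies of the units into three.
  no-four-cosets : (c : Fin 4 → Carrier) → (∀ i → ¬ (c i ≈ 0#)) →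
                   ¬ (∀ i j → i Fin.< j → ∀ w → ¬ (c j ≈ c i * w ³))
  no-four-cosets c c≉0 distinct = collide (Fin.pigeonhole fewer encode)
    where
    fewer : 3 ℕ.* U ℕ.< 4 ℕ.* U
    fewer = ℕ.*-monoˡ-< U {{Fin.nonZeroIndex (unitIndex 1# 1≉0)}} {3} {4} (ℕ.n<1+n 3)
    cube≉0 : ∀ k → ¬ (unit k ³ ≈ 0#)
    cube≉0 k = *-nonzero (*-nonzero (unit≉0 k) (unit≉0 k)) (unit≉0 k)
    cubeIndex : Fin U → Fin U
    cubeIndex k = unitIndex (unit k ³) (cube≉0 k)
    cosetIndex : Fin 4 → Fin U → Fin U
    cosetIndex i k = unitIndex (c i * unit k ³) (*-nonzero (c≉0 i) (cube≉0 k))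
    -- Disjointness of the cosets lets c i · u³ determine i, where u is the unit numbered k, and
    -- hence also u³; the rank then tells the at most three cube roots apart.
    code : Fin 4 × Fin U → Fin (3 ℕ.* U)
    code (i , k) = Fin.combine (rank (cubeIndex k) k) (cosetIndex i k)
    encode : Fin (4 ℕ.* U) → Fin (3 ℕ.* U)
    encode p = code (Fin.remQuot {4} U p)
    same-coset : ∀ i j k l → c i * unit k ³ ≈ c j * unit l ³ → i ≡ j
    same-coset i j k l e with Fin.<-cmp i j
    ... | tri≈ _ i≡j _ = i≡j
    ... | tri< i<j _ _ = contradiction (proj₂ (coset-ratio (unit≉0 l) (sym e))) (distinct i j i<j _)
    ... | tri> _ _ j<i = contradiction (proj₂ (coset-ratio (unit≉0 k) e)) (distinct j i j<i _)
    code-injective : ∀ x y → code x ≡ code y → x ≡ y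
    code-injective (i , k) (j , l) eq = ≡.cong₂ _,_ i≡j k≡l
      where
      ranks : rank (cubeIndex k) k ≡ rank (cubeIndex l) l
      ranks = Fin.combine-injectiveˡ (rank (cubeIndex k) k) (cosetIndex i k) (rank (cubeIndex l) l) (cosetIndex j l) eq
      cosets : cosetIndex i k ≡ cosetIndex j l
      cosets = Fin.combine-injectiveʳ (rank (cubeIndex k) k) (cosetIndex i k) (rank (cubeIndex l) l) (cosetIndex j l) eq
      e : c i * unit k ³ ≈ c j * unit l ³
      e = trans (sym (unit-unitIndex _ _)) (trans (reflexive (≡.cong unit cosets)) (unit-unitIndex _ _))
      i≡j : i ≡ j
      i≡j = same-coset i j k l e
      cubes≈ : unit k ³ ≈ unit l ³
      cubes≈ = x+y≈0⇒x≈y (*-cancelˡ-0 (c≉0 i) (trans (distribˡ _ _ _)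
        (trans (+-congʳ (trans e (*-congʳ (reflexive (≡.cong c (≡.sym i≡j)))))) (x+x≈0 _))))
      indices : cubeIndex l ≡ cubeIndex k
      indices = unit-injective (trans (unit-unitIndex _ _) (trans (sym cubes≈) (sym (unit-unitIndex _ _))))
      k≡l : k ≡ l
      k≡l = rank-injective (cubeIndex k) k l (sym (unit-unitIndex _ _))
        (trans (sym cubes≈) (sym (unit-unitIndex _ _)))
        (≡.trans ranks (≡.cong (λ j → rank j l) indices))
    collide : ¬ (∃ λ p → ∃ λ r → p Fin.< r × encode p ≡ encode r)
    collide (p , r , p<r , eq) = Fin.<⇒≢ p<r (≡.trans (≡.sym (Fin.combine-remQuot {4} U p))
      (≡.trans (≡.cong (uncurry Fin.combine) (code-injective (Fin.remQuot {4} U p) (Fin.remQuot {4} U r) eq)) (Fin.combine-remQuot {4} U r)))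

module CubeClasses (n : ℕ) (F : CommutativeRing 0ℓ 0ℓ) where

  open CommutativeRing F
  open Forms F using (_³)

  data CubeClass (θ b : Carrier) : Set where
    cube      : ∀ {y} → b ≈ 1# * y ³ → CubeClass θ b
    θ-coset   : ∀ {y} → IsSquareℕ (2 ℕ.^ n) → b ≈ θ * y ³ → CubeClass θ b
    θ²-coset  : ∀ {y} → IsSquareℕ (2 ℕ.^ n) → b ≈ θ * θ * y ³ → CubeClass θ b

-- Frobenius, trace and cube classes in a field of order 2^n

module EvenField (n : ℕ) (F : CommutativeRing 0ℓ 0ℓ) (isField : IsField F) (size : HasSize F (2 ℕ.^ n))
  (1+1≈0 : HasChar2 F) where

  open CommutativeRing F hiding (zero)
  open FieldProperties F isField
  open FiniteField F isField (2 ℕ.^ n) size public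
  open Char2 F 1+1≈0
  open Forms F
  open Pencils F isField 1+1≈0 using (module E; ²-cong; ³-cong)

  open CubeCosets F isField 1+1≈0 _≟_ (proj₁ units) (proj₂ (proj₂ units))
  open CubeClasses n F public

  _≟0 : ∀ x → Dec (x ≈ 0#)
  x ≟0 = x ≟ 0#

  frobenius : ℕ → Carrier → Carrier
  frobenius k x = pow F x (2 ℕ.^ k)

  frobenius-suc : ∀ k x → frobenius (suc k) x ≈ frobenius k x ²
  frobenius-suc k x = trans (pow-+ x (2 ℕ.^ k) _) (*-congˡ (reflexive (≡.cong (pow F x) (ℕ.+-identityʳ (2 ℕ.^ k)))))

  frobenius-+ : ∀ k x y → frobenius k (x + y) ≈ frobenius k x + frobenius k y
  frobenius-+ zero    x y = distribʳ 1# x y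
  frobenius-+ (suc k) x y = trans (frobenius-suc k (x + y)) (trans (²-cong (frobenius-+ k x y))
    (trans (solve 2 (λ x y → (x :+ y) E.² ⊜ x E.² :+ y E.²) (frobenius k x) (frobenius k y))
      (sym (+-cong (frobenius-suc k x) (frobenius-suc k y)))))

  -- The square of x^(2^(n-1)) is x^(2^n), which is x by Fermat.
  square-root : ∀ x → ∃ λ y → y ² ≈ x
  square-root x = go n ≡.refl
    where
    go : ∀ k → n ≡ k → ∃ λ y → y ² ≈ x
    go (suc k) ≡.refl = frobenius k x , trans (sym (frobenius-suc k x)) (fermat x)
    -- The case n = 0 would identify 1 with 0 in a field of one element.
    go zero    ≡.refl = contradiction (trans (sym (element-index 1#)) (trans (reflexive (≡.cong element (all-equal _ _))) (element-index 0#))) 1≉0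
      where
      all-equal : ∀ (i j : Fin 1) → i ≡ j
      all-equal 0F 0F = ≡.refl

  trace-cong : ∀ k {x y} → x ≈ y → trace F k x ≈ trace F k y
  trace-cong zero    e = refl
  trace-cong (suc k) e = +-cong (trace-cong k e) (pow-cong (2 ℕ.^ k) e)

  trace-+ : ∀ k x y → trace F k (x + y) ≈ trace F k x + trace F k y
  trace-+ zero    x y = sym (+-identityˡ 0#)
  trace-+ (suc k) x y = trans (+-cong (trace-+ k x y) (frobenius-+ k x y))
    (solve 4 (λ a b c d → a :+ b :+ (c :+ d) ⊜ a :+ c :+ (b :+ d)) _ _ _ _)

  -- Squaring carries each term of the sum to the next one, so the sum telescopes.
  trace-square : ∀ k x → trace F k x ² + trace F k x ≈ frobenius k x + x
  trace-square zero    x = solve 1 (λ x → 𝟎 E.² :+ 𝟎 ⊜ x :* 𝟏 :+ x) x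
  trace-square (suc k) x = trans
    (solve 2 (λ t f → (t :+ f) E.² :+ (t :+ f) ⊜ (t E.² :+ t) :+ (f E.² :+ f)) (trace F k x) (frobenius k x))
    (trans (+-cong (trace-square k x) (+-congʳ (sym (frobenius-suc k x))))
      (solve 3 (λ f g x → f :+ x :+ (g :+ f) ⊜ g :+ x) (frobenius k x) (frobenius (suc k) x) x))

  trace-squares : ∀ k x → trace F k (x ²) ≈ trace F k x ²
  trace-squares zero    x = solve 0 (𝟎 ⊜ 𝟎 E.²)
  trace-squares (suc k) x = trans (+-cong (trace-squares k x) (frobenius-square k))
    (solve 2 (λ t f → t E.² :+ f E.² ⊜ (t :+ f) E.²) (trace F k x) (frobenius k x))
    where
    frobenius-square : ∀ k → frobenius k (x ²) ≈ frobenius k x ²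
    frobenius-square zero    = solve 1 (λ x → x E.² :* 𝟏 ⊜ (x :* 𝟏) E.²) x
    frobenius-square (suc k) = trans (frobenius-suc k (x ²)) (trans (²-cong (frobenius-square k)) (²-cong (sym (frobenius-suc k x))))

  -- At k = n the telescoped sum is x^q + x = 0, whence t (t + 1) = 0 for the trace t.
  trace-bit : ∀ x → trace F n x ≈ 0# ⊎ trace F n x ≈ 1#
  trace-bit x with trace F n x ≟0
  ... | yes t≈0 = inj₁ t≈0
  ... | no  t≉0 = inj₂ (x+y≈0⇒x≈y (*-cancelˡ-0 t≉0 (trans
    (solve 1 (λ t → t :* (t :+ 𝟏) ⊜ t E.² :+ t) (trace F n x))
    (trans (trace-square n x) (trans (+-congʳ (fermat x)) (x+x≈0 x))))))

  trace-℘ : ∀ y → trace F n (y ² + y) ≈ 0#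
  trace-℘ y = trans (trace-+ n (y ²) y) (trans (+-congʳ (trace-squares n y))
    (trans (trace-square n y) (trans (+-congʳ (fermat y)) (x+x≈0 y))))

  -- Additive Hilbert 90: with T_k the k-th partial trace of τ, the sum of T_k σ^(2^k) solves y² + y = τ.
  hilbert90 : Carrier → Carrier → ℕ → Carrier
  hilbert90 σ τ zero    = 0#
  hilbert90 σ τ (suc k) = hilbert90 σ τ k + trace F k τ * frobenius k σ

  -- The loop invariant of the construction. At k = n its second term vanishes with the trace of τ,
  -- and its third is τ because σ has trace 1.
  hilbert90-square : ∀ σ τ k →
    hilbert90 σ τ k ² ≈ hilbert90 σ τ k + trace F k τ * frobenius k σ + τ * trace F k σ ²
  hilbert90-square σ τ zero = solve 2 (λ s t → 𝟎 E.² ⊜ 𝟎 :+ 𝟎 :* (s :* 𝟏) :+ t :* 𝟎 E.²) σ τ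
  hilbert90-square σ τ (suc k) = trans
    (solve 3 (λ y t s → (y :+ t :* s) E.² ⊜ y E.² :+ (t E.² :+ t) :* s E.² :+ t :* s E.²) (hilbert90 σ τ k) (trace F k τ) (frobenius k σ))
    (trans (+-congʳ (+-cong (hilbert90-square σ τ k) (*-congʳ (trace-square k τ))))
    (trans (solve 6 (λ y t s f τ u → y :+ t :* s :+ τ :* u E.² :+ (f :+ τ) :* s E.² :+ t :* s E.²
             ⊜ y :+ t :* s :+ (t :+ f) :* s E.² :+ τ :* (u :+ s) E.²)
             (hilbert90 σ τ k) (trace F k τ) (frobenius k σ) (frobenius k τ) τ (trace F k σ))
      (+-congʳ (+-congˡ (*-congˡ (sym (frobenius-suc k σ)))))))

  artin-schreier : ∀ σ τ → trace F n σ ≈ 1# → trace F n τ ≈ 0# → ∃ λ y → y ² + y ≈ τ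
  artin-schreier σ τ σ₁ τ₀ = y , (begin
    y ² + y                                                                ≈⟨ +-congʳ (hilbert90-square σ τ n) ⟩
    y + trace F n τ * frobenius n σ + τ * trace F n σ ² + y                ≈⟨ +-congʳ (+-cong (+-congˡ (*-congʳ τ₀)) (*-congˡ (²-cong σ₁))) ⟩
    y + 0# * frobenius n σ + τ * 1# ² + y                                  ≈⟨ solve 3 (λ y s t → y :+ 𝟎 :* s :+ t :* 𝟏 E.² :+ y ⊜ t) y (frobenius n σ) τ ⟩
    τ                                                                      ∎)
    where
    open SetoidReasoning setoid
    y = hilbert90 σ τ n

  -- Here q = 2 + 6 j, and the exponent 1 + 4 j is (2 q - 1)/3. Cubing gives x^(2 q - 1), which two
  -- applications of Fermat reduce to x.
  cubes-of-odd : ∀ k → n ≡ suc (k ℕ.+ k) → ∀ x → ∃ λ y → y ³ ≈ x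
  cubes-of-odd k ≡.refl x with four-power k
  ... | j , eq = pow F x (1 ℕ.+ 4 ℕ.* j) , (begin
    pow F x a ³                                  ≈⟨ *-congʳ (pow-+ x a a) ⟨
    pow F x (a ℕ.+ a) * pow F x a                ≈⟨ pow-+ x (a ℕ.+ a) a ⟨
    pow F x (a ℕ.+ a ℕ.+ a)                      ≈⟨ reflexive (≡.cong (pow F x) (arithmetic j)) ⟩
    pow F x (q′ ℕ.+ (1 ℕ.+ 6 ℕ.* j))             ≈⟨ pow-+ x q′ _ ⟩
    pow F x q′ * pow F x (1 ℕ.+ 6 ℕ.* j)         ≈⟨ *-congʳ (trans (reflexive (≡.cong (pow F x) (≡.sym q≡))) (fermat x)) ⟩
    pow F x (2 ℕ.+ 6 ℕ.* j)                      ≈⟨ reflexive (≡.cong (pow F x) (≡.sym (arithmetic′ j))) ⟩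
    pow F x q′                                   ≈⟨ trans (reflexive (≡.cong (pow F x) (≡.sym q≡))) (fermat x) ⟩
    x                                            ∎)
    where
    open SetoidReasoning setoid
    a = 1 ℕ.+ 4 ℕ.* j
    q′ = 2 ℕ.* (1 ℕ.+ 3 ℕ.* j)
    q≡ : 2 ℕ.^ n ≡ q′
    q≡ = ≡.cong (2 ℕ.*_) eq
    arithmetic : ∀ j → (1 ℕ.+ 4 ℕ.* j) ℕ.+ (1 ℕ.+ 4 ℕ.* j) ℕ.+ (1 ℕ.+ 4 ℕ.* j) ≡ 2 ℕ.* (1 ℕ.+ 3 ℕ.* j) ℕ.+ (1 ℕ.+ 6 ℕ.* j)
    arithmetic = solve-∀
    arithmetic′ : ∀ j → 2 ℕ.* (1 ℕ.+ 3 ℕ.* j) ≡ 2 ℕ.+ 6 ℕ.* j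
    arithmetic′ = solve-∀

  square-order : ∀ k → n ≡ k ℕ.+ k → IsSquareℕ (2 ℕ.^ n)
  square-order k ≡.refl = 2 ℕ.^ k , ≡.sym (ℕ.^-distribˡ-+-* 2 k k)

  nonCube≉0 : ∀ {θ} → NonCube F θ → ¬ (θ ≈ 0#)
  nonCube≉0 nc θ≈0 = nc (0# , trans (zeroʳ _) (sym θ≈0))

  coset? : ∀ a b → ¬ (b ≈ 0#) → Dec (∃ λ y → b ≈ a * y ³)
  coset? a b b≉0 = map′ (λ { (i , e) → unit i , e })
    (λ { (y , e) → unitIndex y (y≉0 e) , trans e (*-congˡ (sym (³-cong (unit-unitIndex y (y≉0 e))))) })
    (Fin.any? (λ i → b ≟ (a * unit i ³)))
    where
    y≉0 : ∀ {y} → b ≈ a * y ³ → ¬ (y ≈ 0#)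
    y≉0 e y≈0 = b≉0 (trans e (trans (*-congˡ (trans (*-congˡ y≈0) (zeroʳ _))) (zeroʳ a)))

  -- For odd n every element is a cube. For even n the order q is a square, the classes of 1, θ and
  -- θ² are distinct, and counting leaves no room for a fourth.
  cubeClass : ∀ θ b → ¬ (b ≈ 0#) → (IsSquareℕ (2 ℕ.^ n) → NonCube F θ) → CubeClass θ b
  cubeClass θ b b≉0 θ-nonCube = classify (odd-or-even n) (coset? 1# b b≉0) (coset? θ b b≉0) (coset? (θ * θ) b b≉0)
    where
    no-other-coset : ∀ k → n ≡ k ℕ.+ k → ¬ (∃ λ y → b ≈ 1# * y ³) → ¬ (∃ λ y → b ≈ θ * y ³) → ¬ (∃ λ y → b ≈ θ * θ * y ³) → ⊥
    classify : (∃ λ k → n ≡ k ℕ.+ k) ⊎ (∃ λ k → n ≡ suc (k ℕ.+ k)) → Dec (∃ λ y → b ≈ 1# * y ³) →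
               Dec (∃ λ y → b ≈ θ * y ³) → Dec (∃ λ y → b ≈ θ * θ * y ³) → CubeClass θ b
    classify (inj₂ (k , eq)) _ _ _ = cube (trans (sym (proj₂ (cubes-of-odd k eq b))) (sym (*-identityˡ _)))
    classify (inj₁ _) (yes (y , e)) _ _ = cube e
    classify (inj₁ (k , eq)) (no _) (yes (y , e)) _ = θ-coset (square-order k eq) e
    classify (inj₁ (k , eq)) (no _) (no _) (yes (y , e)) = θ²-coset (square-order k eq) e
    classify (inj₁ (k , eq)) (no ∉₁) (no ∉₂) (no ∉₃) = ⊥-elim (no-other-coset k eq ∉₁ ∉₂ ∉₃)
    no-other-coset k eq ∉₁ ∉₂ ∉₃ = no-four-cosets c c≉0 distinct
      where
      nc = θ-nonCube (square-order k eq)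
      θ≉0 = nonCube≉0 nc
      c : Fin 4 → Carrier
      c 0F = 1#
      c 1F = θ
      c 2F = θ * θ
      c 3F = b
      c≉0 : ∀ i → ¬ (c i ≈ 0#)
      c≉0 0F = 1≉0
      c≉0 1F = θ≉0
      c≉0 2F = *-nonzero θ≉0 θ≉0
      c≉0 3F = b≉0
      θ-cancel : ∀ {x y} → θ * x ≈ θ * y → x ≈ y
      θ-cancel e = x+y≈0⇒x≈y (*-cancelˡ-0 θ≉0 (trans (distribˡ _ _ _) (trans (+-congʳ e) (x+x≈0 _))))
      distinct : ∀ i j → i Fin.< j → ∀ w → ¬ (c j ≈ c i * w ³)
      distinct 0F 1F _ w e = nc (w , sym (trans e (*-identityˡ _)))
      distinct 0F 2F _ w e = nc (proj₁ root , sym (trans (proj₂ root) (*-identityˡ _)))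
        where
        w≉0 : ¬ (w ≈ 0#)
        w≉0 w≈0 = *-nonzero θ≉0 θ≉0 (trans e (trans (*-congˡ (trans (*-congˡ w≈0) (zeroʳ _))) (zeroʳ _)))
        root : ∃ λ z → θ ≈ 1# * z ³
        -- From θ² = w³ follows θ w³ = θ³, which would make θ the cube of θ / w.
        root = coset-ratio {θ} {1#} {w} {θ} w≉0
          (sym (trans (*-identityˡ _) (trans (*-congʳ e) (solve 2 (λ w θ → 𝟏 :* w E.³ :* θ ⊜ θ :* w E.³) w θ))))
      distinct 1F 2F _ w e = nc (w , sym (θ-cancel e))
      distinct 0F 3F _ w e = ∉₁ (w , e)
      distinct 1F 3F _ w e = ∉₂ (w , e)
      distinct 2F 3F _ w e = ∉₃ (w , e)
      distinct 0F 0F ()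
      distinct 1F 0F ()
      distinct 2F 0F ()
      distinct 3F 0F ()
      distinct 1F 1F (s≤s ())
      distinct 2F 1F (s≤s ())
      distinct 3F 1F (s≤s ())
      distinct 2F 2F (s≤s (s≤s ()))
      distinct 3F 2F (s≤s (s≤s ()))
      distinct 3F 3F (s≤s (s≤s (s≤s ())))

-- Moving a pencil to a normal form

module Orbits (F : CommutativeRing 0ℓ 0ℓ) (isField : IsField F)
  (1+1≈0 : HasChar2 F)
  (_≟0 : ZeroTest F)
  (square-root : ∀ x → ∃ λ y → CommutativeRing._≈_ F (CommutativeRing._*_ F y y) x)
  (σ : CommutativeRing.Carrier F) where

  open CommutativeRing F hiding (zero)
  open FieldProperties F isField
  open Char2 F 1+1≈0
  open Forms F
  open Pencils F isField 1+1≈0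

  pencil-i pencil-iii : Plücker Carrier
  pencil-i   = plücker 0# 0# 1# 0# 0# 0#
  pencil-iii = plücker 0# 1# 1# 0# 0# 0#

  pencil-iv pencil-v pencil-vi : Carrier → Plücker Carrier
  pencil-iv β = plücker β 0# 0# 0# 1# 0#
  pencil-v  c = plücker c 0# c 0# 1# 0#
  -- With b = 0 this is the pencil of (ii).
  pencil-vi b = plücker (σ ²) (σ + b ² + b) (b + 1# + σ) (σ + b) 1# 1#

  data Orbit (p : Plücker Carrier) : Set where
    orbit-i   : p ⇝ pencil-i → Orbit p
    orbit-iii : p ⇝ pencil-iii → Orbit p
    orbit-iv  : ∀ β → ¬ (β ≈ 0#) → p ⇝ pencil-iv β → Orbit p
    orbit-v   : ∀ c → ¬ (c ≈ 0#) → ¬ (c ≈ 1#) → p ⇝ pencil-v c → Orbit p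
    orbit-vi  : ∀ b → ¬ (b ≈ 1#) → p ⇝ pencil-vi b → Orbit p

  orbit-resp : ∀ {p q} → p ⇝ q → Orbit q → Orbit p
  orbit-resp r (orbit-i s)            = orbit-i (r ⨾ s)
  orbit-resp r (orbit-iii s)          = orbit-iii (r ⨾ s)
  orbit-resp r (orbit-iv β β≉0 s)     = orbit-iv β β≉0 (r ⨾ s)
  orbit-resp r (orbit-v c c≉0 c≉1 s)  = orbit-v c c≉0 c≉1 (r ⨾ s)
  orbit-resp r (orbit-vi b b≉1 s)     = orbit-vi b b≉1 (r ⨾ s)

  ⇝-resultant≉0 : ∀ {p q} → p ⇝ q → ¬ (resultant p ≈ 0#) → ¬ (resultant q ≈ 0#)
  ⇝-resultant≉0 r res≉0 with ⇝-invariants r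
  ... | ν , ν≉0 , _ , e = nonzero-resp (sym e) (*-nonzero (*-nonzero (*-nonzero ν≉0 ν≉0) ν≉0) res≉0)

  ⇝-Δ≉0 : ∀ {p q} → p ⇝ q → ¬ (Δ p ≈ 0#) → ¬ (Δ q ≈ 0#)
  ⇝-Δ≉0 r Δ≉0 with ⇝-invariants r
  ... | ν , ν≉0 , e , _ = nonzero-resp (sym e) (*-nonzero ν≉0 Δ≉0)

  ⇝-Δ≈0 : ∀ {p q} → p ⇝ q → Δ p ≈ 0# → Δ q ≈ 0#
  ⇝-Δ≈0 r Δ≈0 with ⇝-invariants r
  ... | ν , _ , e , _ = trans e (trans (*-congˡ Δ≈0) (zeroʳ ν))

  root-to-∞ : ∀ p → HasRoot p → ∃ λ q → p ⇝ q × p₂₃ q ≈ 0#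
  root-to-∞ p (x , y , xy≉0 , w) with y ≟0
  ... | yes y≈0 = p , same ≋-refl , *-cancelˡ-0 (*-nonzero (*-nonzero x≉0 x≉0) (*-nonzero x≉0 x≉0)) (trans
      (solve 5 (λ a D f x y → x E.⁴ :* f ⊜ a :* y E.⁴ :+ D :* (x E.² :* y E.²) :+ f :* x E.⁴ :+ y :* (a :* y E.³ :+ D :* (x E.² :* y)))
        (p₀₁ p) (Δ p) (p₂₃ p) x y)
      (trans (+-cong w (trans (*-congʳ y≈0) (zeroˡ _))) (+-identityˡ 0#)))
    where
    x≉0 : ¬ (x ≈ 0#)
    x≉0 x≈0 = xy≉0 (x≈0 , y≈0)
  ... | no y≉0 with quotient x y y≉0
  ...   | z , zy≈x = swap (shift z p) , shifts z ⨾ swaps ,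
    *-cancelˡ-0 (*-nonzero (*-nonzero y≉0 y≉0) (*-nonzero y≉0 y≉0)) (trans
      (solve 5 (λ a D f z y → y E.⁴ :* (a :+ z E.² :* D :+ z E.⁴ :* f) ⊜ a :* y E.⁴ :+ D :* ((z :* y) E.² :* y E.²) :+ f :* (z :* y) E.⁴)
        (p₀₁ p) (Δ p) (p₂₃ p) z y)
      (trans (+-cong (+-congˡ (*-congˡ (*-congʳ (²-cong zy≈x)))) (*-congˡ (⁴-cong zy≈x))) w))

  -- Under these hypotheses the resultant is p₀₁ p₁₃², so both entries are units. The shift by p₀₃ /
  -- p₁₃ kills p₀₃ and p₁₂, which agree because Δ = 0, and the Klein relation then kills p₀₂.
  wild : ∀ q → p₂₃ q ≈ 0# → Δ q ≈ 0# → relation q ≈ 0# → ¬ (resultant q ≈ 0#) → Orbit q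
  wild q@(plücker a b c d e f) f≈0 Δ≈0 rel res≉0 =
    orbit-iv (ε * a) (*-nonzero ε≉0 a≉0)
      (shifts t ⨾ same (plücker-≈ {q = plücker a 0# 0# 0# e 0#} p₀₁≈ p₀₂≈ p₀₃≈ p₁₂≈ refl f≈0) ⨾ scales ε ε≉0 ⨾
       same (plücker-≈ refl (zeroʳ ε) (zeroʳ ε) (zeroʳ ε) εe≈1 (zeroʳ ε)))
    where
    res≈ : resultant q ≈ a * e ²
    res≈ = trans (solve 6 (λ a b c d e f → E.resultant (plücker a b c d e f) ⊜
        a :* e E.² :+ f :* (a :* (c :+ d) :+ b E.²) :+ (c :+ d) :* c E.²) a b c d e f)
      (trans (+-cong (+-congˡ (trans (*-congʳ f≈0) (zeroˡ _))) (trans (*-congʳ Δ≈0) (zeroˡ _)))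
        (solve 1 (λ x → x :+ 𝟎 :+ 𝟎 ⊜ x) _))
    a≉0 : ¬ (a ≈ 0#)
    a≉0 = *-nonzeroˡ (nonzero-resp res≈ res≉0)
    e≉0 : ¬ (e ≈ 0#)
    e≉0 = *-nonzeroˡ (*-nonzeroʳ (nonzero-resp res≈ res≉0))
    t = proj₁ (quotient c e e≉0)
    te≈c : t * e ≈ c
    te≈c = proj₂ (quotient c e e≉0)
    ε = proj₁ (quotient 1# e e≉0)
    εe≈1 : ε * e ≈ 1#
    εe≈1 = proj₂ (quotient 1# e e≉0)
    ε≉0 : ¬ (ε ≈ 0#)
    ε≉0 = quotient-nonzero εe≈1 1≉0
    drop : ∀ {x} y z {u v} → u ≈ 0# → v ≈ 0# → x + y * u + z * v ≈ x
    drop {x} y z {u} {v} u≈0 v≈0 = trans (+-cong (+-congˡ (trans (*-congˡ u≈0) (zeroʳ y))) (trans (*-congˡ v≈0) (zeroʳ z)))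
      (solve 1 (λ x → x :+ 𝟎 :+ 𝟎 ⊜ x) x)
    p₀₁≈ : a + t ² * (c + d) + t ⁴ * f ≈ a
    p₀₁≈ = drop _ _ Δ≈0 f≈0
    p₀₃≈ : c + t * e + t ² * f ≈ 0#
    p₀₃≈ = trans (+-cong (+-congˡ te≈c) (trans (*-congˡ f≈0) (zeroʳ _))) (trans (+-identityʳ _) (x+x≈0 c))
    p₁₂≈ : d + t * e + t ² * f ≈ 0#
    p₁₂≈ = trans (+-cong (+-congˡ te≈c) (trans (*-congˡ f≈0) (zeroʳ _))) (trans (+-identityʳ _) (trans (+-comm d c) Δ≈0))
    p₀₂≈ : b + t * (c + d) + t ² * e ≈ 0#
    p₀₂≈ = *-cancelˡ-0 e≉0 (trans
      (solve 7 (λ a b c d e f t → e :* (b :+ t :* (c :+ d) :+ t E.² :* e)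
          ⊜ E.relation (plücker a b c d e f) :+ a :* f :+ (c :+ d) :* (t :* e) :+ (t :* e :+ c) :* (t :* e) :+ c :* (t :* e :+ d)) a b c d e f t)
      (trans (+-cong (+-cong (+-cong (+-cong rel (trans (*-congˡ f≈0) (zeroʳ a))) (trans (*-congʳ Δ≈0) (zeroˡ _)))
                      (trans (*-congʳ (trans (+-congʳ te≈c) (x+x≈0 c))) (zeroˡ _)))
                     (trans (*-congˡ (trans (+-congʳ te≈c) Δ≈0)) (zeroʳ c)))
        (solve 0 (𝟎 :+ 𝟎 :+ 𝟎 :+ 𝟎 :+ 𝟎 ⊜ 𝟎))))

  -- Both branch points of the Wronskian are rational and have been moved to 0 and ∞.
  split : ∀ b c d e → b * e + c * d ≈ 0# → ¬ (c ≈ 0#) → ¬ (c + d ≈ 0#) → Orbit (plücker 0# b c d e 0#)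
  split b c d e rel c≉0 Δ≉0 with d ≟0
  ... | no d≉0 = general
    where
    e≉0 : ¬ (e ≈ 0#)
    e≉0 e≈0 = *-nonzero c≉0 d≉0 (trans (sym (x+y≈0⇒x≈y rel)) (trans (*-congˡ e≈0) (zeroʳ b)))
    -- A dilation multiplies p₁₂ by s³ and p₁₃ by s⁴, so s = p₁₂ / p₁₃ makes them equal.
    s = proj₁ (quotient d e e≉0)
    se≈d : s * e ≈ d
    se≈d = proj₂ (quotient d e e≉0)
    s≉0 = quotient-nonzero se≈d d≉0
    s²≉0 = *-nonzero s≉0 s≉0
    k = proj₁ (quotient c d d≉0)
    kd≈c : k * d ≈ c
    kd≈c = proj₂ (quotient c d d≉0)
    k≉0 = quotient-nonzero kd≈c c≉0
    s³d≉0 = *-nonzero (*-nonzero s²≉0 s≉0) d≉0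
    ε = proj₁ (inverse (s ³ * d) s³d≉0)
    s³dε≈1 : s ³ * d * ε ≈ 1#
    s³dε≈1 = proj₂ (inverse (s ³ * d) s³d≉0)
    -- b e = c d = k d² = k d s e
    b≈ : b ≈ k * (d * s)
    b≈ = x+y≈0⇒x≈y (*-cancelˡ-0 e≉0 (trans
      (solve 6 (λ b c d e k s → e :* (b :+ k :* (d :* s)) ⊜ (b :* e :+ c :* d) :+ (c :+ k :* d) :* d :+ k :* d :* (s :* e :+ d)) b c d e k s)
      (trans (+-cong (+-cong rel (trans (*-congʳ (trans (+-congˡ kd≈c) (x+x≈0 c))) (zeroˡ d)))
                     (trans (*-congˡ (trans (+-congʳ se≈d) (x+x≈0 d))) (zeroʳ _)))
        (solve 0 (𝟎 :+ 𝟎 :+ 𝟎 ⊜ 𝟎)))))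
    unit : ∀ x → ε * (x * (s ³ * d)) ≈ x
    unit x = trans (solve 3 (λ ε x y → ε :* (x :* y) ⊜ y :* ε :* x) ε x (s ³ * d)) (trans (*-congʳ s³dε≈1) (*-identityˡ x))
    general : Orbit (plücker 0# b c d e 0#)
    general = orbit-v (k + 1#)
      (λ k+1≈0 → Δ≉0 (trans (+-congʳ (sym kd≈c)) (trans (solve 2 (λ k d → k :* d :+ d ⊜ (k :+ 𝟏) :* d) k d)
        (trans (*-congʳ k+1≈0) (zeroˡ d)))))
      (λ k+1≈1 → k≉0 (trans (solve 1 (λ k → k ⊜ k :+ 𝟏 :+ 𝟏) k) (trans (+-congʳ k+1≈1) 1+1≈0)))
      -- The intermediate vector (0, k, k, 1, 1, 0) is the pencil of x² (x + 1) and x + k. The shift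
      -- by 1 turns it into (v) with c = k + 1.
      (dilates s s≉0 ⨾ scales ε (inverse-nonzero s³dε≈1) ⨾
       same (plücker-≈ {q = plücker 0# k k 1# 1# 0#}
         (trans (*-congˡ (zeroʳ s)) (zeroʳ ε))
         (trans (*-congˡ (trans (*-congˡ b≈) (solve 3 (λ s k d → s E.² :* (k :* (d :* s)) ⊜ k :* (s E.³ :* d)) s k d))) (unit k))
         (trans (*-congˡ (trans (*-congˡ (sym kd≈c)) (solve 3 (λ s k d → s E.³ :* (k :* d) ⊜ k :* (s E.³ :* d)) s k d))) (unit k))
         (trans (*-congˡ (sym (*-identityˡ _))) (unit 1#))
         (trans (*-congˡ (trans (solve 2 (λ s e → s E.⁴ :* e ⊜ 𝟏 :* (s E.³ :* (s :* e))) s e) (*-congˡ (*-congˡ se≈d)))) (unit 1#))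
         (trans (*-congˡ (zeroʳ _)) (zeroʳ ε))) ⨾
       shifts 1# ⨾
       same (plücker-≈
         (solve 1 (λ k → 𝟎 :+ 𝟏 E.² :* (k :+ 𝟏) :+ 𝟏 E.⁴ :* 𝟎 ⊜ k :+ 𝟏) k)
         (solve 1 (λ k → k :+ 𝟏 :* (k :+ 𝟏) :+ 𝟏 E.² :* 𝟏 ⊜ 𝟎) k)
         (solve 1 (λ k → k :+ 𝟏 :* 𝟏 :+ 𝟏 E.² :* 𝟎 ⊜ k :+ 𝟏) k)
         (solve 0 (𝟏 :+ 𝟏 :* 𝟏 :+ 𝟏 E.² :* 𝟎 ⊜ 𝟎))
         refl refl))
  ... | yes d≈0 = special
    where
    -- One of p₀₂ and p₁₃ vanishes. If the other survives the pencil is (iii), possibly after a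
    -- swap; if neither does it is (i).
    be≈0 : b * e ≈ 0#
    be≈0 = trans (sym (+-identityʳ _)) (trans (+-congˡ (sym (trans (*-congˡ d≈0) (zeroʳ c)))) rel)
    one-triple : ∀ b → ¬ (b ≈ 0#) → plücker 0# b c 0# 0# 0# ⇝ pencil-iii
    one-triple b b≉0 = dilates s s≉0 ⨾ scales ε (inverse-nonzero s²bε≈1) ⨾ same (plücker-≈
      (trans (*-congˡ (zeroʳ _)) (zeroʳ ε))
      (trans (*-comm ε _) s²bε≈1)
      (trans (*-congˡ (trans (solve 2 (λ s c → s E.³ :* c ⊜ s E.² :* (s :* c)) s c) (*-congˡ sc≈b))) (trans (*-comm ε _) s²bε≈1))
      (trans (*-congˡ (zeroʳ _)) (zeroʳ ε))
      (trans (*-congˡ (zeroʳ _)) (zeroʳ ε))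
      (trans (*-congˡ (zeroʳ _)) (zeroʳ ε)))
      where
      s = proj₁ (quotient b c c≉0)
      sc≈b : s * c ≈ b
      sc≈b = proj₂ (quotient b c c≉0)
      s≉0 = quotient-nonzero sc≈b b≉0
      s²b≉0 = *-nonzero (*-nonzero s≉0 s≉0) b≉0
      ε = proj₁ (inverse (s ² * b) s²b≉0)
      s²bε≈1 : s ² * b * ε ≈ 1#
      s²bε≈1 = proj₂ (inverse (s ² * b) s²b≉0)
    special : Orbit (plücker 0# b c d e 0#)
    special with b ≟0 | e ≟0 | inverse c c≉0
    ... | no b≉0  | _       | _ = orbit-iii (same (plücker-≈ refl refl refl d≈0 (*-cancelˡ-0 b≉0 be≈0) refl) ⨾ one-triple b b≉0)
    ... | yes b≈0 | no e≉0  | _ = orbit-iii (same (plücker-≈ refl b≈0 refl d≈0 refl refl) ⨾ swaps ⨾ one-triple e e≉0)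
    ... | yes b≈0 | yes e≈0 | ε , cε≈1 = orbit-i (same (plücker-≈ {q = plücker 0# 0# c 0# 0# 0#} refl b≈0 refl d≈0 e≈0 refl) ⨾
      scales ε (inverse-nonzero cε≈1) ⨾
      same (plücker-≈ (zeroʳ ε) (zeroʳ ε) (trans (*-comm ε c) cε≈1) (zeroʳ ε) (zeroʳ ε) (zeroʳ ε)))

  rational-root : ∀ p → HasRoot p → relation p ≈ 0# → ¬ (resultant p ≈ 0#) → Orbit p
  rational-root p root rel res≉0 = at-infinity (root-to-∞ p root)
    where
    tame : ∀ q → p₂₃ q ≈ 0# → ¬ (Δ q ≈ 0#) → relation q ≈ 0# → ¬ (resultant q ≈ 0#) → Orbit q
    tame q f≈0 Δ≉0 rel′ res′≉0 = orbit-resp (shifts t ⨾ same (plücker-≈ p₀₁≈0 refl refl refl refl f≈0))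
      (split (p₀₂ r) (p₀₃ r) (p₁₂ r) (p₁₃ r) rel-r p₀₃≉0 (⇝-Δ≉0 (shifts t {q}) Δ≉0))
      where
      -- With p₂₃ = 0 a shift by t adds t² Δ to p₀₁.
      t² = proj₁ (quotient (p₀₁ q) (Δ q) Δ≉0)
      t = proj₁ (square-root t²)
      r = shift t q
      p₀₁≈0 : p₀₁ r ≈ 0#
      p₀₁≈0 = trans (+-cong (+-congˡ (trans (*-congʳ (proj₂ (square-root t²))) (proj₂ (quotient (p₀₁ q) (Δ q) Δ≉0))))
                            (trans (*-congˡ f≈0) (zeroʳ _)))
              (trans (+-identityʳ _) (x+x≈0 _))
      rel-r : p₀₂ r * p₁₃ r + p₀₃ r * p₁₂ r ≈ 0#
      rel-r = trans (+-congʳ (trans (sym (+-identityˡ _)) (+-congʳ (sym (trans (*-congʳ p₀₁≈0) (zeroˡ _))))))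
        (⇝-relation (shifts t {q}) rel′)
      -- For p₀₁ = p₂₃ = 0 the resultant is Δ p₀₃².
      p₀₃≉0 : ¬ (p₀₃ r ≈ 0#)
      p₀₃≉0 p₀₃≈0 = ⇝-resultant≉0 (shifts t {q}) res′≉0
        (trans (resultant-cong {q = plücker 0# (p₀₂ r) 0# (p₁₂ r) (p₁₃ r) 0#} (plücker-≈ p₀₁≈0 refl p₀₃≈0 refl refl f≈0))
          (solve 3 (λ b d e → E.resultant (plücker 𝟎 b 𝟎 d e 𝟎) ⊜ 𝟎) (p₀₂ r) (p₁₂ r) (p₁₃ r)))
    at-infinity : (∃ λ q → p ⇝ q × p₂₃ q ≈ 0#) → Orbit p
    at-infinity (q , p⇝q , f≈0) with Δ q ≟0
    ... | yes Δ≈0 = orbit-resp p⇝q (wild q f≈0 Δ≈0 (⇝-relation p⇝q rel) (⇝-resultant≉0 p⇝q res≉0))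
    ... | no Δ≉0 = orbit-resp p⇝q (tame q f≈0 Δ≉0 (⇝-relation p⇝q rel) (⇝-resultant≉0 p⇝q res≉0))

  resultant-vi : ∀ b → resultant (pencil-vi b) ≈ (b + 1#) ⁴
  resultant-vi b = solve 2 (λ σ b → E.resultant (plücker (σ E.²) (σ :+ b E.² :+ b) (b :+ 𝟏 :+ σ) (σ :+ b) 𝟏 𝟏)
    ⊜ (b :+ 𝟏) E.⁴) σ b

  module _ (℘-or : ∀ τ → (∃ λ y → y ² + y ≈ τ) ⊎ (∃ λ y → y ² + y ≈ τ + σ)) (σ∉℘ : ∀ y → ¬ (y ² + y ≈ σ)) where

    -- One degree of freedom is left: Δ = 1 gives p₁₂ = p₀₃ + 1, and the Klein relation gives p₀₂
    -- because p₁₃ = 1. The parameter is written b = p₀₃ + 1 + σ, and b ≠ 1 because the resultant is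
    -- (b + 1)⁴.
    inert-unit : ∀ p → p₀₁ p ≈ σ ² → Δ p ≈ 1# → p₂₃ p ≈ 1# → p₁₃ p ≈ 1# → relation p ≈ 0# → ¬ (resultant p ≈ 0#) → Orbit p
    inert-unit p e₀₁ eΔ e₂₃ e₁₃ rel res≉0 = orbit-vi b b≉1 p⇝vi
      where
      b = p₀₃ p + 1# + σ
      p⇝vi : p ⇝ pencil-vi b
      p⇝vi = same (plücker-≈ e₀₁ e₀₂
        (solve 2 (λ u s → u ⊜ u :+ 𝟏 :+ s :+ 𝟏 :+ s) (p₀₃ p) σ)
        (trans (solve 2 (λ u d → d ⊜ u :+ d :+ u) (p₀₃ p) (p₁₂ p)) (trans (+-congʳ eΔ)
          (solve 2 (λ u s → 𝟏 :+ u ⊜ s :+ (u :+ 𝟏 :+ s)) (p₀₃ p) σ)))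
        e₁₃ e₂₃)
        where
        e₀₂ : p₀₂ p ≈ σ + b ² + b
        e₀₂ = begin
          p₀₂ p                                                  ≈⟨ *-identityʳ _ ⟨
          p₀₂ p * 1#                                             ≈⟨ *-congˡ e₁₃ ⟨
          p₀₂ p * p₁₃ p                                          ≈⟨ solve 6 (λ a b c d e f → b :* e ⊜ E.relation (plücker a b c d e f) :+ (a :* f :+ c :* (c :+ d) :+ c E.²)) (p₀₁ p) (p₀₂ p) (p₀₃ p) (p₁₂ p) (p₁₃ p) (p₂₃ p) ⟩
          relation p + (p₀₁ p * p₂₃ p + p₀₃ p * Δ p + p₀₃ p ²)   ≈⟨ +-cong rel (+-congʳ (+-cong (*-cong e₀₁ e₂₃) (*-congˡ eΔ))) ⟩
          0# + (σ ² * 1# + p₀₃ p * 1# + p₀₃ p ²)                 ≈⟨ solve 2 (λ u s → 𝟎 :+ (s E.² :* 𝟏 :+ u :* 𝟏 :+ u E.²) ⊜ s :+ (u :+ 𝟏 :+ s) E.² :+ (u :+ 𝟏 :+ s)) (p₀₃ p) σ ⟩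
          σ + b ² + b                                            ∎
          where open SetoidReasoning setoid
      b≉1 : ¬ (b ≈ 1#)
      b≉1 b≈1 = ⇝-resultant≉0 p⇝vi res≉0 (trans (resultant-vi b) (trans (⁴-cong (trans (+-congʳ b≈1) 1+1≈0))
        (solve 0 (𝟎 E.⁴ ⊜ 𝟎))))

    inert : ∀ p → p₀₁ p ≈ σ ² → Δ p ≈ 1# → p₂₃ p ≈ 1# → relation p ≈ 0# → ¬ (resultant p ≈ 0#) → Orbit p
    inert p e₀₁ eΔ e₂₃ rel res≉0 with (p₁₃ p + 1#) ≟0
    ... | yes t+1≈0 = inert-unit p e₀₁ eΔ e₂₃ (x+y≈0⇒x≈y t+1≈0) rel res≉0
    ... | no  t+1≉0 = orbit-resp p⇝r (inert-unit r r₀₁ rΔ r₂₃ r₁₃ (⇝-relation p⇝r rel) (⇝-resultant≉0 p⇝r res≉0))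
      where
      -- The substitution x ↦ (m x + σ)/(x + m + 1) fixes the roots of x² + x + σ; this choice of m makes p₁₃ = 1.
      open SetoidReasoning setoid
      t = p₁₃ p
      s = p₀₂ p
      -- After the substitution p₁₃ = 1 reads s + m + m² t = m² + m + σ, that is, m² (t + 1) = s +
      -- σ.
      m² = proj₁ (quotient (s + σ) (t + 1#) t+1≉0)
      m = proj₁ (square-root m²)
      m²[t+1] : m ² * (t + 1#) ≈ s + σ
      m²[t+1] = trans (*-congʳ (proj₂ (square-root m²))) (proj₂ (quotient (s + σ) (t + 1#) t+1≉0))
      -- The determinant of the substitution, which is also the norm of m + ρ for a root ρ of x² + x
      -- + σ. It could vanish only if σ had the form m² + m.
      N = m ² + m + σ
      N≉0 : ¬ (N ≈ 0#)
      N≉0 N≈0 = σ∉℘ m (x+y≈0⇒x≈y N≈0)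
      N³≉0 = *-nonzero (*-nonzero N≉0 N≉0) N≉0
      ε = proj₁ (inverse (N ³) N³≉0)
      N³ε≈1 : N ³ * ε ≈ 1#
      N³ε≈1 = proj₂ (inverse (N ³) N³≉0)
      -- The moves come from (m x + σ)/(x + m + 1) = m + N/(x + m + 1).
      q = scaleᵖ ε (swap (dilate N (shift m p)))
      r = shift (m + 1#) q
      p⇝r : p ⇝ r
      p⇝r = shifts m ⨾ dilates N N≉0 ⨾ swaps ⨾ scales ε (inverse-nonzero N³ε≈1) ⨾ shifts (m + 1#)
      unit : ∀ {x} y → x ≈ y * N ³ → ε * x ≈ y
      unit {x} y e = trans (*-congˡ e) (trans (solve 3 (λ ε y N → ε :* (y :* N E.³) ⊜ N E.³ :* ε :* y) ε y N)
        (trans (*-congʳ N³ε≈1) (*-identityˡ y)))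
      q₁₃ : p₁₃ q ≈ 1#
      q₁₃ = unit 1# (begin
        N ² * (s + m * Δ p + m ² * t)           ≈⟨ *-congˡ (+-congʳ (+-congˡ (*-congˡ eΔ))) ⟩
        N ² * (s + m * 1# + m ² * t)            ≈⟨ solve 5 (λ N s m t σ → N :* (s :+ m :* 𝟏 :+ m E.² :* t) ⊜ N :* (m E.² :* (t :+ 𝟏) :+ (s :+ σ) :+ (m E.² :+ m :+ σ))) (N ²) s m t σ ⟩
        N ² * (m ² * (t + 1#) + (s + σ) + N)    ≈⟨ *-congˡ (+-congʳ (trans (+-congʳ m²[t+1]) (x+x≈0 _))) ⟩
        N ² * (0# + N)                          ≈⟨ solve 1 (λ N → N E.² :* (𝟎 :+ N) ⊜ 𝟏 :* N E.³) N ⟩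
        1# * N ³                                ∎)
      q₂₃ : p₂₃ q ≈ 1#
      q₂₃ = unit 1# (begin
        N * (p₀₁ p + m ² * Δ p + m ⁴ * p₂₃ p)   ≈⟨ *-congˡ (+-cong (+-cong e₀₁ (*-congˡ eΔ)) (*-congˡ e₂₃)) ⟩
        N * (σ ² + m ² * 1# + m ⁴ * 1#)         ≈⟨ solve 2 (λ m σ → let N = m E.² :+ m :+ σ in N :* (σ E.² :+ m E.² :* 𝟏 :+ m E.⁴ :* 𝟏) ⊜ 𝟏 :* N E.³) m σ ⟩
        1# * N ³                                ∎)
      q₀₁ : p₀₁ q ≈ N ²
      q₀₁ = unit (N ²) (begin
        N ⁴ * N * p₂₃ p  ≈⟨ *-congˡ e₂₃ ⟩
        N ⁴ * N * 1#     ≈⟨ solve 1 (λ N → N E.⁴ :* N :* 𝟏 ⊜ N E.² :* N E.³) N ⟩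
        N ² * N ³        ∎)
      qΔ : Δ q ≈ 1#
      qΔ = trans (sym (distribˡ ε _ _)) (unit 1# (begin
        N ³ * (p₀₃ p + m * t + m ² * p₂₃ p) + N ³ * (p₁₂ p + m * t + m ² * p₂₃ p)
          ≈⟨ solve 5 (λ n x x′ y z → n :* (x :+ y :+ z) :+ n :* (x′ :+ y :+ z) ⊜ (x :+ x′) :* n) (N ³) (p₀₃ p) (p₁₂ p) (m * t) (m ² * p₂₃ p) ⟩
        Δ p * N ³  ≈⟨ *-congʳ eΔ ⟩
        1# * N ³   ∎))
      r₁₃ = q₁₃
      r₂₃ = q₂₃
      rΔ : Δ r ≈ 1#
      rΔ = trans (solve 4 (λ x y z w → x :+ z :+ w :+ (y :+ z :+ w) ⊜ x :+ y) (p₀₃ q) (p₁₂ q) ((m + 1#) * p₁₃ q) ((m + 1#) ² * p₂₃ q)) qΔ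
      r₀₁ : p₀₁ r ≈ σ ²
      r₀₁ = begin
        p₀₁ q + (m + 1#) ² * Δ q + (m + 1#) ⁴ * p₂₃ q  ≈⟨ +-cong (+-cong q₀₁ (*-congˡ qΔ)) (*-congˡ q₂₃) ⟩
        N ² + (m + 1#) ² * 1# + (m + 1#) ⁴ * 1#        ≈⟨ solve 2 (λ m σ → (m E.² :+ m :+ σ) E.² :+ (m :+ 𝟏) E.² :* 𝟏 :+ (m :+ 𝟏) E.⁴ :* 𝟏 ⊜ σ E.²) m σ ⟩
        σ ²                                            ∎

    irrational : ∀ p → ¬ (Δ p ≈ 0#) → ¬ (p₂₃ p ≈ 0#) → relation p ≈ 0# → ¬ (resultant p ≈ 0#) → Orbit p
    irrational p Δ≉0 f≉0 rel res≉0 = shape (℘-or τ)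
      where
      open SetoidReasoning setoid
      -- A dilation by a multiplies Δ by a³ and p₂₃ by a⁵, so a² = Δ / p₂₃ makes them equal and one
      -- scalar makes both 1.
      a² = proj₁ (quotient (Δ p) (p₂₃ p) f≉0)
      a²f≈Δ : a² * p₂₃ p ≈ Δ p
      a²f≈Δ = proj₂ (quotient (Δ p) (p₂₃ p) f≉0)
      a = proj₁ (square-root a²)
      aa≈a² : a ² ≈ a²
      aa≈a² = proj₂ (square-root a²)
      a≉0 : ¬ (a ≈ 0#)
      a≉0 = *-nonzeroˡ (nonzero-resp (sym aa≈a²) (quotient-nonzero a²f≈Δ Δ≉0))
      a³Δ≉0 = *-nonzero (*-nonzero (*-nonzero a≉0 a≉0) a≉0) Δ≉0
      ε = proj₁ (inverse (a ³ * Δ p) a³Δ≉0)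
      a³Δε≈1 : a ³ * Δ p * ε ≈ 1#
      a³Δε≈1 = proj₂ (inverse (a ³ * Δ p) a³Δ≉0)
      q = scaleᵖ ε (dilate a p)
      p⇝q : p ⇝ q
      p⇝q = dilates a a≉0 ⨾ scales ε (inverse-nonzero a³Δε≈1)
      qΔ : Δ q ≈ 1#
      qΔ = trans (solve 4 (λ ε a x y → ε :* (a :* x) :+ ε :* (a :* y) ⊜ a :* (x :+ y) :* ε) ε (a ³) (p₀₃ p) (p₁₂ p)) a³Δε≈1
      q₂₃ : p₂₃ q ≈ 1#
      q₂₃ = begin
        ε * (a ⁴ * a * p₂₃ p)      ≈⟨ solve 3 (λ ε a f → ε :* (a E.⁴ :* a :* f) ⊜ a E.³ :* (a E.² :* f) :* ε) ε a (p₂₃ p) ⟩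
        a ³ * (a ² * p₂₃ p) * ε    ≈⟨ *-congʳ (*-congˡ (trans (*-congʳ aa≈a²) a²f≈Δ)) ⟩
        a ³ * Δ p * ε              ≈⟨ a³Δε≈1 ⟩
        1#                         ∎
      -- The Wronskian is now the square of x² + x y + τ y². Shifting by y replaces τ by τ + y² + y.
      τ = proj₁ (square-root (p₀₁ q))
      q₀₁ : p₀₁ q ≈ τ ²
      q₀₁ = sym (proj₂ (square-root (p₀₁ q)))
      shape : (∃ λ y → y ² + y ≈ τ) ⊎ (∃ λ y → y ² + y ≈ τ + σ) → Orbit p
      shape (inj₁ (y , e)) = rational-root p (⇝-root (⇝-sym p⇝q) (y , 1# , (1≉0 ∘ proj₂) , (begin
        p₀₁ q * 1# ⁴ + Δ q * (y ² * 1# ²) + p₂₃ q * y ⁴   ≈⟨ +-cong (+-cong (*-congʳ q₀₁) (*-congʳ qΔ)) (*-congʳ q₂₃) ⟩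
        τ ² * 1# ⁴ + 1# * (y ² * 1# ²) + 1# * y ⁴         ≈⟨ solve 2 (λ τ y → τ E.² :* 𝟏 E.⁴ :+ 𝟏 :* (y E.² :* 𝟏 E.²) :+ 𝟏 :* y E.⁴ ⊜ τ E.² :+ (y E.² :+ y) E.²) τ y ⟩
        τ ² + (y ² + y) ²                                 ≈⟨ +-congˡ (²-cong e) ⟩
        τ ² + τ ²                                         ≈⟨ x+x≈0 _ ⟩
        0#                                                ∎))) rel res≉0
      shape (inj₂ (y , e)) = orbit-resp p⇝r (inert r r₀₁
        (trans (solve 4 (λ x y z w → x :+ z :+ w :+ (y :+ z :+ w) ⊜ x :+ y) (p₀₃ q) (p₁₂ q) (y * p₁₃ q) (y ² * p₂₃ q)) qΔ)
        q₂₃ (⇝-relation p⇝r rel) (⇝-resultant≉0 p⇝r res≉0))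
        where
        r = shift y q
        p⇝r = p⇝q ⨾ shifts y
        r₀₁ : p₀₁ r ≈ σ ²
        r₀₁ = begin
          p₀₁ q + y ² * Δ q + y ⁴ * p₂₃ q   ≈⟨ +-cong (+-cong q₀₁ (*-congˡ qΔ)) (*-congˡ q₂₃) ⟩
          τ ² + y ² * 1# + y ⁴ * 1#         ≈⟨ solve 2 (λ τ y → τ E.² :+ y E.² :* 𝟏 :+ y E.⁴ :* 𝟏 ⊜ τ E.² :+ (y E.² :+ y) E.²) τ y ⟩
          τ ² + (y ² + y) ²                 ≈⟨ +-congˡ (²-cong e) ⟩
          τ ² + (τ + σ) ²                   ≈⟨ solve 2 (λ τ σ → τ E.² :+ (τ :+ σ) E.² ⊜ σ E.²) τ σ ⟩
          σ ²                               ∎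

    orbit : ∀ p → relation p ≈ 0# → ¬ (resultant p ≈ 0#) → Orbit p
    orbit p rel res≉0 with Δ p ≟0 | p₂₃ p ≟0
    ... | _       | yes f≈0 = rational-root p
      (1# , 0# , (1≉0 ∘ proj₁) , trans
        (solve 3 (λ a D f → a :* 𝟎 E.⁴ :+ D :* (𝟏 E.² :* 𝟎 E.²) :+ f :* 𝟏 E.⁴ ⊜ f) (p₀₁ p) (Δ p) (p₂₃ p)) f≈0)
      rel res≉0
    ... | no Δ≉0  | no f≉0  = irrational p Δ≉0 f≉0 rel res≉0
    -- The Wronskian is p₂₃ times the fourth power of a linear form, whose root takes two successive
    -- square roots.
    ... | yes Δ≈0 | no f≉0  = rational-root p
      (t , 1# , (1≉0 ∘ proj₂) , (begin
        p₀₁ p * 1# ⁴ + Δ p * (t ² * 1# ²) + p₂₃ p * t ⁴   ≈⟨ +-cong (+-congˡ (trans (*-congʳ Δ≈0) (zeroˡ _))) (trans (*-comm _ _) (*-congʳ (²-cong (proj₂ (square-root t²))))) ⟩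
        p₀₁ p * 1# ⁴ + 0# + t² * t² * p₂₃ p               ≈⟨ +-congˡ (trans (*-congʳ (proj₂ (square-root t⁴))) (proj₂ (quotient (p₀₁ p) (p₂₃ p) f≉0))) ⟩
        p₀₁ p * 1# ⁴ + 0# + p₀₁ p                         ≈⟨ solve 1 (λ x → x :* 𝟏 E.⁴ :+ 𝟎 :+ x ⊜ 𝟎) (p₀₁ p) ⟩
        0#                                                ∎))
      rel res≉0
      where
      open SetoidReasoning setoid
      t⁴ = proj₁ (quotient (p₀₁ p) (p₂₃ p) f≉0)
      t² = proj₁ (square-root t⁴)
      t = proj₁ (square-root t²)

-- Equivalent expressions and equivalent pencils

module Equivalence (F : CommutativeRing 0ℓ 0ℓ) (isField : IsField F)
  (1+1≈0 : HasChar2 F)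
  (_≟0 : ZeroTest F) where

  open CommutativeRing F hiding (zero)
  open FieldProperties F isField
  open Char2 F 1+1≈0
  open Forms F
  open Pencils F isField 1+1≈0
  open Substitution F isField 1+1≈0 _≟0
  open Coprimality F isField 1+1≈0 _≟0

  tail : Poly F → Poly F
  tail []      = []
  tail (x ∷ p) = p

  coeff-tail : ∀ p i → coeff F (tail p) i ≈ coeff F p (suc i)
  coeff-tail []      i = refl
  coeff-tail (x ∷ p) i = refl

  C-cong : ∀ {x y} → x ≈ y → C x ≈ᵖ C y
  C-cong e = pointwise λ { zero → e ; (suc i) → refl }

  toPoly-cong : ∀ {g h} → g ≋ᶜ h → toPoly g ≈ᵖ toPoly h
  toPoly-cong (cubic-≈ a b c d) = pointwise λ
    { 0 → a ; 1 → b ; 2 → c ; 3 → d ; (suc (suc (suc (suc i)))) → refl }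

  module _ (a b c d : Carrier) where

    private
      M = mob {F} a b c d
      l m : Poly F
      l = b ∷ a ∷ []
      m = d ∷ c ∷ []

    substFrom-unfold : ∀ N i p → substFrom F N M i p ≈ᵖ
      C (coeff F p 0) *ᵖ (powₚ F l i *ᵖ powₚ F m (N ℕ.∸ i)) +ᵖ substFrom F N M (suc i) (tail p)
    substFrom-unfold N i []      = P.sym (P.trans (P.+-identityʳ (C 0# *ᵖ (powₚ F l i *ᵖ powₚ F m (N ℕ.∸ i))))
      (P.trans (P.sym (scale-as-* 0# (powₚ F l i *ᵖ powₚ F m (N ℕ.∸ i)))) (scale-zero (powₚ F l i *ᵖ powₚ F m (N ℕ.∸ i)) refl)))
    substFrom-unfold N i (x ∷ p) = P.+-congʳ {substFrom F N M (suc i) p} (scale-as-* x (powₚ F l i *ᵖ powₚ F m (N ℕ.∸ i)))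

    substFrom-zero : ∀ N i p → (∀ j → coeff F p j ≈ 0#) → substFrom F N M i p ≈ᵖ []
    substFrom-zero N i []      z = P.refl
    substFrom-zero N i (x ∷ p) z =
      P.+-cong (scale-zero (powₚ F l i *ᵖ powₚ F m (N ℕ.∸ i)) (z 0)) (substFrom-zero N (suc i) p (λ j → z (suc j)))

    substitute-expand : ∀ g → toPoly (substitute a b c d g) ≈ᵖ
      C c₀ g *ᵖ (m *ᵖ (m *ᵖ m)) +ᵖ C c₁ g *ᵖ (l *ᵖ (m *ᵖ m)) +ᵖ C c₂ g *ᵖ (l *ᵖ (l *ᵖ m)) +ᵖ C c₃ g *ᵖ (l *ᵖ (l *ᵖ l))
    substitute-expand (cubic x y z w) = pointwise (solveₚ 8
      (λ a b c d x y z w → let l = b ∷ a ∷ []; m = d ∷ c ∷ [] in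
        E.toPoly (E.substitute a b c d (cubic x y z w)) ⊜
        (x ∷ []) ⊗ (m ⊗ (m ⊗ m)) ⊕ (y ∷ []) ⊗ (l ⊗ (m ⊗ m)) ⊕ (z ∷ []) ⊗ (l ⊗ (l ⊗ m)) ⊕ (w ∷ []) ⊗ (l ⊗ (l ⊗ l)))
      a b c d x y z w)

    -- Denominators are cleared with an exponent read off from list lengths rather than from the
    -- degree 3. The surplus is a power of c x + d common to numerator and denominator.
    substFrom-cubic : ∀ N k p → N ≡ 3 ℕ.+ k → DegLe F p 3 →
      substFrom F N M 0 p ≈ᵖ powₚ F m k *ᵖ toPoly (substitute a b c d (coefficients p))
    substFrom-cubic N k p ≡.refl deg =
      P.trans (substFrom-unfold N 0 p) (P.trans (P.+-congˡ {t₀} (P.trans (substFrom-unfold N 1 (tail p))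
        (P.trans (P.+-congˡ {t₁} (P.trans (substFrom-unfold N 2 (tail (tail p)))
        (P.trans (P.+-congˡ {t₂} (P.trans (substFrom-unfold N 3 (tail (tail (tail p))))
          (P.+-cong (P.*-congʳ {l³mk} (C-cong e₃)) (substFrom-zero N 4 (tail (tail (tail (tail p)))) rest))))
          (P.+-congʳ {s₃} (P.*-congʳ {l²mmk} (C-cong e₂))))))
          (P.+-congʳ {s₂} (P.*-congʳ {lmmmk} (C-cong (coeff-tail p 0)))))))
      (P.trans (S.solve 7 (λ x y z w l m mk →
          x :* (𝟏 :* (m :* (m :* (m :* mk)))) :+ (y :* (l :* 𝟏 :* (m :* (m :* mk))) :+ (z :* (l :* (l :* 𝟏) :* (m :* mk)) :+ (w :* (l :* (l :* (l :* 𝟏)) :* mk) :+ 𝟎)))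
          ⊜ mk :* (x :* (m :* (m :* m)) :+ y :* (l :* (m :* m)) :+ z :* (l :* (l :* m)) :+ w :* (l :* (l :* l))))
        (C coeff F p 0) (C coeff F p 1) (C coeff F p 2) (C coeff F p 3) l m (powₚ F m k))
      (P.*-congˡ {powₚ F m k} (P.sym (substitute-expand (coefficients p))))))
      where
      l³mk = powₚ F l 3 *ᵖ powₚ F m k
      l²mmk = powₚ F l 2 *ᵖ powₚ F m (suc k)
      lmmmk = powₚ F l 1 *ᵖ powₚ F m (suc (suc k))
      t₀ = C coeff F p 0 *ᵖ (powₚ F l 0 *ᵖ powₚ F m (suc (suc (suc k))))
      t₁ = C coeff F (tail p) 0 *ᵖ lmmmk
      t₂ = C coeff F (tail (tail p)) 0 *ᵖ l²mmk
      s₃ = C coeff F p 3 *ᵖ l³mk +ᵖ []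
      s₂ = C coeff F p 2 *ᵖ l²mmk +ᵖ s₃
      e₂ = trans (coeff-tail (tail p) 0) (coeff-tail p 1)
      e₃ = trans (coeff-tail (tail (tail p)) 0) (trans (coeff-tail (tail p) 1) (coeff-tail p 2))
      rest : ∀ j → coeff F (tail (tail (tail (tail p)))) j ≈ 0#
      rest j = trans (coeff-tail (tail (tail (tail p))) j) (trans (coeff-tail (tail (tail p)) (suc j))
        (trans (coeff-tail (tail p) (suc (suc j))) (trans (coeff-tail p (suc (suc (suc j)))) (deg _ (s≤s (s≤s (s≤s (s≤s z≤n))))))))

  linear-degree : ∀ c d → ¬ (d ≈ 0# × c ≈ 0#) → ∃ (HasDegree (d ∷ c ∷ []))
  linear-degree c d nz with c ≟0 | d ≟0
  ... | no c≉0  | _       = 1 , c≉0 , λ { (suc (suc i)) _ → refl ; 0 () ; 1 (s≤s ()) }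
  ... | yes c≈0 | no d≉0  = 0 , d≉0 , λ { (suc (suc i)) _ → refl ; 1 _ → c≈0 ; 0 () }
  ... | yes c≈0 | yes d≈0 = contradiction (d≈0 , c≈0) nz

  cancel-power : ∀ {m} → ∃ (HasDegree m) → ∀ k x y → powₚ F m k *ᵖ x ≈ᵖ powₚ F m k *ᵖ y → x ≈ᵖ y
  cancel-power deg zero x y e = P.trans (P.sym (P.*-identityˡ x)) (P.trans e (P.*-identityˡ y))
  cancel-power {m} deg (suc k) x y e = cancel-power deg k x y
    (*ᵖ-cancelˡ m (proj₂ deg) (powₚ F m k *ᵖ x) (powₚ F m k *ᵖ y)
      (P.trans (P.sym (*-assocᵖ m (powₚ F m k) x)) (P.trans e (*-assocᵖ m (powₚ F m k) y))))

  pencil : RatExpr F → Plücker Carrier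
  pencil (g , h) = wedge (coefficients g) (coefficients h)

  coeff-length : ∀ p i → ¬ (coeff F p i ≈ 0#) → i < length p
  coeff-length []      i       nz = contradiction refl nz
  coeff-length (x ∷ p) zero    nz = s≤s z≤n
  coeff-length (x ∷ p) (suc i) nz = s≤s (coeff-length p i nz)

  -- Being a cubic expression, with coprimality replaced by the resultant, which the moves on
  -- Plücker vectors control.
  record Cubicᴿ (R : RatExpr F) : Set where
    field
      deg-g        : DegLe F (proj₁ R) 3
      deg-h        : DegLe F (proj₂ R) 3
      leading      : ¬ (coeff F (proj₁ R) 3 ≈ 0#) ⊎ ¬ (coeff F (proj₂ R) 3 ≈ 0#)
      resultant≉0  : ¬ (resultant (pencil R) ≈ 0#)

  bézout-resp : ∀ {g g′ h h′} → g ≈ᵖ g′ → h ≈ᵖ h′ → Bézout g h → Bézout g′ h′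
  bézout-resp e f (u , v , r , r≉0 , bez) =
    u , v , r , r≉0 , P.trans (P.+-cong (P.*-congˡ {u} (P.sym e)) (P.*-congˡ {v} (P.sym f))) bez

  isCubic⇒Cubicᴿ : ∀ R → IsCubic F R → Cubicᴿ R
  isCubic⇒Cubicᴿ (g , h) (h≉0 , coprime , deg-g , deg-h , lead) = record
    { deg-g = deg-g ; deg-h = deg-h ; leading = lead
    ; resultant≉0 = bézout⇒resultant (coefficients g) (coefficients h)
        (bézout-resp (toPoly-coefficients g deg-g) (toPoly-coefficients h deg-h) (coprime⇒bézout g h h≉0 coprime)) lead
    }

  cubicᴿ-bézout : ∀ {g h} → Cubicᴿ (g , h) → Bézout g h
  cubicᴿ-bézout {g} {h} R = bézout-resp (P.sym (toPoly-coefficients g deg-g)) (P.sym (toPoly-coefficients h deg-h))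
    (resultant⇒bézout (coefficients g) (coefficients h) resultant≉0)
    where open Cubicᴿ R

  Cubicᴿ⇒isCubic : ∀ R → Cubicᴿ R → IsCubic F R
  Cubicᴿ⇒isCubic (g , h) R = h≉0 , bézout⇒coprime (cubicᴿ-bézout R) , deg-g , deg-h , leading
    where
    open Cubicᴿ R
    h≉0 : ¬ (_≈ₚ_ F h [])
    h≉0 h≈0 = resultant≉0 (trans
      (resultant-cong (wedge-cong {h′ = cubic 0# 0# 0# 0#} (≋ᶜ-refl {coefficients g}) (cubic-≈ (h≈0 0) (h≈0 1) (h≈0 2) (h≈0 3))))
      (solve 4 (λ x y z w → E.resultant (E.wedge (cubic x y z w) (cubic 𝟎 𝟎 𝟎 𝟎)) ⊜ 𝟎)
        (coeff F g 0) (coeff F g 1) (coeff F g 2) (coeff F g 3)))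

  module Action (R : RatExpr F) (cubicR : Cubicᴿ R) (α β γ δ a b c d : Carrier) where

    open Cubicᴿ cubicR

    private
      g = proj₁ R
      h = proj₂ R
      N = length g ℕ.⊔ length h
      acted = act F (mob α β γ δ) (mob a b c d) R

    m : Poly F
    m = a ∷ - c ∷ []

    moved : Cubic Carrier → Cubic Carrier
    moved = substitute d (- b) (- c) a

    target-g target-h : Cubic Carrier
    target-g = combine α β (moved (coefficients g)) (moved (coefficients h))
    target-h = combine γ δ (moved (coefficients g)) (moved (coefficients h))

    -- N is a length and so at least 4, one more than the degree: the surplus power is never
    -- trivial.
    excess : ∃ λ k → 3 ℕ.+ k ≡ N
    excess = ℕ.m≤n⇒∃[o]m+o≡n (long leading)
      where
      long : ¬ (coeff F g 3 ≈ 0#) ⊎ ¬ (coeff F h 3 ≈ 0#) → 3 ≤ N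
      long (inj₁ nz) = ℕ.≤-trans (ℕ.<⇒≤ (coeff-length g 3 nz)) (ℕ.m≤m⊔n (length g) (length h))
      long (inj₂ nz) = ℕ.≤-trans (ℕ.<⇒≤ (coeff-length h 3 nz)) (ℕ.m≤n⊔m (length g) (length h))

    k = proj₁ excess

    compL-factor : ∀ x y → scale F x (substFrom F N (mob d (- b) (- c) a) 0 g) +ᵖ scale F y (substFrom F N (mob d (- b) (- c) a) 0 h)
                   ≈ᵖ powₚ F m k *ᵖ toPoly (combine x y (moved (coefficients g)) (moved (coefficients h)))
    compL-factor x y = P.trans
      (P.+-cong (scale-cong refl (substFrom-cubic d (- b) (- c) a N k g (≡.sym (proj₂ excess)) deg-g))
                (scale-cong refl (substFrom-cubic d (- b) (- c) a N k h (≡.sym (proj₂ excess)) deg-h)))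
      (P.trans (P.+-cong (scale-as-* x (mk *ᵖ G)) (scale-as-* y (mk *ᵖ H)))
      (P.trans (S.solve 5 (λ x y mk G H → x :* (mk :* G) :+ y :* (mk :* H) ⊜ mk :* (x :* G :+ y :* H)) (C x) (C y) mk G H)
      (P.*-congˡ {mk} (P.sym (P.+-cong (scale-as-* x G) (scale-as-* y H))))))
      where
      mk = powₚ F m k
      G = toPoly (moved (coefficients g))
      H = toPoly (moved (coefficients h))

    act-g : proj₁ acted ≈ᵖ powₚ F m k *ᵖ toPoly target-g
    act-g = compL-factor α β

    act-h : proj₂ acted ≈ᵖ powₚ F m k *ᵖ toPoly target-h
    act-h = compL-factor γ δ

  pencil⇒equivalent : ∀ R S → Cubicᴿ R → Cubicᴿ S → pencil R ⇝ pencil S → Equivalent F R S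
  pencil⇒equivalent R@(g , h) S@(s , t) cubicR cubicS r = conclude (realise-wedge r)
    where
    open Cubicᴿ cubicS
    x≈−−x : ∀ x → x ≈ - (- x)
    x≈−−x x = sym (trans (-x≈x (- x)) (-x≈x x))
    conclude : Realised (coefficients g) (coefficients h) (pencil S) → Equivalent F R S
    conclude (a , b , c , d , det≉0 , μ , μ≉0 , e) = finish (nonzero-minor (coefficients s) (coefficients t) resultant≉0)
      where
      finish : (∃ λ j → ¬ (minor (coefficients s) (coefficients t) 0F j ≈ 0#)) → Equivalent F R S
      finish (j , q≉0) = build (same-pencil μ≉0 e 0F j q≉0)
        where
        build : (∃ λ α → ∃ λ β → ∃ λ γ → ∃ λ δ → ¬ (α * δ + β * γ ≈ 0#)
                  × coefficients s ≋ᶜ combine α β (substitute a b c d (coefficients g)) (substitute a b c d (coefficients h))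
                  × coefficients t ≋ᶜ combine γ δ (substitute a b c d (coefficients g)) (substitute a b c d (coefficients h))) → Equivalent F R S
        build (α , β , γ , δ , det′≉0 , es , et) =
          -- `act` substitutes the adjugate of its second matrix; the adjugate of this one is (a, b;
          -- c, d) up to double signs.
          mob α β γ δ , mob d (- b) (- c) a ,
          nonzero-resp (+-congˡ (sym (-x≈x _))) det′≉0 ,
          nonzero-resp (trans (+-cong (*-comm a d) (trans (*-cong (sym (-x≈x b)) (sym (-x≈x c))) (sym (-x≈x _)))) refl) det≉0 ,
          at same-fraction
          where
          open Action R cubicR α β γ δ d (- b) (- c) a
          combine-congᶜ : ∀ x y {g g′ h h′} → g ≋ᶜ g′ → h ≋ᶜ h′ → combine x y g h ≋ᶜ combine x y g′ h′
          combine-congᶜ x y (cubic-≈ a b c d) (cubic-≈ a′ b′ c′ d′) = cubic-≈ (go a a′) (go b b′) (go c c′) (go d d′)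
            where
            go : ∀ {p p′ q q′} → p ≈ p′ → q ≈ q′ → x * p + y * q ≈ x * p′ + y * q′
            go e f = +-cong (*-congˡ e) (*-congˡ f)
          moved≋ : ∀ g → substitute a b c d g ≋ᶜ moved g
          moved≋ g = substitute-cong g refl (x≈−−x b) (x≈−−x c) refl
          s≈ : s ≈ᵖ toPoly target-g
          s≈ = P.trans (toPoly-coefficients s deg-g) (toPoly-cong (≋ᶜ-trans es (combine-congᶜ α β (moved≋ _) (moved≋ _))))
          t≈ : t ≈ᵖ toPoly target-h
          t≈ = P.trans (toPoly-coefficients t deg-h) (toPoly-cong (≋ᶜ-trans et (combine-congᶜ γ δ (moved≋ _) (moved≋ _))))
          X = proj₁ (act F (mob α β γ δ) (mob d (- b) (- c) a) R)
          Y = proj₂ (act F (mob α β γ δ) (mob d (- b) (- c) a) R)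
          same-fraction : s *ᵖ Y ≈ᵖ X *ᵖ t
          same-fraction = P.trans (P.*-cong s≈ act-h)
            (P.trans (S.solve 3 (λ x y z → x :* (y :* z) ⊜ y :* x :* z) (toPoly target-g) (powₚ F m k) (toPoly target-h))
            (P.sym (P.*-cong act-g t≈)))

  -- Cross-multiplication makes the transformed pair a multiple κ of the coprime pair (s , t), so
  -- the Plücker vectors differ by κ². As s has degree exactly 3, κ is a constant.
  equivalent⇒pencil : ∀ R S → Cubicᴿ R → Cubicᴿ S → ¬ (coeff F (proj₁ S) 3 ≈ 0#) → Equivalent F R S → pencil R ⇝ pencil S
  equivalent⇒pencil R@(g , h) S@(s , t) cubicR cubicS s₃≉0 (mob α β γ δ , mob a b c d , det′≉0 , det≉0 , e) =
    R⇝T ⨾ same T≋ ⨾ ⇝-sym (scales (κ ²) κ²≉0)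
    where
    open Action R cubicR α β γ δ a b c d
    open Cubicᴿ cubicS
    X = proj₁ (act F (mob α β γ δ) (mob a b c d) R)
    Y = proj₂ (act F (mob α β γ δ) (mob a b c d) R)
    det≉0₂ : ¬ (d * a + (- b) * (- c) ≈ 0#)
    det≉0₂ = nonzero-resp (+-cong (*-comm a d) (trans (-x≈x _) (sym (*-cong (-x≈x b) (-x≈x c))))) det≉0
    m-degree : ∃ (HasDegree m)
    m-degree = linear-degree (- c) a (λ { (a≈0 , -c≈0) →
      det≉0₂ (trans (+-cong (trans (*-congˡ a≈0) (zeroʳ d)) (trans (*-congˡ -c≈0) (zeroʳ _))) (+-identityˡ 0#)) })
    cross : s *ᵖ toPoly target-h ≈ᵖ toPoly target-g *ᵖ t
    cross = cancel-power m-degree k (s *ᵖ toPoly target-h) (toPoly target-g *ᵖ t)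
      (P.trans (S.solve 3 (λ mk s y → mk :* (s :* y) ⊜ s :* (mk :* y)) (powₚ F m k) s (toPoly target-h))
      (P.trans (P.*-congˡ {s} (P.sym act-h)) (P.trans (pointwise e)
      (P.trans (P.*-congʳ {t} act-g) (*-assocᵖ (powₚ F m k) (toPoly target-g) t)))))
    prop = proportional {s} {t} {toPoly target-g} {toPoly target-h} (cubicᴿ-bézout cubicS) (s₃≉0 , deg-g) (toPoly-degree target-g) cross
    κ = proj₁ prop
    scaled : ∀ {x} {y} → toPoly x ≈ᵖ C κ *ᵖ y → x ≋ᶜ combine κ 0# (coefficients y) (coefficients y)
    scaled {x} {y} eq = cubic-≈ (entry 0) (entry 1) (entry 2) (entry 3)
      where
      entry : ∀ i → coeff F (toPoly x) i ≈ κ * coeff F y i + 0# * coeff F y i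
      entry i = trans (at eq i) (trans (sym (at (scale-as-* κ y) i)) (trans (coeff-scale κ y i)
        (sym (trans (+-congˡ (zeroˡ _)) (+-identityʳ _)))))
    R⇝T : pencil R ⇝ wedge target-g target-h
    R⇝T = substitute⇝ d (- b) (- c) a (coefficients g) (coefficients h) det≉0₂ ⨾
      combines-wedge α β γ δ (nonzero-resp (+-congˡ (-x≈x _)) det′≉0)
    T≋ : wedge target-g target-h ≋ scaleᵖ (κ ²) (pencil S)
    T≋ = ≋-trans (wedge-cong (scaled (proj₁ (proj₂ prop))) (scaled (proj₂ (proj₂ prop)))) (plücker-≈ (square _ _ _ _) (square _ _ _ _) (square _ _ _ _) (square _ _ _ _) (square _ _ _ _) (square _ _ _ _))
      where
      square : ∀ x y z w → (κ * x + 0# * x) * (κ * w + 0# * w) + (κ * y + 0# * y) * (κ * z + 0# * z) ≈ κ ² * (x * w + y * z)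
      square = solve 5 (λ κ x y z w → (κ :* x :+ 𝟎 :* x) :* (κ :* w :+ 𝟎 :* w) :+ (κ :* y :+ 𝟎 :* y) :* (κ :* z :+ 𝟎 :* z)
        ⊜ κ E.² :* (x :* w :+ y :* z)) κ
    -- Otherwise the resultant of the transformed pencil would vanish, but it is a unit times that
    -- of R.
    κ²≉0 : ¬ (κ ² ≈ 0#)
    κ²≉0 κ²≈0 = nonzero-resp (resultant-cong T≋) res-T≉0 (trans
      (solve 7 (λ k a b c d e f → E.resultant (E.scaleᵖ k (plücker a b c d e f)) ⊜ k :* (k E.² :* E.resultant (plücker a b c d e f)))
        (κ ²) (p₀₁ w) (p₀₂ w) (p₀₃ w) (p₁₂ w) (p₁₃ w) (p₂₃ w))
      (trans (*-congʳ κ²≈0) (zeroˡ _)))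
      where
      w = pencil S
      inv = ⇝-invariants R⇝T
      ν≉0 = proj₁ (proj₂ inv)
      res-T≉0 : ¬ (resultant (wedge target-g target-h) ≈ 0#)
      res-T≉0 = nonzero-resp (sym (proj₂ (proj₂ (proj₂ inv))))
        (*-nonzero (*-nonzero (*-nonzero ν≉0 ν≉0) ν≉0) (Cubicᴿ.resultant≉0 cubicR))

-- Ramification indices from fibre forms and the Wronskian

module Ramification (K : CommutativeRing 0ℓ 0ℓ) (isField : IsField K)
  (1+1≈0 : HasChar2 K) where

  open CommutativeRing K hiding (zero)
  open FieldProperties K isField
  open Char2 K 1+1≈0
  open Forms K
  open Pencils K isField 1+1≈0
  open PolyRing K

  evaluate-cong : ∀ {g h} x y → g ≋ᶜ h → evaluate g x y ≈ evaluate h x y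
  evaluate-cong x y (cubic-≈ a b c d) = +-cong (+-cong (+-cong (*-congʳ a) (*-congʳ b)) (*-congʳ c)) (*-congʳ d)

  -- Base change acts on coefficient lists entry by entry, giving lists of several lengths with
  -- entries like `ι 0#`. The computations use a fixed cubic in their place.
  record Represents (g : Cubic Carrier) (p : Poly K) : Set where
    constructor represents
    field
      coefficients≋ : coefficients p ≋ᶜ g
      degree≤3      : DegLe K p 3

  fibreForm≈ : ∀ {g h} p q P → Represents g p → Represents h q →
               fibreForm K (p , q) P ≈ᵖ toPoly (fibre g h (proj₁ (proj₁ P)) (proj₂ (proj₁ P)))
  fibreForm≈ {g} {h} p q ((x , y) , _) (represents eg@(cubic-≈ g₀ g₁ g₂ g₃) deg-p) (represents eh@(cubic-≈ h₀ h₁ h₂ h₃) deg-q) = pointwise λ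
    { 0 → trans (term 0) (go g₀ h₀) ; 1 → trans (term 1) (go g₁ h₁) ; 2 → trans (term 2) (go g₂ h₂) ; 3 → trans (term 3) (go g₃ h₃)
    ; i@(suc (suc (suc (suc _)))) → trans (term i) (trans
        (+-cong (trans (*-congˡ (deg-p i high)) (zeroʳ _)) (trans (*-congˡ (deg-q i high)) (zeroʳ _))) (+-identityˡ 0#)) }
    where
    H = evalHom3 K q x y
    G = evalHom3 K p x y
    high : ∀ {i} → 3 < suc (suc (suc (suc i)))
    high = s≤s (s≤s (s≤s (s≤s z≤n)))
    term : ∀ i → coeff K (scale K H p +ᵖ scale K (- G) q) i ≈ H * coeff K p i + - G * coeff K q i
    term i = trans (coeff-+ (scale K H p) (scale K (- G) q) i) (+-cong (coeff-scale H p i) (coeff-scale (- G) q i))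
    go : ∀ {u u′ v v′} → u ≈ u′ → v ≈ v′ → H * u + - G * v ≈ evaluate h x y * u′ + - evaluate g x y * v′
    go e f = +-cong (*-cong (evaluate-cong x y eh) e) (*-cong (-‿cong (evaluate-cong x y eg)) f)

  RamIndexᶜ : Cubic Carrier → Cubic Carrier → Pt K → ℕ → Set
  RamIndexᶜ g h P m = LinPowDivides K P m (toPoly Φ) × ¬ LinPowDivides K P (suc m) (toPoly Φ)
    where Φ = fibre g h (proj₁ (proj₁ P)) (proj₂ (proj₁ P))

  linPowDivides-resp : ∀ P m {p q} → p ≈ᵖ q → LinPowDivides K P m p → LinPowDivides K P m q
  linPowDivides-resp ((x , y) , _) m e (m≤3 , Q , deg , d) = m≤3 , Q , deg , λ i → trans (d i) (at e i)

  ramIndex : ∀ {g h} p q P m → Represents g p → Represents h q → RamIndexᶜ g h P m → RamIndex K (p , q) P m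
  ramIndex p q P m rp rq (d , nd) =
    linPowDivides-resp P m (Sum.sym (fibreForm≈ p q P rp rq)) d ,
    nd ∘ linPowDivides-resp P (suc m) (fibreForm≈ p q P rp rq)

  linear : ∀ q₀ q₁ → DegLe K (q₀ ∷ q₁ ∷ []) 1
  linear q₀ q₁ 0 ()
  linear q₀ q₁ 1 (s≤s ())
  linear q₀ q₁ (suc (suc i)) _ = refl

  constant : ∀ q₀ → DegLe K (q₀ ∷ []) 0
  constant q₀ 0 ()
  constant q₀ (suc i) _ = refl

  quadratic : ∀ q₀ q₁ q₂ → DegLe K (q₀ ∷ q₁ ∷ q₂ ∷ []) 2
  quadratic q₀ q₁ q₂ 0 ()
  quadratic q₀ q₁ q₂ 1 (s≤s ())
  quadratic q₀ q₁ q₂ 2 (s≤s (s≤s ()))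
  quadratic q₀ q₁ q₂ (suc (suc (suc i))) _ = refl

  linear⁻ : ∀ Q → DegLe K Q 1 → Q ≈ᵖ coeff K Q 0 ∷ coeff K Q 1 ∷ []
  linear⁻ Q deg = pointwise λ { 0 → refl ; 1 → refl ; (suc (suc i)) → deg _ (s≤s (s≤s z≤n)) }

  constant⁻ : ∀ Q → DegLe K Q 0 → Q ≈ᵖ coeff K Q 0 ∷ []
  constant⁻ Q deg = pointwise λ { 0 → refl ; (suc i) → deg _ (s≤s z≤n) }

  power-product : ∀ {n} → Exp n → Exp n → ℕ → List (Exp n) → List (Exp n)
  power-product {n} x y m Q = _*ₚ_ R (powₚ R (:- x ∷ y ∷ []) m) Q
    where R = expRing n

  entry : ∀ {n} → ℕ → List (Exp n) → Exp n
  entry {n} i p = coeff (expRing n) p i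

  -- The quotient has the Bézout matrix of the pencil as its coefficients.
  divides-once : ∀ g h P → LinPowDivides K P 1 (toPoly (fibre g h (proj₁ (proj₁ P)) (proj₂ (proj₁ P))))
  divides-once g@(cubic a b c d) h@(cubic a′ b′ c′ d′) ((x , y) , _) = s≤s z≤n , bézoutian (wedge g h) x y , quadratic _ _ _ ,
    solveₚ 10 (λ x y → onCubic λ g → onCubic λ h →
      power-product x y 1 (E.bézoutian (E.wedge g h) x y) ⊜ E.toPoly (E.fibre g h x y)) x y a b c d a′ b′ c′ d′

  -- A double zero of H(P) G - G(P) H at P kills both partial derivatives there, which are y W(P) and x W(P).
  unramified : ∀ g h P → ¬ (wronskian (wedge g h) (proj₁ (proj₁ P)) (proj₂ (proj₁ P)) ≈ 0#) → RamIndexᶜ g h P 1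
  unramified g@(cubic a b c d) h@(cubic a′ b′ c′ d′) P@((x , y) , xy≉0) W≉0 = divides-once g h P , λ { (_ , Q , deg , e) →
    let q₀ = coeff K Q 0
        q₁ = coeff K Q 1
        l² = powₚ K (- x ∷ y ∷ []) 2
        φ : ∀ i → coeff K (l² *ᵖ (q₀ ∷ q₁ ∷ [])) i ≈ coeff K (toPoly (fibre g h x y)) i
        φ i = trans (at (*-congˡᵖ l² (Sum.sym (linear⁻ Q deg))) i) (e i)
    in xy≉0
      ( *-cancelˡ-0 W≉0 (trans
          (solve 10 (λ x y → onCubic λ g → onCubic λ h → let φ = E.fibre g h x y in
            E.wronskian (E.wedge g h) x y :* x ⊜ c₀ φ :* y E.² :+ c₂ φ :* x E.²) x y a b c d a′ b′ c′ d′)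
          (trans (+-cong (*-congʳ (sym (φ 0))) (*-congʳ (sym (φ 2))))
            (solve 4 (λ q₀ q₁ x y → entry 0 (power-product x y 2 (q₀ ∷ q₁ ∷ [])) :* y E.² :+ entry 2 (power-product x y 2 (q₀ ∷ q₁ ∷ [])) :* x E.² ⊜ 𝟎) q₀ q₁ x y)))
      , *-cancelˡ-0 W≉0 (trans
          (solve 10 (λ x y → onCubic λ g → onCubic λ h → let φ = E.fibre g h x y in
            E.wronskian (E.wedge g h) x y :* y ⊜ c₁ φ :* y E.² :+ c₃ φ :* x E.²) x y a b c d a′ b′ c′ d′)
          (trans (+-cong (*-congʳ (sym (φ 1))) (*-congʳ (sym (φ 3))))
            (solve 4 (λ q₀ q₁ x y → entry 1 (power-product x y 2 (q₀ ∷ q₁ ∷ [])) :* y E.² :+ entry 3 (power-product x y 2 (q₀ ∷ q₁ ∷ [])) :* x E.² ⊜ 𝟎) q₀ q₁ x y)))) }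

  not-four : ∀ P Φ → ¬ LinPowDivides K P 4 Φ
  not-four ((x , y) , _) Φ (s≤s (s≤s (s≤s ())) , _)

  affine : Carrier → Pt K
  affine r = (r , 1#) , (1≉0 ∘ proj₂)

  infinity : Pt K
  infinity = (1# , 0#) , (1≉0 ∘ proj₁)

  -- Since (x + r)² = x² + r², the two conditions say that the form is (x² + r²)(φ₃ x + φ₂).
  double-affine : ∀ φ r → c₀ φ ≈ r ² * c₂ φ → c₁ φ ≈ r ² * c₃ φ → LinPowDivides K (affine r) 2 (toPoly φ)
  double-affine (cubic φ₀ φ₁ φ₂ φ₃) r e₀ e₁ = s≤s (s≤s z≤n) , φ₂ ∷ φ₃ ∷ [] , linear φ₂ φ₃ , λ
    { 0 → trans (solve 3 (λ r a b → entry 0 (power-product r 𝟏 2 (a ∷ b ∷ [])) ⊜ r E.² :* a) r φ₂ φ₃) (sym e₀)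
    ; 1 → trans (solve 3 (λ r a b → entry 1 (power-product r 𝟏 2 (a ∷ b ∷ [])) ⊜ r E.² :* b) r φ₂ φ₃) (sym e₁)
    ; 2 → solve 3 (λ r a b → entry 2 (power-product r 𝟏 2 (a ∷ b ∷ [])) ⊜ a) r φ₂ φ₃
    ; 3 → solve 3 (λ r a b → entry 3 (power-product r 𝟏 2 (a ∷ b ∷ [])) ⊜ b) r φ₂ φ₃
    ; (suc (suc (suc (suc i)))) → refl }

  triple-affine : ∀ φ r → c₀ φ ≈ r ² * c₂ φ → c₁ φ ≈ r ² * c₃ φ → c₂ φ ≈ r * c₃ φ → LinPowDivides K (affine r) 3 (toPoly φ)
  triple-affine (cubic φ₀ φ₁ φ₂ φ₃) r e₀ e₁ e₂ = s≤s (s≤s (s≤s z≤n)) , φ₃ ∷ [] , constant φ₃ , λ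
    { 0 → trans (solve 2 (λ r a → entry 0 (power-product r 𝟏 3 (a ∷ [])) ⊜ r E.² :* (r :* a)) r φ₃) (trans (*-congˡ (sym e₂)) (sym e₀))
    ; 1 → trans (solve 2 (λ r a → entry 1 (power-product r 𝟏 3 (a ∷ [])) ⊜ r E.² :* a) r φ₃) (sym e₁)
    ; 2 → trans (solve 2 (λ r a → entry 2 (power-product r 𝟏 3 (a ∷ [])) ⊜ r :* a) r φ₃) (sym e₂)
    ; 3 → solve 2 (λ r a → entry 3 (power-product r 𝟏 3 (a ∷ [])) ⊜ a) r φ₃
    ; (suc (suc (suc (suc i)))) → refl }

  -- In a multiple of (x + r)³ = x³ + r x² + r² x + r³ the coefficient of x² is r times the leading
  -- one.
  not-triple-affine : ∀ φ r → ¬ (c₂ φ ≈ r * c₃ φ) → ¬ LinPowDivides K (affine r) 3 (toPoly φ)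
  not-triple-affine φ r φ₂≉ (_ , Q , deg , e) = φ₂≉ (trans (sym (matches 2)) (trans
    (solve 2 (λ r a → entry 2 (power-product r 𝟏 3 (a ∷ [])) ⊜ r :* entry 3 (power-product r 𝟏 3 (a ∷ []))) r (coeff K Q 0))
    (*-congˡ (matches 3))))
    where
    matches : ∀ i → coeff K (powₚ K (- r ∷ 1# ∷ []) 3 *ᵖ (coeff K Q 0 ∷ [])) i ≈ coeff K (toPoly φ) i
    matches i = trans (at (*-congˡᵖ (powₚ K (- r ∷ 1# ∷ []) 3) (Sum.sym (constant⁻ Q deg))) i) (e i)

  -- The linear form of the point at infinity is Y up to sign, so a power of it divides exactly when
  -- the top coefficients vanish.
  double-infinity : ∀ φ → c₂ φ ≈ 0# → c₃ φ ≈ 0# → LinPowDivides K infinity 2 (toPoly φ)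
  double-infinity (cubic φ₀ φ₁ φ₂ φ₃) e₂ e₃ = s≤s (s≤s z≤n) , φ₀ ∷ φ₁ ∷ [] , linear φ₀ φ₁ , λ
    { 0 → solve 2 (λ a b → entry 0 (power-product 𝟏 𝟎 2 (a ∷ b ∷ [])) ⊜ a) φ₀ φ₁
    ; 1 → solve 2 (λ a b → entry 1 (power-product 𝟏 𝟎 2 (a ∷ b ∷ [])) ⊜ b) φ₀ φ₁
    ; 2 → trans (solve 2 (λ a b → entry 2 (power-product 𝟏 𝟎 2 (a ∷ b ∷ [])) ⊜ 𝟎) φ₀ φ₁) (sym e₂)
    ; 3 → trans (solve 2 (λ a b → entry 3 (power-product 𝟏 𝟎 2 (a ∷ b ∷ [])) ⊜ 𝟎) φ₀ φ₁) (sym e₃)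
    ; (suc (suc (suc (suc i)))) → refl }

  triple-infinity : ∀ φ → c₁ φ ≈ 0# → c₂ φ ≈ 0# → c₃ φ ≈ 0# → LinPowDivides K infinity 3 (toPoly φ)
  triple-infinity (cubic φ₀ φ₁ φ₂ φ₃) e₁ e₂ e₃ = s≤s (s≤s (s≤s z≤n)) , φ₀ ∷ [] , constant φ₀ , λ
    { 0 → solve 1 (λ a → entry 0 (power-product 𝟏 𝟎 3 (a ∷ [])) ⊜ a) φ₀
    ; 1 → trans (solve 1 (λ a → entry 1 (power-product 𝟏 𝟎 3 (a ∷ [])) ⊜ 𝟎) φ₀) (sym e₁)
    ; 2 → trans (solve 1 (λ a → entry 2 (power-product 𝟏 𝟎 3 (a ∷ [])) ⊜ 𝟎) φ₀) (sym e₂)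
    ; 3 → trans (solve 1 (λ a → entry 3 (power-product 𝟏 𝟎 3 (a ∷ [])) ⊜ 𝟎) φ₀) (sym e₃)
    ; (suc (suc (suc (suc i)))) → refl }

  not-triple-infinity : ∀ φ → ¬ (c₁ φ ≈ 0#) → ¬ LinPowDivides K infinity 3 (toPoly φ)
  not-triple-infinity φ φ₁≉0 (_ , Q , deg , e) = φ₁≉0 (trans
    (sym (trans (at (*-congˡᵖ (powₚ K (- 1# ∷ 0# ∷ []) 3) (Sum.sym (constant⁻ Q deg))) 1) (e 1)))
    (solve 1 (λ a → entry 1 (power-product 𝟏 𝟎 3 (a ∷ [])) ⊜ 𝟎) (coeff K Q 0)))

  Profile : Poly K × Poly K → List ℕ → Set
  Profile R es = ∃ λ (Ps : Fin (length es) → Pt K) →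
      (∀ i j → SamePt K (Ps i) (Ps j) → i ≡ j)
    × (∀ i → RamIndex K R (Ps i) (List.lookup es i))
    × (∀ P → (∀ i → ¬ SamePt K P (Ps i)) → RamIndex K R P 1)

  RamifiedOnlyAt : Cubic Carrier → Cubic Carrier → (Pt K → Set) → Set
  RamifiedOnlyAt g h Away = ∀ P → Away P → ¬ (wronskian (wedge g h) (proj₁ (proj₁ P)) (proj₂ (proj₁ P)) ≈ 0#)

  one-point : ∀ {g h p q} P e → Represents g p → Represents h q → RamIndexᶜ g h P e →
              RamifiedOnlyAt g h (λ X → ¬ SamePt K X P) → Profile (p , q) (e ∷ [])
  one-point {g} {h} {p} {q} P e rp rq index only =
    (λ _ → P) , (λ { 0F 0F _ → ≡.refl }) , (λ { 0F → ramIndex p q P e rp rq index }) ,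
    λ X away → ramIndex p q X 1 rp rq (unramified g h X (only X (away 0F)))

  two-points : ∀ {g h p q} P Q e f → ¬ SamePt K P Q → ¬ SamePt K Q P → Represents g p → Represents h q →
               RamIndexᶜ g h P e → RamIndexᶜ g h Q f →
               RamifiedOnlyAt g h (λ X → ¬ SamePt K X P × ¬ SamePt K X Q) → Profile (p , q) (e ∷ f ∷ [])
  two-points {g} {h} {p} {q} P Q e f P≉Q Q≉P rp rq indexP indexQ only =
    points ,
    (λ { 0F 0F _ → ≡.refl ; 1F 1F _ → ≡.refl ; 0F 1F s → contradiction s P≉Q ; 1F 0F s → contradiction s Q≉P }) ,
    (λ { 0F → ramIndex p q P e rp rq indexP ; 1F → ramIndex p q Q f rp rq indexQ }) ,
    λ X away → ramIndex p q X 1 rp rq (unramified g h X (only X (away 0F , away 1F)))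
    where
    points : Fin 2 → Pt K
    points 0F = P
    points 1F = Q

  affine≉infinity : ∀ r → ¬ SamePt K (affine r) infinity
  affine≉infinity r e = 1≉0 (trans (sym (*-identityˡ 1#)) (trans (sym e) (zeroʳ r)))

  infinity≉affine : ∀ r → ¬ SamePt K infinity (affine r)
  infinity≉affine r e = 1≉0 (trans (sym (*-identityˡ 1#)) (trans e (zeroʳ r)))

  away-infinity : ∀ {P} → ¬ SamePt K P infinity → ¬ (proj₂ (proj₁ P) ≈ 0#)
  away-infinity away y≈0 = away (trans (zeroʳ _) (trans (sym y≈0) (sym (*-identityˡ _))))

  away-affine : ∀ {P} r → ¬ SamePt K P (affine r) → ¬ (proj₁ (proj₁ P) + r * proj₂ (proj₁ P) ≈ 0#)
  away-affine r away e = away (trans (*-identityʳ _) (x+y≈0⇒x≈y e))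

  square≉0 : ∀ {x} → ¬ (x ≈ 0#) → ¬ (x ² ≈ 0#)
  square≉0 x≉0 = *-nonzero x≉0 x≉0

  profile-i : ∀ {p q} → Represents (cubic 0# 0# 0# 1#) p → Represents (cubic 1# 0# 0# 0#) q → Profile (p , q) (3 ∷ 3 ∷ [])
  profile-i rp rq = two-points infinity (affine 0#) 3 3 (infinity≉affine 0#) (affine≉infinity 0#) rp rq
    (triple-infinity φ₁ (solve 0 (c₁ ψ₁ ⊜ 𝟎)) (solve 0 (c₂ ψ₁ ⊜ 𝟎)) (solve 0 (c₃ ψ₁ ⊜ 𝟎)) ,
     not-four infinity (toPoly φ₁))
    (triple-affine φ₂ 0# (solve 0 (c₀ ψ₂ ⊜ 𝟎 E.² :* c₂ ψ₂)) (solve 0 (c₁ ψ₂ ⊜ 𝟎 E.² :* c₃ ψ₂)) (solve 0 (c₂ ψ₂ ⊜ 𝟎 :* c₃ ψ₂)) ,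
     not-four (affine 0#) (toPoly φ₂))
    λ { P@((x , y) , _) (away₁ , away₂) → nonzero-resp
      (solve 2 (λ x y → (x :+ 𝟎 :* y) E.² :* y E.² ⊜
        E.wronskian (E.wedge (cubic 𝟎 𝟎 𝟎 𝟏) (cubic 𝟏 𝟎 𝟎 𝟎)) x y) x y)
      (*-nonzero (square≉0 (away-affine {P} 0# away₂)) (square≉0 (away-infinity {P} away₁))) }
    where
    φ₁ = fibre (cubic 0# 0# 0# 1#) (cubic 1# 0# 0# 0#) 1# 0#
    φ₂ = fibre (cubic 0# 0# 0# 1#) (cubic 1# 0# 0# 0#) 0# 1#
    ψ₁ = E.fibre {0} (cubic 𝟎 𝟎 𝟎 𝟏) (cubic 𝟏 𝟎 𝟎 𝟎) 𝟏 𝟎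
    ψ₂ = E.fibre {0} (cubic 𝟎 𝟎 𝟎 𝟏) (cubic 𝟏 𝟎 𝟎 𝟎) 𝟎 𝟏

  profile-iii : ∀ {p q} → Represents (cubic 0# 0# 1# 1#) p → Represents (cubic 1# 0# 0# 0#) q → Profile (p , q) (3 ∷ 2 ∷ [])
  profile-iii rp rq = two-points infinity (affine 0#) 3 2 (infinity≉affine 0#) (affine≉infinity 0#) rp rq
    (triple-infinity φ₁ (solve 0 (c₁ ψ₁ ⊜ 𝟎)) (solve 0 (c₂ ψ₁ ⊜ 𝟎)) (solve 0 (c₃ ψ₁ ⊜ 𝟎)) ,
     not-four infinity (toPoly φ₁))
    (double-affine φ₂ 0# (solve 0 (c₀ ψ₂ ⊜ 𝟎 E.² :* c₂ ψ₂)) (solve 0 (c₁ ψ₂ ⊜ 𝟎 E.² :* c₃ ψ₂)) ,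
     not-triple-affine φ₂ 0# (λ e → 1≉0 (trans (solve 0 (𝟏 ⊜ c₂ ψ₂)) (trans e (zeroˡ _)))))
    λ { P@((x , y) , _) (away₁ , away₂) → nonzero-resp
      (solve 2 (λ x y → (x :+ 𝟎 :* y) E.² :* y E.² ⊜
        E.wronskian (E.wedge (cubic 𝟎 𝟎 𝟏 𝟏) (cubic 𝟏 𝟎 𝟎 𝟎)) x y) x y)
      (*-nonzero (square≉0 (away-affine {P} 0# away₂)) (square≉0 (away-infinity {P} away₁))) }
    where
    φ₁ = fibre (cubic 0# 0# 1# 1#) (cubic 1# 0# 0# 0#) 1# 0#
    φ₂ = fibre (cubic 0# 0# 1# 1#) (cubic 1# 0# 0# 0#) 0# 1#
    ψ₁ = E.fibre {0} (cubic 𝟎 𝟎 𝟏 𝟏) (cubic 𝟏 𝟎 𝟎 𝟎) 𝟏 𝟎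
    ψ₂ = E.fibre {0} (cubic 𝟎 𝟎 𝟏 𝟏) (cubic 𝟏 𝟎 𝟎 𝟎) 𝟎 𝟏

  profile-iv : ∀ β {p q} → ¬ (β ≈ 0#) → Represents (cubic β 0# 0# 1#) p → Represents (cubic 0# 1# 0# 0#) q → Profile (p , q) (2 ∷ [])
  profile-iv β β≉0 rp rq = one-point infinity 2 rp rq
    (double-infinity φ (solve 1 (λ β → c₂ (ψ β) ⊜ 𝟎) β) (solve 1 (λ β → c₃ (ψ β) ⊜ 𝟎) β) ,
     not-triple-infinity φ (nonzero-resp (solve 1 (λ β → 𝟏 ⊜ c₁ (ψ β)) β) 1≉0))
    λ { P@((x , y) , _) away → nonzero-resp
      (solve 3 (λ β x y → β :* (y E.² :* y E.²) ⊜
        E.wronskian (E.wedge (cubic β 𝟎 𝟎 𝟏) (cubic 𝟎 𝟏 𝟎 𝟎)) x y) β x y)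
      (*-nonzero β≉0 (square≉0 (square≉0 (away-infinity {P} away)))) }
    where
    φ = fibre (cubic β 0# 0# 1#) (cubic 0# 1# 0# 0#) 1# 0#
    ψ : ∀ {n} → Exp n → Cubic (Exp n)
    ψ β = E.fibre (cubic β 𝟎 𝟎 𝟏) (cubic 𝟎 𝟏 𝟎 𝟎) 𝟏 𝟎

  profile-v : ∀ c {p q} → ¬ (c ≈ 0#) → ¬ (c ≈ 1#) → Represents (cubic c 0# 0# 1#) p → Represents (cubic c 1# 0# 0#) q → Profile (p , q) (2 ∷ 2 ∷ [])
  profile-v c c≉0 c≉1 rp rq = two-points infinity (affine 1#) 2 2 (infinity≉affine 1#) (affine≉infinity 1#) rp rq
    (double-infinity φ₁ (solve 1 (λ c → c₂ (ψ₁ c) ⊜ 𝟎) c) (solve 1 (λ c → c₃ (ψ₁ c) ⊜ 𝟎) c) ,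
     not-triple-infinity φ₁ (nonzero-resp (solve 1 (λ c → 𝟏 ⊜ c₁ (ψ₁ c)) c) 1≉0))
    (double-affine φ₂ 1# (solve 1 (λ c → c₀ (ψ₂ c) ⊜ 𝟏 E.² :* c₂ (ψ₂ c)) c) (solve 1 (λ c → c₁ (ψ₂ c) ⊜ 𝟏 E.² :* c₃ (ψ₂ c)) c) ,
     -- The obstruction to a triple point at 1 is c + 1.
     not-triple-affine φ₂ 1# (λ e → c≉1 (x+y≈0⇒x≈y (trans (solve 1 (λ c → c :+ 𝟏 ⊜ c₂ (ψ₂ c) :+ 𝟏 :* c₃ (ψ₂ c)) c)
       (trans (+-congʳ e) (x+x≈0 _))))))
    λ { P@((x , y) , _) (away₁ , away₂) → nonzero-resp
      (solve 3 (λ c x y → c :* ((x :+ 𝟏 :* y) E.² :* y E.²) ⊜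
        E.wronskian (E.wedge (cubic c 𝟎 𝟎 𝟏) (cubic c 𝟏 𝟎 𝟎)) x y) c x y)
      (*-nonzero c≉0 (*-nonzero (square≉0 (away-affine {P} 1# away₂)) (square≉0 (away-infinity {P} away₁)))) }
    where
    φ₁ = fibre (cubic c 0# 0# 1#) (cubic c 1# 0# 0#) 1# 0#
    φ₂ = fibre (cubic c 0# 0# 1#) (cubic c 1# 0# 0#) 1# 1#
    ψ₁ ψ₂ : ∀ {n} → Exp n → Cubic (Exp n)
    ψ₁ c = E.fibre (cubic c 𝟎 𝟎 𝟏) (cubic c 𝟏 𝟎 𝟎) 𝟏 𝟎
    ψ₂ c = E.fibre (cubic c 𝟎 𝟎 𝟏) (cubic c 𝟏 𝟎 𝟎) 𝟏 𝟏

  module Inert (b ρ : Carrier) where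

    φ : Carrier → Cubic Carrier
    φ r = fibre (inert-g b ρ) (inert-h b ρ) r 1#

    ψ : ∀ {n} → Exp n → Exp n → Exp n → Cubic (Exp n)
    ψ b ρ r = E.fibre (E.inert-g b ρ) (E.inert-h b ρ) r 𝟏

    double₁ : LinPowDivides K (affine ρ) 2 (toPoly (φ ρ))
    double₁ = double-affine (φ ρ) ρ
      (solve 2 (λ b ρ → c₀ (ψ b ρ ρ) ⊜ ρ E.² :* c₂ (ψ b ρ ρ)) b ρ) (solve 2 (λ b ρ → c₁ (ψ b ρ ρ) ⊜ ρ E.² :* c₃ (ψ b ρ ρ)) b ρ)

    double₂ : LinPowDivides K (affine (ρ + 1#)) 2 (toPoly (φ (ρ + 1#)))
    double₂ = double-affine (φ (ρ + 1#)) (ρ + 1#)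
      (solve 2 (λ b ρ → let r = ρ :+ 𝟏 in c₀ (ψ b ρ r) ⊜ r E.² :* c₂ (ψ b ρ r)) b ρ)
      (solve 2 (λ b ρ → let r = ρ :+ 𝟏 in c₁ (ψ b ρ r) ⊜ r E.² :* c₃ (ψ b ρ r)) b ρ)

    -- The obstruction to a triple point, the same at both conjugate roots. Its zero b = 0 separates
    -- (ii) from (vi), and its zero b = 1 is excluded.
    defect₁ : c₂ (φ ρ) + ρ * c₃ (φ ρ) ≈ (b + 1#) * b
    defect₁ = solve 2 (λ b ρ → c₂ (ψ b ρ ρ) :+ ρ :* c₃ (ψ b ρ ρ) ⊜ (b :+ 𝟏) :* b) b ρ

    defect₂ : c₂ (φ (ρ + 1#)) + (ρ + 1#) * c₃ (φ (ρ + 1#)) ≈ (b + 1#) * b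
    defect₂ = solve 2 (λ b ρ → let r = ρ :+ 𝟏 in c₂ (ψ b ρ r) :+ r :* c₃ (ψ b ρ r) ⊜ (b :+ 𝟏) :* b) b ρ

    not-triple : ∀ r → c₂ (φ r) + r * c₃ (φ r) ≈ (b + 1#) * b → ¬ (b ≈ 0#) → ¬ (b ≈ 1#) → ¬ LinPowDivides K (affine r) 3 (toPoly (φ r))
    not-triple r defect b≉0 b≉1 = not-triple-affine (φ r) r λ e →
      *-nonzero (b≉1 ∘ x+y≈0⇒x≈y) b≉0 (trans (sym defect) (trans (+-congʳ e) (x+x≈0 _)))

    distinct₁ : ¬ SamePt K (affine ρ) (affine (ρ + 1#))
    distinct₁ e = 1≉0 (trans (solve 1 (λ ρ → 𝟏 ⊜ ρ :* 𝟏 :+ (ρ :+ 𝟏) :* 𝟏) ρ) (trans (+-congʳ e) (x+x≈0 _)))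

    distinct₂ : ¬ SamePt K (affine (ρ + 1#)) (affine ρ)
    distinct₂ e = distinct₁ (sym e)

    only : RamifiedOnlyAt (inert-g b ρ) (inert-h b ρ) (λ X → ¬ SamePt K X (affine ρ) × ¬ SamePt K X (affine (ρ + 1#)))
    only P@((x , y) , _) (away₁ , away₂) = nonzero-resp
      (solve 4 (λ b ρ x y → (x :+ ρ :* y) E.² :* (x :+ (ρ :+ 𝟏) :* y) E.² ⊜ E.wronskian (E.wedge (E.inert-g b ρ) (E.inert-h b ρ)) x y) b ρ x y)
      (*-nonzero (square≉0 (away-affine {P} ρ away₁)) (square≉0 (away-affine {P} (ρ + 1#) away₂)))

    profile-vi : ∀ {p q} → ¬ (b ≈ 0#) → ¬ (b ≈ 1#) → Represents (inert-g b ρ) p → Represents (inert-h b ρ) q → Profile (p , q) (2 ∷ 2 ∷ [])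
    profile-vi b≉0 b≉1 rp rq = two-points (affine ρ) (affine (ρ + 1#)) 2 2 distinct₁ distinct₂ rp rq
      (double₁ , not-triple ρ defect₁ b≉0 b≉1) (double₂ , not-triple (ρ + 1#) defect₂ b≉0 b≉1) only

  profile-ii : ∀ ρ {p q} → Represents (inert-g 0# ρ) p → Represents (inert-h 0# ρ) q → Profile (p , q) (3 ∷ 3 ∷ [])
  profile-ii ρ rp rq = two-points (affine ρ) (affine (ρ + 1#)) 3 3 distinct₁ distinct₂ rp rq
    (triple-affine (φ ρ) ρ
      (solve 1 (λ ρ → c₀ (ψ 𝟎 ρ ρ) ⊜ ρ E.² :* c₂ (ψ 𝟎 ρ ρ)) ρ)
      (solve 1 (λ ρ → c₁ (ψ 𝟎 ρ ρ) ⊜ ρ E.² :* c₃ (ψ 𝟎 ρ ρ)) ρ)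
      (x+y≈0⇒x≈y (trans defect₁ (zeroʳ _))) ,
     not-four (affine ρ) (toPoly (φ ρ)))
    (triple-affine (φ (ρ + 1#)) (ρ + 1#)
      (solve 1 (λ ρ → let r = ρ :+ 𝟏 in c₀ (ψ 𝟎 ρ r) ⊜ r E.² :* c₂ (ψ 𝟎 ρ r)) ρ)
      (solve 1 (λ ρ → let r = ρ :+ 𝟏 in c₁ (ψ 𝟎 ρ r) ⊜ r E.² :* c₃ (ψ 𝟎 ρ r)) ρ)
      (x+y≈0⇒x≈y (trans defect₂ (zeroʳ _))) ,
     not-four (affine (ρ + 1#)) (toPoly (φ (ρ + 1#))))
    only
    where open Inert 0# ρ

-- The classification theorem

module NormalForms (n : ℕ) (F : CommutativeRing 0ℓ 0ℓ) (isField : IsField F)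
  (1+1≈0 : HasChar2 F)
  (_≟0 : ZeroTest F)
  (square-root : ∀ x → ∃ λ y → CommutativeRing._≈_ F (CommutativeRing._*_ F y y) x)
  (σ : CommutativeRing.Carrier F)
  (℘-or : ∀ τ → (∃ λ y → CommutativeRing._≈_ F (CommutativeRing._+_ F (CommutativeRing._*_ F y y) y) τ)
              ⊎ (∃ λ y → CommutativeRing._≈_ F (CommutativeRing._+_ F (CommutativeRing._*_ F y y) y) (CommutativeRing._+_ F τ σ)))
  (σ∉℘ : ∀ y → ¬ CommutativeRing._≈_ F (CommutativeRing._+_ F (CommutativeRing._*_ F y y) y) σ)
  (θ : CommutativeRing.Carrier F) (θ-nonCube : IsSquareℕ (2 ^ n) → NonCube F θ)
  (cubeClass : ∀ b → ¬ CommutativeRing._≈_ F b (CommutativeRing.0# F) → CubeClasses.CubeClass n F θ b) where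

  open CommutativeRing F hiding (zero)
  open FieldProperties F isField
  open Char2 F 1+1≈0
  open Forms F
  open Pencils F isField 1+1≈0
  open Coprimality F isField 1+1≈0 _≟0 using (square-zero; zeroFrom-length)
  open Orbits F isField 1+1≈0 _≟0 square-root σ
  open Equivalence F isField 1+1≈0 _≟0
  open CubeClasses n F

  wedge-i : wedge (cubic 0# 0# 0# 1#) (cubic 1# 0# 0# 0#) ≋ pencil-i
  wedge-i = solveᵖ 0 (E.wedge (cubic 𝟎 𝟎 𝟎 𝟏) (cubic 𝟏 𝟎 𝟎 𝟎)
    ⊜ plücker 𝟎 𝟎 𝟏 𝟎 𝟎 𝟎)

  wedge-iii : wedge (cubic 0# 0# 1# 1#) (cubic 1# 0# 0# 0#) ≋ pencil-iii
  wedge-iii = solveᵖ 0 (E.wedge (cubic 𝟎 𝟎 𝟏 𝟏) (cubic 𝟏 𝟎 𝟎 𝟎)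
    ⊜ plücker 𝟎 𝟏 𝟏 𝟎 𝟎 𝟎)

  wedge-iv : ∀ β → wedge (cubic β 0# 0# 1#) (cubic 0# 1# 0# 0#) ≋ pencil-iv β
  wedge-iv β = solveᵖ 1 (λ β → E.wedge (cubic β 𝟎 𝟎 𝟏) (cubic 𝟎 𝟏 𝟎 𝟎)
    ⊜ plücker β 𝟎 𝟎 𝟎 𝟏 𝟎) β

  wedge-v : ∀ c → wedge (cubic c 0# 0# 1#) (cubic c 1# 0# 0#) ≋ pencil-v c
  wedge-v c = solveᵖ 1 (λ c → E.wedge (cubic c 𝟎 𝟎 𝟏) (cubic c 𝟏 𝟎 𝟎)
    ⊜ plücker c 𝟎 c 𝟎 𝟏 𝟎) c

  wedge-vi : ∀ b → wedge (cubic ((b + 1#) * σ) σ b 1#) (cubic (b + 1# + σ) 1# 1# 0#) ≋ pencil-vi b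
  wedge-vi b = solveᵖ 2 (λ σ b → E.wedge (cubic ((b :+ 𝟏) :* σ) σ b 𝟏) (cubic (b :+ 𝟏 :+ σ) 𝟏 𝟏 𝟎)
    ⊜ plücker (σ E.²) (σ :+ b E.² :+ b) (b :+ 𝟏 :+ σ) (σ :+ b) 𝟏 𝟏) σ b

  form : NF F n → RatExpr F
  form = nfForm F n σ θ

  normal : NF F n → Plücker Carrier
  normal nf-i         = pencil-i
  normal nf-ii        = pencil-vi 0#
  normal nf-iii       = pencil-iii
  normal nf-iv₁       = pencil-iv 1#
  normal (nf-iv₂ _)   = pencil-iv θ
  normal (nf-iv₃ _)   = pencil-iv (θ * θ)
  normal (nf-v c _ _) = pencil-v c
  normal (nf-vi b _ _) = pencil-vi b

  pencil-form : ∀ i → pencil (form i) ≋ normal i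
  pencil-form nf-i          = wedge-i
  pencil-form nf-ii         = ≋-trans
    (wedge-cong (cubic-≈ (sym (trans (*-congʳ (+-identityˡ 1#)) (*-identityˡ σ))) refl refl refl)
                (cubic-≈ (trans (+-comm σ 1#) (+-congʳ (sym (+-identityˡ 1#)))) refl refl refl))
    (wedge-vi 0#)
  pencil-form nf-iii        = wedge-iii
  pencil-form nf-iv₁        = wedge-iv 1#
  pencil-form (nf-iv₂ _)    = wedge-iv θ
  pencil-form (nf-iv₃ _)    = wedge-iv (θ * θ)
  pencil-form (nf-v c _ _)  = wedge-v c
  pencil-form (nf-vi b _ _) = wedge-vi b

  θ≉0 : IsSquareℕ (2 ^ n) → ¬ (θ ≈ 0#)
  θ≉0 square θ≈0 = θ-nonCube square (0# , trans (zeroʳ _) (sym θ≈0))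

  resultant-i : resultant pencil-i ≈ 1#
  resultant-i = solve 0 (E.resultant (plücker 𝟎 𝟎 𝟏 𝟎 𝟎 𝟎) ⊜ 𝟏)

  resultant-iii : resultant pencil-iii ≈ 1#
  resultant-iii = solve 0 (E.resultant (plücker 𝟎 𝟏 𝟏 𝟎 𝟎 𝟎) ⊜ 𝟏)

  resultant-iv : ∀ β → resultant (pencil-iv β) ≈ β
  resultant-iv β = solve 1 (λ β → E.resultant (plücker β 𝟎 𝟎 𝟎 𝟏 𝟎) ⊜ β) β

  resultant-v : ∀ c → resultant (pencil-v c) ≈ c * (c + 1#) ²
  resultant-v c = solve 1 (λ c → E.resultant (plücker c 𝟎 c 𝟎 𝟏 𝟎) ⊜ c :* (c :+ 𝟏) E.²) c

  Δ-vi : ∀ b → Δ (pencil-vi b) ≈ 1#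
  Δ-vi b = solve 2 (λ σ b → b :+ 𝟏 :+ σ :+ (σ :+ b) ⊜ 𝟏) σ b

  ⁴≉0 : ∀ {x} → ¬ (x ≈ 0#) → ¬ (x ⁴ ≈ 0#)
  ⁴≉0 x≉0 = *-nonzero (*-nonzero x≉0 x≉0) (*-nonzero x≉0 x≉0)

  resultant-normal : ∀ i → ¬ (resultant (normal i) ≈ 0#)
  resultant-normal nf-i         = nonzero-resp (sym resultant-i) 1≉0
  resultant-normal nf-ii        = nonzero-resp (sym (resultant-vi 0#)) (⁴≉0 (nonzero-resp (sym (+-identityˡ 1#)) 1≉0))
  resultant-normal nf-iii       = nonzero-resp (sym resultant-iii) 1≉0
  resultant-normal nf-iv₁       = nonzero-resp (sym (resultant-iv 1#)) 1≉0
  resultant-normal (nf-iv₂ s)   = nonzero-resp (sym (resultant-iv θ)) (θ≉0 s)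
  resultant-normal (nf-iv₃ s)   = nonzero-resp (sym (resultant-iv (θ * θ))) (*-nonzero (θ≉0 s) (θ≉0 s))
  resultant-normal (nf-v c c≉0 c≉1) =
    nonzero-resp (sym (resultant-v c)) (*-nonzero c≉0 (*-nonzero (c≉1 ∘ x+y≈0⇒x≈y) (c≉1 ∘ x+y≈0⇒x≈y)))
  resultant-normal (nf-vi b b≉0 b≉1) = nonzero-resp (sym (resultant-vi b)) (⁴≉0 (b≉1 ∘ x+y≈0⇒x≈y))

  short : ∀ p → length p ≤ 4 → DegLe F p 3
  short p l i 3<i = zeroFrom-length p i (ℕ.≤-trans l 3<i)

  1≤4 : 1 ≤ 4
  1≤4 = s≤s z≤n
  2≤4 : 2 ≤ 4
  2≤4 = s≤s (s≤s z≤n)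
  3≤4 : 3 ≤ 4
  3≤4 = s≤s (s≤s (s≤s z≤n))

  form-degrees : ∀ i → DegLe F (proj₁ (form i)) 3 × DegLe F (proj₂ (form i)) 3 × ¬ (coeff F (proj₁ (form i)) 3 ≈ 0#)
  form-degrees nf-i          = short _ ℕ.≤-refl , short _ 1≤4 , 1≉0
  form-degrees nf-ii         = short _ ℕ.≤-refl , short _ 3≤4 , 1≉0
  form-degrees nf-iii        = short _ ℕ.≤-refl , short _ 1≤4 , 1≉0
  form-degrees nf-iv₁        = short _ ℕ.≤-refl , short _ 2≤4 , 1≉0
  form-degrees (nf-iv₂ _)    = short _ ℕ.≤-refl , short _ 2≤4 , 1≉0
  form-degrees (nf-iv₃ _)    = short _ ℕ.≤-refl , short _ 2≤4 , 1≉0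
  form-degrees (nf-v _ _ _)  = short _ ℕ.≤-refl , short _ 2≤4 , 1≉0
  form-degrees (nf-vi _ _ _) = short _ ℕ.≤-refl , short _ 3≤4 , 1≉0

  cubic-form : ∀ i → Cubicᴿ (form i)
  cubic-form i = record
    { deg-g       = proj₁ (form-degrees i)
    ; deg-h       = proj₁ (proj₂ (form-degrees i))
    ; leading     = inj₁ (proj₂ (proj₂ (form-degrees i)))
    ; resultant≉0 = nonzero-resp (sym (resultant-cong (pencil-form i))) (resultant-normal i)
    }

  -- A dilation by y multiplies p₀₁ by y and p₁₃ by y⁴; restoring p₁₃ = 1 divides β by y³.
  rescale-iv : ∀ {β γ y} → ¬ (β ≈ 0#) → β ≈ γ * y ³ → pencil-iv β ⇝ pencil-iv γ
  rescale-iv {β} {γ} {y} β≉0 e = dilates y y≉0 ⨾ scales (z ⁴) (⁴≉0 (inverse-nonzero yz≈1)) ⨾ same (plücker-≈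
    (trans (*-congˡ (*-congˡ e)) (trans (solve 3 (λ y z γ → z E.⁴ :* (y :* (γ :* y E.³)) ⊜ (y :* z) E.⁴ :* γ) y z γ) (unit γ)))
    (vanish _) (vanish _) (vanish _)
    (trans (solve 2 (λ y z → z E.⁴ :* (y E.⁴ :* 𝟏) ⊜ (y :* z) E.⁴ :* 𝟏) y z) (unit 1#))
    (vanish _))
    where
    y≉0 : ¬ (y ≈ 0#)
    y≉0 = *-nonzeroʳ (*-nonzeroʳ (nonzero-resp e β≉0))
    z = proj₁ (inverse y y≉0)
    yz≈1 : y * z ≈ 1#
    yz≈1 = proj₂ (inverse y y≉0)
    unit : ∀ x → (y * z) ⁴ * x ≈ x
    unit x = trans (*-congʳ (⁴-cong yz≈1)) (solve 1 (λ x → 𝟏 E.⁴ :* x ⊜ x) x)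
    vanish : ∀ x → z ⁴ * (x * 0#) ≈ 0#
    vanish x = trans (*-congˡ (zeroʳ x)) (zeroʳ _)

  Classified : Plücker Carrier → Set
  Classified p = ∃ λ i → p ⇝ normal i

  classify-iv : ∀ β → ¬ (β ≈ 0#) → CubeClass θ β → Classified (pencil-iv β)
  classify-iv β β≉0 (cube e)         = nf-iv₁ , rescale-iv β≉0 e
  classify-iv β β≉0 (θ-coset s e)    = nf-iv₂ s , rescale-iv β≉0 e
  classify-iv β β≉0 (θ²-coset s e)   = nf-iv₃ s , rescale-iv β≉0 e

  pencil-vi-cong : ∀ {b b′} → b ≈ b′ → pencil-vi b ≋ pencil-vi b′
  pencil-vi-cong e = plücker-≈ refl (+-cong (+-congˡ (²-cong e)) e) (+-congʳ (+-congʳ e)) (+-congˡ e) refl refl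

  classify : ∀ {p} → Orbit p → Classified p
  classify (orbit-i r)           = nf-i , r
  classify (orbit-iii r)         = nf-iii , r
  classify (orbit-iv β β≉0 r)    with classify-iv β β≉0 (cubeClass β β≉0)
  ... | i , s = i , r ⨾ s
  classify (orbit-v c c≉0 c≉1 r) = nf-v c c≉0 c≉1 , r
  classify (orbit-vi b b≉1 r)    with b ≟0
  ... | yes b≈0 = nf-ii , r ⨾ same (pencil-vi-cong b≈0)
  ... | no  b≉0 = nf-vi b b≉0 b≉1 , r

  existence : ∀ R → IsCubic F R → ∃ λ i → Equivalent F R (form i)
  existence R isCubic = proj₁ classified ,
    pencil⇒equivalent R (form (proj₁ classified)) cubicR (cubic-form (proj₁ classified))
      (proj₂ classified ⨾ same (≋-sym (pencil-form (proj₁ classified))))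
    where
    cubicR : Cubicᴿ R
    cubicR = isCubic⇒Cubicᴿ R isCubic
    classified : Classified (pencil R)
    classified = classify (orbit ℘-or σ∉℘ (pencil R)
      (Substitution.relation-wedge F isField 1+1≈0 _≟0 (coefficients (proj₁ R)) (coefficients (proj₂ R)))
      (Cubicᴿ.resultant≉0 cubicR))

  -- Uniqueness of the normal form

  data Kind : Set where
    wildᵏ splitᵏ inertᵏ : Kind

  kind : NF F n → Kind
  kind nf-i          = splitᵏ
  kind nf-ii         = inertᵏ
  kind nf-iii        = splitᵏ
  kind nf-iv₁        = wildᵏ
  kind (nf-iv₂ _)    = wildᵏ
  kind (nf-iv₃ _)    = wildᵏ
  kind (nf-v _ _ _)  = splitᵏ
  kind (nf-vi _ _ _) = inertᵏ

  OfKind : Kind → Plücker Carrier → Set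
  OfKind wildᵏ  p = Δ p ≈ 0#
  OfKind splitᵏ p = ¬ (Δ p ≈ 0#) × HasRoot p
  OfKind inertᵏ p = ¬ (Δ p ≈ 0#) × ¬ HasRoot p

  root-at-∞ : ∀ a b c d e → HasRoot (plücker a b c d e 0#)
  root-at-∞ a b c d e = 1# , 0# , (1≉0 ∘ proj₁) ,
    solve 5 (λ a b c d e → E.wronskian (plücker a b c d e 𝟎) 𝟏 𝟎 ⊜ 𝟎) a b c d e

  -- The Wronskian is the square of σ y² + x y + x², and a rational zero would write σ as z² + z.
  inert-no-root : ∀ b → ¬ HasRoot (pencil-vi b)
  inert-no-root b (x , y , xy≉0 , w) = go (y ≟0)
    where
    form≈0 : σ * y ² + x * y + x ² ≈ 0#
    form≈0 = square-zero (trans (solve 4 (λ σ b x y → (σ :* y E.² :+ x :* y :+ x E.²) E.²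
      ⊜ E.wronskian (plücker (σ E.²) (σ :+ b E.² :+ b) (b :+ 𝟏 :+ σ) (σ :+ b) 𝟏 𝟏) x y) σ b x y) w)
    go : Dec (y ≈ 0#) → ⊥
    go (yes y≈0) = xy≉0 (square-zero (trans (solve 3 (λ σ x y → x E.² ⊜ (σ :* y E.² :+ x :* y :+ x E.²) :+ y :* (σ :* y :+ x)) σ x y)
      (trans (+-cong form≈0 (trans (*-congʳ y≈0) (zeroˡ _))) (+-identityˡ 0#))) , y≈0)
    go (no y≉0) = σ∉℘ z (x+y≈0⇒x≈y (*-cancelˡ-0 (*-nonzero y≉0 y≉0) (trans
      (solve 3 (λ σ z y → y E.² :* (z E.² :+ z :+ σ) ⊜ σ :* y E.² :+ z :* y :* y :+ (z :* y) E.²) σ z y)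
      (trans (+-cong (+-congˡ (*-congʳ zy≈x)) (²-cong zy≈x)) form≈0))))
      where
      z = proj₁ (quotient x y y≉0)
      zy≈x : z * y ≈ x
      zy≈x = proj₂ (quotient x y y≉0)

  ofKind : ∀ i → OfKind (kind i) (normal i)
  ofKind nf-i          = nonzero-resp (sym (+-identityʳ 1#)) 1≉0 , root-at-∞ 0# 0# 1# 0# 0#
  ofKind nf-ii         = nonzero-resp (sym (Δ-vi 0#)) 1≉0 , inert-no-root 0#
  ofKind nf-iii        = nonzero-resp (sym (+-identityʳ 1#)) 1≉0 , root-at-∞ 0# 1# 1# 0# 0#
  ofKind nf-iv₁        = +-identityˡ 0#
  ofKind (nf-iv₂ _)    = +-identityˡ 0#
  ofKind (nf-iv₃ _)    = +-identityˡ 0#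
  ofKind (nf-v c c≉0 _) = nonzero-resp (sym (+-identityʳ c)) c≉0 , root-at-∞ c 0# c 0# 1#
  ofKind (nf-vi b _ _) = nonzero-resp (sym (Δ-vi b)) 1≉0 , inert-no-root b

  kind-invariant : ∀ k l {p q} → OfKind k p → OfKind l q → p ⇝ q → k ≡ l
  kind-invariant wildᵏ  wildᵏ  _ _ _ = ≡.refl
  kind-invariant splitᵏ splitᵏ _ _ _ = ≡.refl
  kind-invariant inertᵏ inertᵏ _ _ _ = ≡.refl
  kind-invariant wildᵏ  splitᵏ Δ≈0 (Δ≉0 , _) r = contradiction (⇝-Δ≈0 r Δ≈0) Δ≉0
  kind-invariant wildᵏ  inertᵏ Δ≈0 (Δ≉0 , _) r = contradiction (⇝-Δ≈0 r Δ≈0) Δ≉0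
  kind-invariant splitᵏ wildᵏ  (Δ≉0 , _) Δ≈0 r = contradiction Δ≈0 (⇝-Δ≉0 r Δ≉0)
  kind-invariant inertᵏ wildᵏ  (Δ≉0 , _) Δ≈0 r = contradiction Δ≈0 (⇝-Δ≉0 r Δ≉0)
  kind-invariant splitᵏ inertᵏ (_ , root) (_ , no-root) r = contradiction (⇝-root r root) no-root
  kind-invariant inertᵏ splitᵏ (_ , no-root) (_ , root) r = contradiction (⇝-root (⇝-sym r) root) no-root

  wild-cosets : ∀ {β γ} → pencil-iv β ⇝ pencil-iv γ → ∃ λ ν → γ ≈ ν ³ * β
  wild-cosets {β} {γ} r = let ν , _ , _ , e = ⇝-invariants r in
    ν , trans (sym (resultant-iv γ)) (trans e (*-congˡ (resultant-iv β)))

  -- Invariance of Res/Δ³ with denominators cleared, which avoids dividing by Δ.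
  absolute-invariant : ∀ {p q} → p ⇝ q → resultant q * Δ p ³ ≈ resultant p * Δ q ³
  absolute-invariant {p} {q} r = let ν , _ , eΔ , eR = ⇝-invariants r in trans (*-congʳ eR)
    (trans (solve 3 (λ ν x y → ν E.³ :* x :* y E.³ ⊜ x :* (ν :* y) E.³) ν (resultant p) (Δ p)) (*-congˡ (³-cong (sym eΔ))))

  unit-absolute-invariant : ∀ {p q} → Δ p ≈ 1# → resultant p ≈ 1# → p ⇝ q → resultant q ≈ Δ q ³
  unit-absolute-invariant {p} {q} Δ≈1 res≈1 r = begin
    resultant q            ≈⟨ solve 1 (λ x → x ⊜ x :* 𝟏 E.³) _ ⟩
    resultant q * 1# ³     ≈⟨ *-congˡ (³-cong Δ≈1) ⟨
    resultant q * Δ p ³    ≈⟨ absolute-invariant r ⟩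
    resultant p * Δ q ³    ≈⟨ *-congʳ res≈1 ⟩
    1# * Δ q ³             ≈⟨ *-identityˡ _ ⟩
    Δ q ³                  ∎
    where open SetoidReasoning setoid

  -- The invariant would have to be 1, but c (c + 1)² = c³ forces c = 0 in characteristic two.
  not-v : ∀ {p} c → ¬ (c ≈ 0#) → Δ p ≈ 1# → resultant p ≈ 1# → ¬ (p ⇝ pencil-v c)
  not-v c c≉0 Δ≈1 res≈1 r = c≉0 (trans (solve 1 (λ c → c ⊜ c :* (c :+ 𝟏) E.² :+ (c :+ 𝟎) E.³) c)
    (trans (+-congʳ (trans (sym (resultant-v c)) (unit-absolute-invariant Δ≈1 res≈1 r))) (x+x≈0 _)))

  -- Comparing (c + 1)²/c² with (d + 1)²/d² leaves c d (c + d)² = 0 after clearing denominators.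
  v-injective : ∀ c d → ¬ (c ≈ 0#) → ¬ (d ≈ 0#) → pencil-v c ⇝ pencil-v d → c ≈ d
  v-injective c d c≉0 d≉0 r = x+y≈0⇒x≈y (square-zero (*-cancelˡ-0 (*-nonzero c≉0 d≉0) (trans
    (solve 2 (λ c d → c :* d :* (c :+ d) E.² ⊜ d :* (d :+ 𝟏) E.² :* (c :+ 𝟎) E.³ :+ c :* (c :+ 𝟏) E.² :* (d :+ 𝟎) E.³) c d)
    (trans (+-cong (*-congʳ (sym (resultant-v d))) (*-congʳ (sym (resultant-v c))))
      (trans (+-congʳ (absolute-invariant r)) (x+x≈0 _))))))

  vi-injective : ∀ b b′ → pencil-vi b ⇝ pencil-vi b′ → b ≈ b′
  vi-injective b b′ r = x+y≈0⇒x≈y (square-zero (square-zero (trans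
    (solve 2 (λ b b′ → (b :+ b′) E.² E.² ⊜ (b′ :+ 𝟏) E.⁴ :* 𝟏 E.³ :+ (b :+ 𝟏) E.⁴ :* 𝟏 E.³) b b′)
    (trans (+-cong (*-cong (sym (resultant-vi b′)) (³-cong (sym (Δ-vi b)))) (*-cong (sym (resultant-vi b)) (³-cong (sym (Δ-vi b′)))))
      (trans (+-congʳ (absolute-invariant r)) (x+x≈0 _))))))

  -- The pencil of (iii) has p₀₂ = 1 and p₀₁ = 0, against the first equation of `TwoCubes`.
  i≠iii : ¬ (pencil-i ⇝ pencil-iii)
  i≠iii r = 1≉0 (trans (solve 0 (𝟏 ⊜ 𝟏 E.²)) (trans
    (proj₁ (⇝-twoCubes r (solve 0 (𝟎 E.² ⊜ 𝟎 :* (𝟏 :+ 𝟎)) , solve 0 (𝟎 E.² ⊜ 𝟎 :* (𝟏 :+ 𝟎)))))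
    (zeroˡ _)))

  cube-cancel : ∀ {ν x y} → ¬ (y ≈ 0#) → y ≈ ν ³ * x → ∃ λ w → x ≈ y * w ³
  cube-cancel {ν} {x} {y} y≉0 e = w , sym (trans (*-congʳ e) (trans
      (solve 3 (λ ν x w → ν E.³ :* x :* w E.³ ⊜ (ν :* w) E.³ :* x) ν x w)
      (trans (*-congʳ (³-cong νw≈1)) (solve 1 (λ x → 𝟏 E.³ :* x ⊜ x) x))))
    where
    ν≉0 : ¬ (ν ≈ 0#)
    ν≉0 = *-nonzeroʳ (*-nonzeroˡ (nonzero-resp e y≉0))
    w = proj₁ (inverse ν ν≉0)
    νw≈1 : ν * w ≈ 1#
    νw≈1 = proj₂ (inverse ν ν≉0)

  iv₁≠iv₂ : IsSquareℕ (2 ^ n) → ¬ (pencil-iv 1# ⇝ pencil-iv θ)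
  iv₁≠iv₂ s r = let ν , e = wild-cosets r in
    θ-nonCube s (ν , sym (trans e (*-identityʳ _)))

  iv₂≠iv₃ : IsSquareℕ (2 ^ n) → ¬ (pencil-iv θ ⇝ pencil-iv (θ * θ))
  iv₂≠iv₃ s r = let ν , e = wild-cosets r in
    θ-nonCube s (ν , x+y≈0⇒x≈y (*-cancelˡ-0 (θ≉0 s) (trans
    (solve 2 (λ θ c → θ :* (c :+ θ) ⊜ θ :* θ :+ c :* θ) θ (ν ³)) (trans (+-congʳ e) (x+x≈0 _)))))

  -- From θ² = ν³ follows θ³ = ν³ θ, so θ would be the cube of θ / ν.
  iv₁≠iv₃ : IsSquareℕ (2 ^ n) → ¬ (pencil-iv 1# ⇝ pencil-iv (θ * θ))
  iv₁≠iv₃ s r =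
    let ν , e  = wild-cosets r
        w , θ≈ = cube-cancel {ν} {θ} {θ ³} (*-nonzero (*-nonzero (θ≉0 s) (θ≉0 s)) (θ≉0 s)) (*-congʳ (trans e (*-identityʳ _)))
    in θ-nonCube s (θ * w , sym (trans θ≈ (solve 2 (λ θ w → θ E.³ :* w E.³ ⊜ (θ :* w) E.³) θ w)))

  same-normal : ∀ i j → kind i ≡ kind j → normal i ⇝ normal j → SameNF F n i j
  same-normal nf-i nf-i _ r = tt
  same-normal nf-i nf-iii _ r = i≠iii r
  same-normal nf-i (nf-v c c≉0 _) _ r = not-v c c≉0 (+-identityʳ 1#) resultant-i r
  same-normal nf-iii nf-i _ r = i≠iii (⇝-sym r)
  same-normal nf-iii nf-iii _ r = tt
  same-normal nf-iii (nf-v c c≉0 _) _ r = not-v c c≉0 (+-identityʳ 1#) resultant-iii r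
  same-normal (nf-v c c≉0 _) nf-i _ r = not-v c c≉0 (+-identityʳ 1#) resultant-i (⇝-sym r)
  same-normal (nf-v c c≉0 _) nf-iii _ r = not-v c c≉0 (+-identityʳ 1#) resultant-iii (⇝-sym r)
  same-normal (nf-v c c≉0 _) (nf-v d d≉0 _) _ r = v-injective c d c≉0 d≉0 r
  same-normal nf-ii nf-ii _ r = tt
  same-normal nf-ii (nf-vi b b≉0 _) _ r = b≉0 (sym (vi-injective 0# b r))
  same-normal (nf-vi b b≉0 _) nf-ii _ r = b≉0 (vi-injective b 0# r)
  same-normal (nf-vi b _ _) (nf-vi b′ _ _) _ r = vi-injective b b′ r
  same-normal nf-iv₁ nf-iv₁ _ r = tt
  same-normal nf-iv₁ (nf-iv₂ s) _ r = iv₁≠iv₂ s r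
  same-normal nf-iv₁ (nf-iv₃ s) _ r = iv₁≠iv₃ s r
  same-normal (nf-iv₂ s) nf-iv₁ _ r = iv₁≠iv₂ s (⇝-sym r)
  same-normal (nf-iv₂ _) (nf-iv₂ _) _ r = tt
  same-normal (nf-iv₂ s) (nf-iv₃ _) _ r = iv₂≠iv₃ s r
  same-normal (nf-iv₃ s) nf-iv₁ _ r = iv₁≠iv₃ s (⇝-sym r)
  same-normal (nf-iv₃ s) (nf-iv₂ _) _ r = iv₂≠iv₃ s (⇝-sym r)
  same-normal (nf-iv₃ _) (nf-iv₃ _) _ r = tt

  uniqueness : ∀ R → IsCubic F R → ∀ i j → Equivalent F R (form i) → Equivalent F R (form j) → SameNF F n i j
  uniqueness R isCubic i j ei ej = same-normal i j (kind-invariant (kind i) (kind j) (ofKind i) (ofKind j) r) r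
    where
    to-normal : ∀ i → Equivalent F R (form i) → pencil R ⇝ normal i
    to-normal i e = equivalent⇒pencil R (form i) (isCubic⇒Cubicᴿ R isCubic) (cubic-form i) (proj₂ (proj₂ (form-degrees i))) e
      ⨾ same (pencil-form i)
    r : normal i ⇝ normal j
    r = ⇝-sym (to-normal i ei) ⨾ to-normal j ej

  isCubic-form : ∀ i → IsCubic F (form i)
  isCubic-form i = Cubicᴿ⇒isCubic (form i) (cubic-form i)

  -- Ramification of the normal forms over an algebraically closed field

  module _ (K : CommutativeRing 0ℓ 0ℓ) (isFieldᴷ : IsField K) (closed : AlgClosed K)
    (ι : Carrier → CommutativeRing.Carrier K) (hom : IsRingHom F K ι) where

    private
      module K = CommutativeRing K
      open RingMorphisms.IsRingHomomorphism hom

      ι0 : ι 0# K.≈ K.0#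
      ι0 = 0#-homo

      ι1 : ι 1# K.≈ K.1#
      ι1 = 1#-homo

      1+1≈0ᴷ : K.1# K.+ K.1# K.≈ K.0#
      1+1≈0ᴷ = K.trans (K.+-cong (K.sym ι1) (K.sym ι1)) (K.trans (K.sym (+-homo 1# 1#)) (K.trans (⟦⟧-cong 1+1≈0) ι0))

      ι≉0 : ∀ {x} → ¬ (x ≈ 0#) → ¬ (ι x K.≈ K.0#)
      ι≉0 {x} x≉0 ιx≈0 with inverse x x≉0
      ... | y , xy≈1 = IsField.1≉0 isFieldᴷ (K.trans (K.sym ι1) (K.trans (⟦⟧-cong (sym xy≈1))
        (K.trans (*-homo x y) (K.trans (K.*-congʳ ιx≈0) (K.zeroˡ _)))))

      ι≉1 : ∀ {x} → ¬ (x ≈ 1#) → ¬ (ι x K.≈ K.1#)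
      ι≉1 {x} x≉1 ιx≈1 = ι≉0 (x≉1 ∘ x+y≈0⇒x≈y) (K.trans (+-homo x 1#) (K.trans (K.+-cong ιx≈1 ι1) 1+1≈0ᴷ))

    open Ramification K isFieldᴷ 1+1≈0ᴷ

    private
      open Pencils K isFieldᴷ 1+1≈0ᴷ using () renaming (_≋ᶜ_ to _≋ᴷ_; cubic-≈ to cubic-≈ᴷ)
      open Forms K using () renaming (_² to _²ᴷ)

      ρ : K.Carrier
      -- With the leading 1 that `AlgClosed` appends, this list is x² + x + σ. Its roots ρ and ρ + 1
      -- are the ramification points of (ii) and (vi).
      ρ = proj₁ (closed (ι σ ∷ K.1# ∷ []) (s≤s z≤n))

      module Kᶜ = Char2 K 1+1≈0ᴷ

      ρ-root : ι σ K.≈ ρ ²ᴷ K.+ ρ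
      ρ-root = Kᶜ.x+y≈0⇒x≈y (K.trans (Kᶜ.solve 2 (λ s r → s :+ (r :* r :+ r) ⊜ s :+ r :* (𝟏 :+ r :* (𝟏 :+ r :* 𝟎))) (ι σ) ρ)
        (proj₂ (closed (ι σ ∷ K.1# ∷ []) (s≤s z≤n))))

      beyond : ∀ p i → length p ≤ i → coeff K (List.map ι p) i K.≈ K.0#
      beyond []      i       _         = K.refl
      beyond (x ∷ p) (suc i) (s≤s l≤i) = beyond p i l≤i

      represent : ∀ p {g} → length p ≤ 4 → Forms.coefficients K (List.map ι p) ≋ᴷ g → Represents g (List.map ι p)
      represent p l e = represents e (λ i 3<i → beyond p i (ℕ.≤-trans l 3<i))

      one : Represents (cubic K.1# K.0# K.0# K.0#) (ι 1# ∷ [])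
      one = represent (1# ∷ []) 1≤4 (cubic-≈ᴷ ι1 K.refl K.refl K.refl)

      iv-profile : ∀ β → ¬ (β ≈ 0#) → RamProfile F K ι ((β ∷ 0# ∷ 0# ∷ 1# ∷ []) , (0# ∷ 1# ∷ [])) (2 ∷ [])
      iv-profile β β≉0 = profile-iv (ι β) (ι≉0 β≉0)
        (represent (β ∷ 0# ∷ 0# ∷ 1# ∷ []) ℕ.≤-refl (cubic-≈ᴷ K.refl ι0 ι0 ι1))
        (represent (0# ∷ 1# ∷ []) 2≤4 (cubic-≈ᴷ ι0 ι1 K.refl K.refl))

    ramification : ∀ i → RamProfile F K ι (form i) (nfRam F n i)
    ramification nf-i = profile-i (represent (proj₁ (form nf-i)) ℕ.≤-refl (cubic-≈ᴷ ι0 ι0 ι0 ι1)) one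
    ramification nf-ii = profile-ii ρ
      (represent (proj₁ (form nf-ii)) ℕ.≤-refl
        (cubic-≈ᴷ (K.trans ρ-root (K.sym (K.trans (K.*-congʳ (K.+-identityˡ _)) (K.*-identityˡ _)))) ρ-root ι0 ι1))
      (represent (proj₂ (form nf-ii)) 3≤4
        (cubic-≈ᴷ (K.trans (+-homo σ 1#) (K.trans (K.+-comm _ _) (K.+-cong (K.trans ι1 (K.sym (K.+-identityˡ _))) ρ-root))) ι1 ι1 K.refl))
    ramification nf-iii = profile-iii (represent (proj₁ (form nf-iii)) ℕ.≤-refl (cubic-≈ᴷ ι0 ι0 ι1 ι1)) one
    ramification nf-iv₁ = iv-profile 1# 1≉0
    ramification (nf-iv₂ s) = iv-profile θ (θ≉0 s)
    ramification (nf-iv₃ s) = iv-profile (θ * θ) (*-nonzero (θ≉0 s) (θ≉0 s))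
    ramification (nf-v c c≉0 c≉1) = profile-v (ι c) (ι≉0 c≉0) (ι≉1 c≉1)
      (represent (c ∷ 0# ∷ 0# ∷ 1# ∷ []) ℕ.≤-refl (cubic-≈ᴷ K.refl ι0 ι0 ι1))
      (represent (c ∷ 1# ∷ []) 2≤4 (cubic-≈ᴷ K.refl ι1 K.refl K.refl))
    ramification (nf-vi b b≉0 b≉1) = Inert.profile-vi (ι b) ρ (ι≉0 b≉0) (ι≉1 b≉1)
      (represent (proj₁ (form (nf-vi b b≉0 b≉1))) ℕ.≤-refl
        (cubic-≈ᴷ (K.trans (*-homo (b + 1#) σ) (K.*-cong (K.trans (+-homo b 1#) (K.+-congˡ ι1)) ρ-root)) ρ-root K.refl ι1))
      (represent (proj₂ (form (nf-vi b b≉0 b≉1))) 3≤4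
        (cubic-≈ᴷ (K.trans (+-homo (b + 1#) σ) (K.+-cong (K.trans (+-homo b 1#) (K.+-congˡ ι1)) ρ-root)) ι1 ι1 K.refl))

theorem7p2 : (n : ℕ) (F : CommutativeRing 0ℓ 0ℓ) → IsField F → HasSize F (2 ^ n)
    → CommutativeRing._≈_ F (CommutativeRing._+_ F (CommutativeRing.1# F) (CommutativeRing.1# F)) (CommutativeRing.0# F)
    → (σ : CommutativeRing.Carrier F) → CommutativeRing._≈_ F (trace F n σ) (CommutativeRing.1# F)
    → (θ : CommutativeRing.Carrier F) → (IsSquareℕ (2 ^ n) → NonCube F θ)
    → ((R : RatExpr F) → IsCubic F R
    → Σ (NF F n) (λ i → Equivalent F R (nfForm F n σ θ i))
    × ((i j : NF F n) → Equivalent F R (nfForm F n σ θ i) → Equivalent F R (nfForm F n σ θ j) → SameNF F n i j))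
    × ((i : NF F n) → IsCubic F (nfForm F n σ θ i)
    × ((K : CommutativeRing 0ℓ 0ℓ) → IsField K → AlgClosed K
    → (ι : CommutativeRing.Carrier F → CommutativeRing.Carrier K) → IsRingHom F K ι
    → RamProfile F K ι (nfForm F n σ θ i) (nfRam F n i)))
theorem7p2 n F isField size 1+1≈0 σ σ₁ θ θ-nonCube =
  (λ R isCubic → existence R isCubic , uniqueness R isCubic) ,
  (λ i → isCubic-form i , λ K isFieldᴷ closed ι hom → ramification K isFieldᴷ closed ι hom i)
  where
  open CommutativeRing F hiding (zero)
  open EvenField n F isField size 1+1≈0
  -- The trace of τ is 0 or 1 and that of σ is 1, so either τ or τ + σ has trace 0 and is of the
  -- form y² + y.
  ℘-or : ∀ τ → (∃ λ y → y * y + y ≈ τ) ⊎ (∃ λ y → y * y + y ≈ τ + σ)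
  ℘-or τ with trace-bit τ
  ... | inj₁ τ₀ = inj₁ (artin-schreier σ τ σ₁ τ₀)
  ... | inj₂ τ₁ = inj₂ (artin-schreier σ (τ + σ) σ₁ (trans (trace-+ n τ σ) (trans (+-cong τ₁ σ₁) 1+1≈0)))
  σ∉℘ : ∀ y → ¬ (y * y + y ≈ σ)
  σ∉℘ y e = IsField.1≉0 isField (trans (sym σ₁) (trans (sym (trace-cong n e)) (trace-℘ y)))
  open NormalForms n F isField 1+1≈0 _≟0 square-root σ ℘-or σ∉℘ θ θ-nonCube (λ b b≉0 → cubeClass θ b b≉0 θ-nonCube)
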